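{- Let $r\ge 3$ and $s\ge 1$ be integers. There exist $\delta>0$ and an integer $N>0$ such that for all integers $n_1\ge\dots\ge n_r$ with $n_r\ge N$ and $n_1\le(1+\delta)n_r$ the following holds. If $r\ne 4$, then $$m_0(s,n_1,\dots,n_r) = s\prod_{\ell=1}^{r-1}n_\ell-\prod_{\ell=1}^{r-1}(n_\ell-1)+n_r-s.$$ If $r=4$, then $$m_0(s,n_1,\dots,n_4)=\max\left\{s\prod_{\ell=1}^{3}n_\ell-\prod_{\ell=1}^{3}(n_\ell-1)+n_4-s,\ n_1\bigl(s n_2n_3-(n_2-1)(n_3-1)+n_4-s\bigr)\right\}.$$
   Context: For $1\le \ell\le r$ let $X_\ell=\{1,\dots,n_\ell\}$. An $r$-partite $r$-graph is a family $\mathcal{F}\subseteq X_1\times\dots\times X_r$; for $A$ in this product, $A[\ell]$ denotes its $\ell$-th coordinate. Viewing $X_1,\dots,X_r$ as pairwise disjoint sets, each sequence $A$ is identified with the $r$-element set $\{A[1],\dots,A[r]\}\subseteq X_1\sqcup\dots\sqcup X_r$. Two sequences $A,B$ are disjoint if $A[\ell]\ne B[\ell]$ for all $\ell$; a matching is a collection of pairwise disjoint members; $\nu(\mathcal{F})$ is the maximum size of a matching in $\mathcal{F}$. A transversal of $\mathcal{F}$ is a set $T\subseteq X_1\sqcup\dots\sqcup X_r$ meeting every member of $\mathcal{F}$, and $\tau(\mathcal{F})$ is the minimum size of a transversal. For $r\ge 3$ and $n_1\ge\dots\ge n_r>s\ge1$, $m_0(s,n_1,\dots,n_r)$ is the maximum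 of $|\mathcal{F}|$ over $\mathcal{F}\subseteq X_1\times\dots\times X_r$ with $\nu(\mathcal{F})\le s<\tau(\mathcal{F})$. -}

module Defs where

open import Data.Nat using (ℕ; zero; suc; _+_; _*_; _∸_; _≤_; _<_; _⊔_)
open import Data.Fin using (Fin; inject₁; fromℕ)
open import Data.Vec using (Vec; lookup)
open import Data.List using (List; length)
open import Data.List.Membership.Propositional using (_∈_)
open import Data.List.Relation.Unary.Unique.Propositional using (Unique)
open import Data.List.Relation.Unary.AllPairs using (AllPairs)
open import Data.Product using (Σ; ∃; _×_; _,_)
open import Relation.Binary.PropositionalEquality using (_≡_; _≢_)

-- Throughout, r = suc k, the parts are X_ℓ = {0,…,n ℓ - 1} (0-indexed
-- version of {1,…,n_ℓ}), and ℓ ranges over Fin r.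

IsSeq : ∀ {r} → (Fin r → ℕ) → Vec ℕ r → Set
IsSeq {r} n A = ∀ (ℓ : Fin r) → lookup A ℓ < n ℓ

-- An r-partite r-graph: a duplicate-free list of sequences.
record Family {r : ℕ} (n : Fin r → ℕ) : Set where
  field
    members  : List (Vec ℕ r)
    valid    : ∀ {A} → A ∈ members → IsSeq n A
    distinct : Unique members
open Family public

size : ∀ {r} {n : Fin r → ℕ} → Family n → ℕ
size F = length (members F)

Disjoint : ∀ {r} → Vec ℕ r → Vec ℕ r → Set
Disjoint {r} A B = ∀ (ℓ : Fin r) → lookup A ℓ ≢ lookup B ℓ

IsMatching : ∀ {r} {n : Fin r → ℕ} → Family n → List (Vec ℕ r) → Set
IsMatching F M = (∀ {A} → A ∈ M → A ∈ members F) × AllPairs Disjoint M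

νAtMost : ∀ {r} {n : Fin r → ℕ} → ℕ → Family n → Set
νAtMost s F = ∀ M → IsMatching F M → length M ≤ s

-- A vertex of X_1 ⊔ … ⊔ X_r is a pair (ℓ , v) with v < n ℓ.
Vertex : ℕ → Set
Vertex r = Fin r × ℕ

IsTransversal : ∀ {r} {n : Fin r → ℕ} → Family n → List (Vertex r) → Set
IsTransversal {r} {n} F T =
  Unique T
  × (∀ {ℓ v} → (ℓ , v) ∈ T → v < n ℓ)
  × (∀ {A} → A ∈ members F → Σ (Fin r) λ ℓ → (ℓ , lookup A ℓ) ∈ T)

τExceeds : ∀ {r} {n : Fin r → ℕ} → ℕ → Family n → Set
τExceeds s F = ∀ T → IsTransversal F T → s < length T

Admissible : ∀ {r} {n : Fin r → ℕ} → ℕ → Family n → Set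
Admissible s F = νAtMost s F × τExceeds s F

M0Is : ∀ {r} → ℕ → (Fin r → ℕ) → ℕ → Set
M0Is s n m =
  (Σ (Family n) λ F → Admissible s F × size F ≡ m)
  × (∀ (F : Family n) → Admissible s F → size F ≤ m)

prod : ∀ k → (Fin k → ℕ) → ℕ
prod zero    f = 1
prod (suc k) f = f Fin.zero * prod k (λ i → f (Fin.suc i))

prodInit : ∀ k → (Fin (suc k) → ℕ) → ℕ
prodInit k n = prod k (λ i → n (inject₁ i))

prodInitPred : ∀ k → (Fin (suc k) → ℕ) → ℕ
prodInitPred k n = prod k (λ i → n (inject₁ i) ∸ 1)

lastN : ∀ k → (Fin (suc k) → ℕ) → ℕ
lastN k n = n (fromℕ k)

-- s ∏ n_ℓ - ∏ (n_ℓ - 1) + n_r - s   (nonnegative in the range considered;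
-- computed with truncated subtraction as (s∏n_ℓ + n_r) ∸ (∏(n_ℓ-1) + s))
mainBound : ∀ k → ℕ → (Fin (suc k) → ℕ) → ℕ
mainBound k s n = (s * prodInit k n + lastN k n) ∸ (prodInitPred k n + s)

altBound4 : ℕ → (Fin 4 → ℕ) → ℕ
altBound4 s n =
  n (Fin.zero) * ((s * n (Fin.suc Fin.zero) * n (Fin.suc (Fin.suc Fin.zero))
                    + n (Fin.suc (Fin.suc (Fin.suc Fin.zero))))
                  ∸ ((n (Fin.suc Fin.zero) ∸ 1) * (n (Fin.suc (Fin.suc Fin.zero)) ∸ 1) + s))

{-# OPTIONS --safe #-}
-- Call a vertex heavy if its degree exceeds s r b^(r-2), where b = n₁ is the largest and m = n_r the smallest part size.
-- A matching avoiding a heavy vertex extends by an edge through it, so deleting a heavy vertex lowers ν; peel heavy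
-- vertices off until none is left. Peeling s of them would give a transversal of size s, and if at most s - 2 are peeled,
-- the light residue has only O(b^(r-2)) edges, which is too few. So s - 1 vertices H are peeled and the residue G is
-- intersecting without a common vertex. Unless all of H lies in one part of size m, the stars of H lose m^(r-2) edges,
-- which outweighs all lower order terms; otherwise one needs the exact maximum of |G| after deleting H from that part.
--
-- For G, a pair of vertices of codegree more than r b^(r-3) meets every edge of G. Following such pairs, either
-- |G| ≤ (r-2) b^(r-2) + O(b^(r-3)), or G is contained in a Hilton–Milner family, or every edge of G contains two
-- vertices of a fixed triple. The last case is of Hilton–Milner type for r = 3, too small for r ≥ 5, and yields the
-- second term of the maximum for r = 4.
module Submission where

open import Defs
open import Data.Nat using (ℕ; zero; suc; _+_; _*_; _∸_; _^_; _≤_; _<_; _⊓_; _⊔_; z≤n; s≤s; _≤?_; _<?_; >-nonZero)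
open import Data.Nat.Properties
open import Data.Nat.Tactic.RingSolver using (solve-∀)
open import Data.Fin using (Fin; fromℕ; cast; inject₁; punchIn; punchOut) renaming (zero to fzero; suc to fsuc; _≤_ to _≤ᶠ_)
open import Data.Fin.Properties using (punchIn-punchOut; punchOut-injective; punchInᵢ≢i; punchIn-injective; ≤fromℕ) renaming (_≟_ to _≟ᶠ_; any? to anyᶠ?; all? to allᶠ?)
open import Data.Vec using (Vec; []; _∷_; lookup; tabulate; tail)
open import Data.Vec.Properties using (lookup∘tabulate)
open import Data.List using (List; []; _∷_; [_]; length; map; filter; upTo; _++_; cartesianProductWith; deduplicate)
open import Data.List.Properties using (length-++; length-map; length-upTo)
open import Data.List.Membership.Propositional using (_∈_; _∉_; find; lose)
open import Data.List.Membership.Propositional.Properties using (∈-∃++; ∈-++⁺ˡ; ∈-++⁺ʳ; ∈-++⁻; ∈-map⁺; ∈-map⁻; ∈-filter⁺; ∈-filter⁻; ∈-upTo⁺; ∈-upTo⁻; ∈-deduplicate⁺; ∈-deduplicate⁻; ∈-cartesianProductWith⁺; ∈-cartesianProductWith⁻)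
open import Data.List.Relation.Unary.Any using (here; there; any?)
open import Data.List.Relation.Unary.All using (All; []; _∷_)
open import Data.List.Relation.Unary.AllPairs using (AllPairs; []; _∷_)
open import Data.List.Relation.Unary.Unique.Propositional using (Unique)
open import Data.Product using (Σ; ∃; _×_; _,_; proj₁; proj₂)
open import Data.Product.Properties using (≡-dec)
open import Data.Sum using (_⊎_; inj₁; inj₂; [_,_]′; swap)
open import Data.Empty using (⊥; ⊥-elim)
open import Function using (_∘_; id)
open import Relation.Nullary using (¬_; Dec; yes; no; ¬?; _×-dec_)
open import Relation.Nullary.Decidable using (from-yes; _→-dec_; _⊎-dec_)
open import Relation.Unary using (Decidable)
open import Relation.Binary.Definitions using (DecidableEquality)
open import Relation.Binary.PropositionalEquality using (_≡_; _≢_; refl; sym; trans; cong; cong₂; subst; subst₂; _≗_; ≢-sym; module ≡-Reasoning)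
import Data.List.Membership.DecPropositional as DecMembership
import Data.List.Relation.Unary.All as All
import Data.List.Relation.Unary.AllPairs as AllPairs
import Data.List.Relation.Unary.AllPairs.Properties as AllPairsₚ
import Data.List.Relation.Unary.Unique.Propositional.Properties as Uniqueₚ
import Data.List.Relation.Unary.Unique.DecPropositional.Properties as DecUniqueₚ

-- Cardinalities

-- Let P be the product of the parts other than the smallest one, and P⁻ the same product with every
-- factor lowered by 1. With s - 1 stars of size at most P set aside, the residue is allowed P - P⁻
-- + m - s edges, where P - P⁻ is about (r-1) m^(r-2). A Hilton-Milner family attains this budget,
-- so no constant factor is spare: b and m must agree up to a factor 1 + 1/q, and any other
-- configuration must fall short by about m^(r-2), through the smaller coefficient r - 2 or through
-- lost star edges. A fixed triple gives about 3 b^(r-2) edges. For r = 3 this is the Hilton-Milner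
-- shape itself; for r > 3 the coefficients 3 and r - 1 tie only at r = 4. There neither shape can
-- be discarded by its leading term, so both counts must be exact. Exactness also concerns the part
-- containing H: deleting H shrinks it, which affects the lower order terms and makes it the best
-- place for a Hilton-Milner centre.

Card≤ : {S : Set} → (S → Set) → ℕ → Set
Card≤ Q D = ∀ {L} → Unique L → (∀ {a} → a ∈ L → Q a) → length L ≤ D

private variable
  S T : Set

∈⇒≢ : ∀ {a : S} {L} {b} → All (a ≢_) L → b ∈ L → b ≢ a
∈⇒≢ a∉ b∈ eq = All.lookup a∉ b∈ (sym eq)

∉⇒All≢ : ∀ {a : S} {L} → a ∉ L → All (a ≢_) L
∉⇒All≢ a∉ = All.tabulate λ { b∈ refl → a∉ b∈ }

Card≤-list : (K : List S) → Card≤ (_∈ K) (length K)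
Card≤-list K {[]} [] L⊆K = z≤n
Card≤-list K {a ∷ L} (a∉L ∷ uL) L⊆K with ∈-∃++ (L⊆K (here refl))
... | ys , zs , refl = begin
    suc (length L)                ≤⟨ s≤s (Card≤-list (ys ++ zs) uL L⊆) ⟩
    suc (length (ys ++ zs))       ≡⟨ cong suc (length-++ ys) ⟩
    suc (length ys + length zs)   ≡⟨ sym (+-suc (length ys) (length zs)) ⟩
    length ys + suc (length zs)   ≡⟨ sym (length-++ ys) ⟩
    length (ys ++ a ∷ zs)         ∎
  where
  open ≤-Reasoning
  L⊆ : ∀ {b} → b ∈ L → b ∈ ys ++ zs
  L⊆ b∈L with ∈-++⁻ ys (L⊆K (there b∈L))
  ... | inj₁ b∈ys         = ∈-++⁺ˡ b∈ys
  ... | inj₂ (here b≡a)   = ⊥-elim (∈⇒≢ a∉L b∈L b≡a)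
  ... | inj₂ (there b∈zs) = ∈-++⁺ʳ ys b∈zs

Card≤-mono : {P Q : S → Set} {D E : ℕ} → (∀ {a} → P a → Q a) → D ≤ E → Card≤ Q D → Card≤ P E
Card≤-mono P⊆Q D≤E cQ uL L⊆P = ≤-trans (cQ uL (P⊆Q ∘ L⊆P)) D≤E

Card≤-⊆ : {P Q : S → Set} {D : ℕ} → (∀ {a} → P a → Q a) → Card≤ Q D → Card≤ P D
Card≤-⊆ P⊆Q = Card≤-mono P⊆Q ≤-refl

Card≤-∅ : {P : S → Set} {D : ℕ} → (∀ {a} → ¬ P a) → Card≤ P D
Card≤-∅ ¬P {[]}    uL L⊆P = z≤n
Card≤-∅ ¬P {a ∷ L} uL L⊆P = ⊥-elim (¬P (L⊆P (here refl)))

-- The disjunct returned for an element decides its side, so neither `P` nor `Q` has to be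
-- decidable. This is what lets `Card≤` be applied to arbitrary predicates.
split-list : {P Q : S → Set} (L : List S) → Unique L → (∀ {a} → a ∈ L → P a ⊎ Q a) →
  Σ (List S) λ L₁ → Σ (List S) λ L₂ →
    (Unique L₁ × (∀ {a} → a ∈ L₁ → a ∈ L × P a)) ×
    (Unique L₂ × (∀ {a} → a ∈ L₂ → a ∈ L × Q a)) ×
    length L ≡ length L₁ + length L₂
split-list [] uL f = [] , [] , ([] , λ ()) , ([] , λ ()) , refl
split-list {S = S} (a ∷ L) (a∉L ∷ uL) f with split-list L uL (f ∘ there) | f (here refl)
... | L₁ , L₂ , (u₁ , s₁) , (u₂ , s₂) , eq | inj₁ Pa =
  a ∷ L₁ , L₂ , (∉⇒All≢ (λ a∈ → ∈⇒≢ a∉L (proj₁ (s₁ a∈)) refl) ∷ u₁ ,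
    λ { (here refl) → here refl , Pa ; (there b∈) → there (proj₁ (s₁ b∈)) , proj₂ (s₁ b∈) }) ,
  (u₂ , λ b∈ → there (proj₁ (s₂ b∈)) , proj₂ (s₂ b∈)) , cong suc eq
... | L₁ , L₂ , (u₁ , s₁) , (u₂ , s₂) , eq | inj₂ Qa =
  L₁ , a ∷ L₂ , (u₁ , λ b∈ → there (proj₁ (s₁ b∈)) , proj₂ (s₁ b∈)) ,
  (∉⇒All≢ (λ a∈ → ∈⇒≢ a∉L (proj₁ (s₂ a∈)) refl) ∷ u₂ ,
    λ { (here refl) → here refl , Qa ; (there b∈) → there (proj₁ (s₂ b∈)) , proj₂ (s₂ b∈) }) ,
  trans (cong suc eq) (sym (+-suc (length L₁) (length L₂)))

Card≤-⊎ : {P Q : S → Set} {D E : ℕ} → Card≤ P D → Card≤ Q E → Card≤ (λ a → P a ⊎ Q a) (D + E)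
Card≤-⊎ cP cQ {L} uL L⊆ with split-list L uL L⊆
... | L₁ , L₂ , (u₁ , s₁) , (u₂ , s₂) , eq =
  ≤-trans (≤-reflexive eq) (+-mono-≤ (cP u₁ (proj₂ ∘ s₁)) (cQ u₂ (proj₂ ∘ s₂)))

Card≤-⋃ : ∀ c {D} {Q : Fin c → S → Set} → (∀ i → Card≤ (Q i) D) → Card≤ (λ a → ∃ λ i → Q i a) (c * D)
Card≤-⋃ zero    cQ = Card≤-∅ λ ()
Card≤-⋃ (suc c) cQ = Card≤-⊆ (λ { (fzero , q) → inj₁ q ; (fsuc i , q) → inj₂ (i , q) })
  (Card≤-⊎ (cQ fzero) (Card≤-⋃ c (cQ ∘ fsuc)))

Card≤-⋃-list : ∀ (M : List T) {D} {Q : T → S → Set} → (∀ {b} → b ∈ M → Card≤ (Q b) D) →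
  Card≤ (λ a → ∃ λ b → b ∈ M × Q b a) (length M * D)
Card≤-⋃-list []      cQ = Card≤-∅ λ ()
Card≤-⋃-list (b ∷ M) cQ = Card≤-⊆ (λ { (_ , here refl , q) → inj₁ q ; (c , there c∈ , q) → inj₂ (c , c∈ , q) })
  (Card≤-⊎ (cQ (here refl)) (Card≤-⋃-list M (cQ ∘ there)))

Unique-++ : {P : S → Set} {L K : List S} → Unique L → Unique K →
  (∀ {a} → a ∈ L → P a) → (∀ {a} → a ∈ K → ¬ P a) → Unique (L ++ K)
Unique-++ uL uK LP KP = Uniqueₚ.++⁺ uL uK λ { (a∈L , a∈K) → KP a∈K (LP a∈L) }

-- Appending `K` to a list of elements of `P` keeps it duplicate-free and inside `R`. It gives sharp
-- counts where the excluded elements are the easier ones to enumerate.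
Card≤-complement : {P R : S → Set} {c : ℕ} → Card≤ R c → (∀ {a} → P a → R a) →
  {K : List S} → Unique K → (∀ {a} → a ∈ K → R a) → (∀ {a} → a ∈ K → ¬ P a) →
  Card≤ P (c ∸ length K)
Card≤-complement cR P⊆R {K} uK KR K¬P {L} uL L⊆P = m+n≤o⇒m≤o∸n (length L)
  (subst (_≤ _) (length-++ L) (cR (Unique-++ uL uK L⊆P K¬P)
    λ a∈ → [ P⊆R ∘ L⊆P , KR ]′ (∈-++⁻ L a∈)))

Card≤-singleton : (a : S) → Card≤ (_≡ a) 1
Card≤-singleton a = Card≤-⊆ (λ { refl → here refl }) (Card≤-list [ a ])

Card≤? : {Q : S → Set} → Decidable Q → (G : List S) → Unique G → ∀ D → Dec (Card≤ (λ a → a ∈ G × Q a) D)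
Card≤? Q? G uG D with length (filter Q? G) ≤? D
... | yes ≤D = yes (Card≤-mono (λ { (a∈ , q) → ∈-filter⁺ Q? a∈ q }) ≤D (Card≤-list _))
... | no  ≰D = no λ c → ≰D (c (Uniqueₚ.filter⁺ Q? uG) (∈-filter⁻ Q?))

-- Products and boxes

-- With value 1 this removes a factor: `prod r (set f j 1)` is the product over the parts other than
-- `j`, the size of the full star of a vertex in part `j`.
set : ∀ {r} → (Fin r → S) → Fin r → S → Fin r → S
set f fzero    a fzero    = a
set f fzero    a (fsuc i) = f (fsuc i)
set f (fsuc j) a fzero    = f fzero
set f (fsuc j) a (fsuc i) = set (f ∘ fsuc) j a i

set-same : ∀ {r} (f : Fin r → S) j a → set f j a j ≡ a
set-same f fzero    a = refl
set-same f (fsuc j) a = set-same (f ∘ fsuc) j a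

set-other : ∀ {r} (f : Fin r → S) {j i} a → i ≢ j → set f j a i ≡ f i
set-other f {fzero}  {fzero}  a i≢j = ⊥-elim (i≢j refl)
set-other f {fzero}  {fsuc i} a i≢j = refl
set-other f {fsuc j} {fzero}  a i≢j = refl
set-other f {fsuc j} {fsuc i} a i≢j = set-other (f ∘ fsuc) a (i≢j ∘ cong fsuc)

set-elim : ∀ {r} (f : Fin r → S) j a (P : Fin r → S → Set) → P j a → (∀ i → i ≢ j → P i (f i)) → ∀ i → P i (set f j a i)
set-elim f j a P same other i with i ≟ᶠ j
... | yes refl = subst (P j) (sym (set-same f j a)) same
... | no  i≢j  = subst (P i) (sym (set-other f a i≢j)) (other i i≢j)

prod-mono : ∀ r {f g : Fin r → ℕ} → (∀ i → f i ≤ g i) → prod r f ≤ prod r g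
prod-mono zero    f≤g = ≤-refl
prod-mono (suc r) f≤g = *-mono-≤ (f≤g fzero) (prod-mono r (f≤g ∘ fsuc))

prod-cong : ∀ r {f g : Fin r → ℕ} → f ≗ g → prod r f ≡ prod r g
prod-cong zero    f≗g = refl
prod-cong (suc r) f≗g = cong₂ _*_ (f≗g fzero) (prod-cong r (f≗g ∘ fsuc))

prod-const : ∀ r b → prod r (λ _ → b) ≡ b ^ r
prod-const zero    b = refl
prod-const (suc r) b = cong (b *_) (prod-const r b)

*-left-comm : ∀ a b c → a * (b * c) ≡ b * (a * c)
*-left-comm a b c = trans (sym (*-assoc a b c)) (trans (cong (_* c) (*-comm a b)) (*-assoc b a c))

prod-set : ∀ r (f : Fin r → ℕ) j a → prod r (set f j a) ≡ a * prod r (set f j 1)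
prod-set (suc r) f fzero    a = cong (a *_) (sym (+-identityʳ _))
prod-set (suc r) f (fsuc j) a = trans (cong (f fzero *_) (prod-set r (f ∘ fsuc) j a)) (*-left-comm (f fzero) a _)

set-id : ∀ {r} (f : Fin r → S) j → set f j (f j) ≗ f
set-id f j = set-elim f j (f j) (λ i y → y ≡ f i) refl (λ _ _ → refl)

prod-extract : ∀ r (f : Fin r → ℕ) j → prod r f ≡ f j * prod r (set f j 1)
prod-extract r f j = trans (sym (prod-cong r (set-id f j))) (prod-set r f j (f j))

set-map : (g : S → T) → ∀ {r} (f : Fin r → S) j a → (g ∘ set f j a) ≗ set (g ∘ f) j (g a)
set-map g f fzero    a fzero    = refl
set-map g f fzero    a (fsuc i) = refl
set-map g f (fsuc j) a fzero    = refl
set-map g f (fsuc j) a (fsuc i) = set-map g (f ∘ fsuc) j a i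

set-cong : ∀ {r} {f g : Fin r → S} → f ≗ g → ∀ j a → set f j a ≗ set g j a
set-cong f≗g fzero    a fzero    = refl
set-cong f≗g fzero    a (fsuc i) = f≗g (fsuc i)
set-cong f≗g (fsuc j) a fzero    = f≗g fzero
set-cong f≗g (fsuc j) a (fsuc i) = set-cong (f≗g ∘ fsuc) j a i

set-set : ∀ {r} (f : Fin r → S) j a b → set (set f j a) j b ≗ set f j b
set-set f fzero    a b fzero    = refl
set-set f fzero    a b (fsuc i) = refl
set-set f (fsuc j) a b fzero    = refl
set-set f (fsuc j) a b (fsuc i) = set-set (f ∘ fsuc) j a b i

set-comm : ∀ {r} (f : Fin r → S) {i j} a b → i ≢ j → set (set f i a) j b ≗ set (set f j b) i a
set-comm f {fzero}  {fzero}  a b i≢j ℓ        = ⊥-elim (i≢j refl)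
set-comm f {fzero}  {fsuc j} a b i≢j fzero    = refl
set-comm f {fzero}  {fsuc j} a b i≢j (fsuc ℓ) = refl
set-comm f {fsuc i} {fzero}  a b i≢j fzero    = refl
set-comm f {fsuc i} {fzero}  a b i≢j (fsuc ℓ) = refl
set-comm f {fsuc i} {fsuc j} a b i≢j fzero    = refl
set-comm f {fsuc i} {fsuc j} a b i≢j (fsuc ℓ) = set-comm (f ∘ fsuc) a b (i≢j ∘ cong fsuc) ℓ

set-mono : ∀ {r} {f g : Fin r → ℕ} → (∀ i → f i ≤ g i) → ∀ j {a b} → a ≤ b → ∀ i → set f j a i ≤ set g j b i
set-mono f≤g fzero    a≤b fzero    = a≤b
set-mono f≤g fzero    a≤b (fsuc i) = f≤g (fsuc i)
set-mono f≤g (fsuc j) a≤b fzero    = f≤g fzero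
set-mono f≤g (fsuc j) a≤b (fsuc i) = set-mono (f≤g ∘ fsuc) j a≤b i

InBox : ∀ {r} → (Fin r → List ℕ) → Vec ℕ r → Set
InBox X A = ∀ ℓ → lookup A ℓ ∈ X ℓ

box : ∀ r → (Fin r → List ℕ) → List (Vec ℕ r)
box zero    X = [ [] ]
box (suc r) X = cartesianProductWith _∷_ (X fzero) (box r (X ∘ fsuc))

∈-box⁺ : ∀ {r} {X : Fin r → List ℕ} {A} → InBox X A → A ∈ box r X
∈-box⁺ {zero}  {A = []}    inX = here refl
∈-box⁺ {suc r} {A = a ∷ A} inX = ∈-cartesianProductWith⁺ _∷_ (inX fzero) (∈-box⁺ (inX ∘ fsuc))

∈-box⁻ : ∀ {r} {X : Fin r → List ℕ} {A} → A ∈ box r X → InBox X A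
∈-box⁻ {suc r} {X} A∈ ℓ with ∈-cartesianProductWith⁻ _∷_ (X fzero) (box r (X ∘ fsuc)) A∈
∈-box⁻ {suc r} {X} A∈ fzero    | a , A , a∈ , A∈′ , refl = a∈
∈-box⁻ {suc r} {X} A∈ (fsuc ℓ) | a , A , a∈ , A∈′ , refl = ∈-box⁻ A∈′ ℓ

∷-injective : ∀ {r} {a b : ℕ} {A B : Vec ℕ r} → _≡_ {A = Vec ℕ (suc r)} (a ∷ A) (b ∷ B) → a ≡ b × A ≡ B
∷-injective refl = refl , refl

box-unique : ∀ r {X : Fin r → List ℕ} → (∀ ℓ → Unique (X ℓ)) → Unique (box r X)
box-unique zero    uX = [] ∷ []
box-unique (suc r) uX = Uniqueₚ.cartesianProductWith⁺ _∷_ ∷-injective (uX fzero) (box-unique r (uX ∘ fsuc))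

length-cartesianProductWith : ∀ {C : Set} (f : S → T → C) xs ys → length (cartesianProductWith f xs ys) ≡ length xs * length ys
length-cartesianProductWith f []       ys = refl
length-cartesianProductWith f (x ∷ xs) ys = trans (length-++ (map (f x) ys))
  (cong₂ _+_ (length-map (f x) ys) (length-cartesianProductWith f xs ys))

length-box : ∀ r (X : Fin r → List ℕ) → length (box r X) ≡ prod r (length ∘ X)
length-box zero    X = refl
length-box (suc r) X = trans (length-cartesianProductWith _∷_ (X fzero) _) (cong (length (X fzero) *_) (length-box r (X ∘ fsuc)))

Card≤-box : ∀ {r} (X : Fin r → List ℕ) → Card≤ (InBox X) (prod r (length ∘ X))
Card≤-box {r} X = Card≤-mono ∈-box⁺ (≤-reflexive (length-box r X)) (Card≤-list _)

InBox-set : ∀ {r} {X : Fin r → List ℕ} A → InBox X A → ∀ j {Y} → lookup A j ∈ Y → InBox (set X j Y) A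
InBox-set {X = X} A inX j {Y} A∈Y = set-elim X j Y (λ ℓ Z → lookup A ℓ ∈ Z) A∈Y (λ ℓ _ → inX ℓ)

_minus_ : List ℕ → ℕ → List ℕ
X minus x = filter (λ y → ¬? (y ≟ x)) X

∈-minus⁺ : ∀ {X x y} → y ∈ X → y ≢ x → y ∈ X minus x
∈-minus⁺ {x = x} = ∈-filter⁺ (λ y → ¬? (y ≟ x))

∈-minus⁻ : ∀ X {x y} → y ∈ X minus x → y ∈ X × y ≢ x
∈-minus⁻ X {x} = ∈-filter⁻ (λ y → ¬? (y ≟ x))

minus-unique : ∀ {X} x → Unique X → Unique (X minus x)
minus-unique x = Uniqueₚ.filter⁺ (λ y → ¬? (y ≟ x))

length-minus : ∀ {X x} → Unique X → x ∈ X → length (X minus x) ≡ length X ∸ 1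
length-minus {X} {x} uX x∈X = ≤-antisym
  (m+n≤o⇒m≤o∸n (length (X minus x)) (subst (_≤ length X) (+-comm 1 _)
    (Card≤-list X (∉⇒All≢ (λ x∈ → proj₂ (∈-minus⁻ X x∈) refl) ∷ minus-unique x uX)
      λ { (here refl) → x∈X ; (there y∈) → proj₁ (∈-minus⁻ X y∈) })))
  (m≤n+o⇒m∸n≤o (length X) 1
    (Card≤-⊎ (Card≤-singleton x) (Card≤-list (X minus x)) uX split))
  where
  split : ∀ {y} → y ∈ X → y ≡ x ⊎ y ∈ X minus x
  split {y} y∈X with y ≟ x
  ... | yes y≡x = inj₁ y≡x
  ... | no  y≢x = inj₂ (∈-minus⁺ y∈X y≢x)

module _ {r : ℕ} (f : Fin r → ℕ) where

  prod-set₂ : ∀ {i j} p q → i ≢ j → prod r (set (set f i p) j q) ≡ p * (q * prod r (set (set f i 1) j 1))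
  prod-set₂ {i} {j} p q i≢j =
    trans (prod-set r _ j q) (trans (cong (q *_)
      (trans (prod-cong r (set-comm f p 1 i≢j))
        (trans (prod-set r _ i p) (cong (p *_) (prod-cong r (set-comm f 1 1 (i≢j ∘ sym)))))))
      (*-left-comm q p _))

module _ {r : ℕ} (f : Fin r → ℕ) where

  prod-set₃ : ∀ {i j l} p q t → i ≢ j → i ≢ l → j ≢ l →
    prod r (set (set (set f i p) j q) l t) ≡ p * (q * (t * prod r (set (set (set f i 1) j 1) l 1)))
  prod-set₃ {i} {j} {l} p q t i≢j i≢l j≢l =
    trans (prod-set r _ l t) (trans (cong (t *_) (trans (prod-cong r (inwards p q))
      (trans (prod-set₂ (set f l 1) p q i≢j) (cong (λ w → p * (q * w)) (sym (prod-cong r (inwards 1 1)))))))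
      (trans (*-left-comm t p _) (cong (p *_) (*-left-comm t q _))))
    where
    inwards : ∀ p q → set (set (set f i p) j q) l 1 ≗ set (set (set f l 1) i p) j q
    inwards p q ℓ = trans (set-comm (set f i p) q 1 j≢l ℓ) (set-cong (set-comm f p 1 i≢l) j q ℓ)

prod-set₁≡ : ∀ {r} (f : Fin r → ℕ) {i j} → i ≢ j → prod r (set f j 1) ≡ f i * prod r (set (set f i 1) j 1)
prod-set₁≡ {r} f {i} {j} i≢j = trans (prod-extract r (set f j 1) i)
  (cong₂ _*_ (set-other f 1 i≢j) (prod-cong r (set-comm f 1 1 (i≢j ∘ sym))))

module _ (b : ℕ) (1≤b : 1 ≤ b) where
  private instance _ = >-nonZero 1≤b

  prod-set₁-const : ∀ k i → prod (suc k) (set (λ _ → b) i 1) ≡ b ^ k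
  prod-set₁-const k i = *-cancelˡ-≡ _ _ b
    (trans (sym (prod-extract (suc k) (λ _ → b) i)) (prod-const (suc k) b))

  prod-set₂-const : ∀ k {i j} → i ≢ j → prod (2 + k) (set (set (λ _ → b) i 1) j 1) ≡ b ^ k
  prod-set₂-const k {i} {j} i≢j = *-cancelˡ-≡ _ _ b
    (trans (cong (_* prod (2 + k) (set (set (λ _ → b) i 1) j 1)) (sym (set-other (λ _ → b) 1 (i≢j ∘ sym))))
      (trans (sym (prod-extract (2 + k) (set (λ _ → b) i 1) j)) (prod-set₁-const (suc k) i)))

  prod-set₃-const : ∀ k {i j l} → i ≢ j → i ≢ l → j ≢ l →
    prod (3 + k) (set (set (set (λ _ → b) i 1) j 1) l 1) ≡ b ^ k
  prod-set₃-const k {i} {j} {l} i≢j i≢l j≢l = *-cancelˡ-≡ _ _ b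
    (trans (cong (_* prod (3 + k) (set (set (set (λ _ → b) i 1) j 1) l 1)) (sym (trans (set-other _ 1 (j≢l ∘ sym)) (set-other (λ _ → b) 1 (i≢l ∘ sym)))))
      (trans (sym (prod-extract (3 + k) (set (set (λ _ → b) i 1) j 1) l)) (prod-set₂-const (suc k) i≢j)))

module _ {r : ℕ} (X : Fin r → List ℕ) where

  Card≤-box₁ : ∀ i Y → Card≤ (λ A → InBox X A × lookup A i ∈ Y) (length Y * prod r (set (length ∘ X) i 1))
  Card≤-box₁ i Y = Card≤-mono (λ {A} (inX , ∈Y) → InBox-set A inX i ∈Y)
    (≤-reflexive (trans (prod-cong r (set-map length X i Y)) (prod-set r _ i _))) (Card≤-box (set X i Y))

  Card≤-box₂ : ∀ {i j} Y Z → i ≢ j → Card≤ (λ A → InBox X A × lookup A i ∈ Y × lookup A j ∈ Z)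
    (length Y * (length Z * prod r (set (set (length ∘ X) i 1) j 1)))
  Card≤-box₂ {i} {j} Y Z i≢j = Card≤-mono (λ {A} (inX , ∈Y , ∈Z) → InBox-set A (InBox-set A inX i ∈Y) j ∈Z)
    (≤-reflexive (trans (prod-cong r (λ ℓ → trans (set-map length (set X i Y) j Z ℓ) (set-cong (set-map length X i Y) j _ ℓ)))
      (prod-set₂ (length ∘ X) _ _ i≢j))) (Card≤-box (set (set X i Y) j Z))

  Card≤-box₃ : ∀ {i j l} Y Z W → i ≢ j → i ≢ l → j ≢ l →
    Card≤ (λ A → InBox X A × lookup A i ∈ Y × lookup A j ∈ Z × lookup A l ∈ W)
      (length Y * (length Z * (length W * prod r (set (set (set (length ∘ X) i 1) j 1) l 1))))
  Card≤-box₃ {i} {j} {l} Y Z W i≢j i≢l j≢l =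
    Card≤-mono (λ {A} (inX , ∈Y , ∈Z , ∈W) → InBox-set A (InBox-set A (InBox-set A inX i ∈Y) j ∈Z) l ∈W)
    (≤-reflexive (trans (prod-cong r (λ ℓ → trans (set-map length (set (set X i Y) j Z) l W ℓ)
        (set-cong (λ ℓ → trans (set-map length (set X i Y) j Z ℓ) (set-cong (set-map length X i Y) j _ ℓ)) l _ ℓ)))
      (prod-set₃ (length ∘ X) _ _ _ i≢j i≢l j≢l))) (Card≤-box (set (set (set X i Y) j Z) l W))

-- Codegrees and intersecting families without a common vertex

≡⇒∈[] : ∀ {x y : ℕ} → x ≡ y → x ∈ [ y ]
≡⇒∈[] refl = here refl

differ : ∀ {r} (A B : Vec ℕ r) {i j x} → lookup A i ≡ x → lookup A j ≡ lookup B j → lookup B i ≢ x → i ≢ j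
differ A B e e′ B≢x refl = B≢x (trans (sym e′) e)

∈[]⇒≡ : ∀ {x y : ℕ} → x ∈ [ y ] → x ≡ y
∈[]⇒≡ (here e) = e

-- For r = 3 the triple of a `Triangle` occupies every part. The finite statement is settled by
-- exhaustion; the equation `k ≡ 0` makes it applicable at a variable `k`.
three-parts : ∀ {k} → k ≡ 0 → ∀ {i j l ℓ : Fin (3 + k)} → i ≢ j → i ≢ l → j ≢ l → ℓ ≢ i → ℓ ≡ j ⊎ ℓ ≡ l
three-parts refl {i} {j} {l} {ℓ} = from-yes (allᶠ? λ (i : Fin 3) → allᶠ? λ j → allᶠ? λ l → allᶠ? λ ℓ →
  ¬? (i ≟ᶠ j) →-dec (¬? (i ≟ᶠ l) →-dec (¬? (j ≟ᶠ l) →-dec (¬? (ℓ ≟ᶠ i) →-dec ((ℓ ≟ᶠ j) ⊎-dec (ℓ ≟ᶠ l)))))) i j l ℓ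

module Codegree (k : ℕ) (X : Fin (3 + k) → List ℕ) (b : ℕ) (1≤b : 1 ≤ b) (X≤b : ∀ ℓ → length (X ℓ) ≤ b) where

  degree₂ : ∀ {i j} x y → i ≢ j → Card≤ (λ A → InBox X A × lookup A i ≡ x × lookup A j ≡ y) (b ^ (1 + k))
  degree₂ {i} {j} x y i≢j = Card≤-mono (λ { (inX , e , e′) → inX , ≡⇒∈[] e , ≡⇒∈[] e′ }) (begin
    1 * (1 * prod _ (set (set (length ∘ X) i 1) j 1)) ≡⟨ trans (*-identityˡ _) (*-identityˡ _) ⟩
    prod _ (set (set (length ∘ X) i 1) j 1)           ≤⟨ prod-mono _ (set-mono (set-mono X≤b i ≤-refl) j ≤-refl) ⟩
    prod _ (set (set (λ _ → b) i 1) j 1)              ≡⟨ prod-set₂-const b 1≤b (1 + k) i≢j ⟩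
    b ^ (1 + k) ∎) (Card≤-box₂ X [ x ] [ y ] i≢j)
    where open ≤-Reasoning

  prod-set₃-≤ : ∀ {i j l} → i ≢ j → i ≢ l → j ≢ l → prod _ (set (set (set (length ∘ X) i 1) j 1) l 1) ≤ b ^ k
  prod-set₃-≤ {i} {j} {l} i≢j i≢l j≢l = ≤-trans
    (prod-mono _ (set-mono (set-mono (set-mono X≤b i ≤-refl) j ≤-refl) l ≤-refl))
    (≤-reflexive (prod-set₃-const b 1≤b k i≢j i≢l j≢l))

  degree₃ : ∀ {i j l} x y z → i ≢ j → i ≢ l → j ≢ l →
    Card≤ (λ A → InBox X A × lookup A i ≡ x × lookup A j ≡ y × lookup A l ≡ z) (b ^ k)
  degree₃ {i} {j} {l} x y z i≢j i≢l j≢l =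
    Card≤-mono (λ { (inX , e , e′ , e″) → inX , ≡⇒∈[] e , ≡⇒∈[] e′ , ≡⇒∈[] e″ })
      (≤-trans (≤-reflexive (trans (*-identityˡ _) (trans (*-identityˡ _) (*-identityˡ _)))) (prod-set₃-≤ i≢j i≢l j≢l))
      (Card≤-box₃ X [ x ] [ y ] [ z ] i≢j i≢l j≢l)

module Intersecting (k : ℕ) (X : Fin (3 + k) → List ℕ) (b : ℕ) (1≤b : 1 ≤ b) (X≤b : ∀ ℓ → length (X ℓ) ≤ b)
  (G : List (Vec ℕ (3 + k))) (uG : Unique G) (inX : ∀ {A} → A ∈ G → InBox X A)
  (intersecting : ∀ {A B} → A ∈ G → B ∈ G → ∃ λ ℓ → lookup A ℓ ≡ lookup B ℓ)
  (nontrivial : ∀ i x → ∃ λ B → B ∈ G × lookup B i ≢ x) where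

  open Codegree k X b 1≤b X≤b public

  r D₂ : ℕ
  r  = 3 + k
  D₂ = r * b ^ k

  Pair : Fin r → ℕ → Fin r → ℕ → Vec ℕ r → Set
  Pair i x j y A = A ∈ G × lookup A i ≡ x × lookup A j ≡ y

  Light Cover : Fin r → ℕ → Fin r → ℕ → Set
  Light i x j y = Card≤ (Pair i x j y) D₂
  Cover i x j y = ∀ {A} → A ∈ G → lookup A i ≡ x ⊎ lookup A j ≡ y

  Light? : ∀ i x j y → Dec (Light i x j y)
  Light? i x j y = Card≤? (λ A → (lookup A i ≟ x) ×-dec (lookup A j ≟ y)) G uG D₂

  Light-sym : ∀ {i x j y} → Light i x j y → Light j y i x
  Light-sym = Card≤-⊆ λ { (A∈ , e , e′) → A∈ , e′ , e }

  -- If an edge `B` misses both vertices, every edge through the pair meets `B` in some third part.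
  -- That fixes three coordinates, so there are at most `b ^ k` such edges for each of the `r`
  -- parts, and the codegree is at most `D₂`.
  heavy⇒cover : ∀ {i x j y} → i ≢ j → ¬ Light i x j y → Cover i x j y
  heavy⇒cover {i} {x} {j} {y} i≢j heavy {B} B∈ with lookup B i ≟ x | lookup B j ≟ y
  ... | yes e | _     = inj₁ e
  ... | no _  | yes e = inj₂ e
  ... | no B≢x | no B≢y = ⊥-elim (heavy (Card≤-⊆
        (λ { (A∈ , e , e′) → let ℓ , eℓ = intersecting A∈ B∈ in ℓ , A∈ , e , e′ , eℓ })
        (Card≤-⋃ r meets-at)))
    where
    meets-at : ∀ ℓ → Card≤ (λ A → A ∈ G × lookup A i ≡ x × lookup A j ≡ y × lookup A ℓ ≡ lookup B ℓ) (b ^ k)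
    meets-at ℓ with i ≟ᶠ ℓ | j ≟ᶠ ℓ
    ... | yes refl | _        = Card≤-∅ λ { (_ , e , _ , eℓ) → B≢x (trans (sym eℓ) e) }
    ... | no _     | yes refl = Card≤-∅ λ { (_ , _ , e , eℓ) → B≢y (trans (sym eℓ) e) }
    ... | no i≢ℓ   | no j≢ℓ   = Card≤-⊆ (λ { (A∈ , e) → inX A∈ , e }) (degree₃ x y (lookup B ℓ) i≢j i≢ℓ j≢ℓ)

  -- The coefficient r - 2 is one below that of a Hilton-Milner family. The error term is the size
  -- of a union of r² light pairs.
  Small : Set
  Small = length G ≤ (1 + k) * b ^ (1 + k) + r * (r * D₂)

  -- The r-partite form of the Hilton-Milner family with centre `(i , x)`. The edges off the centre
  -- may be all those agreeing with `B` outside part `i`, since these also meet each other.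
  record HiltonMilner : Set where
    field
      {i}   : Fin r
      {x}   : ℕ
      {B}   : Vec ℕ r
      x∈    : x ∈ X i
      B∈    : InBox X B
      shape : ∀ {A} → A ∈ G → (lookup A i ≡ x × ∃ λ ℓ → ℓ ≢ i × lookup A ℓ ≡ lookup B ℓ)
                            ⊎ (lookup A i ≢ x × ∀ ℓ → ℓ ≢ i → lookup A ℓ ≡ lookup B ℓ)

  record Triangle : Set where
    field
      {i j l} : Fin r
      {x y z} : ℕ
      i≢j     : i ≢ j
      i≢l     : i ≢ l
      j≢l     : j ≢ l
      cover₁₂ : Cover i x j y
      cover₁₃ : Cover i x l z
      cover₂₃ : Cover j y l z

  -- Edges through x meet `B` outside part `i`. If x forms a heavy pair with each vertex of `B`
  -- there, an edge missing x must contain all of them, which is the Hilton-Milner shape. Otherwise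
  -- one of the r - 1 meeting places is light, leaving r - 2 places of full codegree. Edges missing
  -- x contain y and meet `B′`; as `B′` contains x but not y, this happens outside `i` and `j`,
  -- where pairs with y are light.
  star : ∀ {i x j y B B′} → i ≢ j → ¬ Light i x j y → B ∈ G → lookup B i ≢ x → B′ ∈ G → lookup B′ j ≢ y →
    (∀ ℓ → ℓ ≢ i → ℓ ≢ j → Light j y ℓ (lookup B′ ℓ)) → Small ⊎ HiltonMilner
  star {i} {x} {j} {y} {B} {B′} i≢j heavy B∈ B≢x B′∈ B′≢y light
    with anyᶠ? (λ ℓ → ¬? (i ≟ᶠ ℓ) ×-dec Light? i x ℓ (lookup B ℓ))
  ... | no all-heavy = inj₂ record
        { B = B ; x∈ = subst (_∈ X i) B′≡x (inX B′∈ i)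
        ; B∈ = inX B∈
        ; shape = shape }
    where
    B′≡x : lookup B′ i ≡ x
    B′≡x = [ id , (λ e → ⊥-elim (B′≢y e)) ]′ (heavy⇒cover i≢j heavy B′∈)
    shape : ∀ {A} → A ∈ G → (lookup A i ≡ x × ∃ λ ℓ → ℓ ≢ i × lookup A ℓ ≡ lookup B ℓ)
                          ⊎ (lookup A i ≢ x × ∀ ℓ → ℓ ≢ i → lookup A ℓ ≡ lookup B ℓ)
    shape {A} A∈ with lookup A i ≟ x
    ... | yes e = let ℓ , eℓ = intersecting A∈ B∈ in
          inj₁ (e , ℓ , ≢-sym (differ A B e eℓ B≢x) , eℓ)
    ... | no A≢x = inj₂ (A≢x , λ ℓ ℓ≢i →
          [ (λ e → ⊥-elim (A≢x e)) , id ]′ (heavy⇒cover (≢-sym ℓ≢i) (λ lt → all-heavy (ℓ , ≢-sym ℓ≢i , lt)) A∈))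
  ... | yes (ℓ₀ , i≢ℓ₀ , light₀) = inj₁ (≤-trans (cG uG id) total)
    where
    l₀ : Fin (2 + k)
    l₀ = punchOut i≢ℓ₀
    -- Runs through the r - 2 parts different from `i` and `ℓ₀`, which produces the coefficient of
    -- `Small`.
    other : Fin (1 + k) → Fin r
    other c = punchIn i (punchIn l₀ c)
    cG : Card≤ (_∈ G) ((1 + k) * b ^ (1 + k) + (D₂ + r * D₂))
    cG = Card≤-⊆ classify (Card≤-⊎
           (Card≤-⋃ (1 + k) {Q = λ c → Pair i x (other c) (lookup B (other c))} λ c →
             Card≤-⊆ (λ { (A∈ , e) → inX A∈ , e }) (degree₂ x (lookup B (other c)) (≢-sym (punchInᵢ≢i i (punchIn l₀ c)))))
           (Card≤-⊎ light₀ (Card≤-⋃ r {Q = λ ℓ A → (ℓ ≢ i × ℓ ≢ j) × Pair j y ℓ (lookup B′ ℓ) A} light′)))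
      where
      light′ : ∀ ℓ → Card≤ (λ A → (ℓ ≢ i × ℓ ≢ j) × Pair j y ℓ (lookup B′ ℓ) A) D₂
      light′ ℓ with ℓ ≟ᶠ i | ℓ ≟ᶠ j
      ... | yes e  | _      = Card≤-∅ λ { ((≢i , _) , _) → ≢i e }
      ... | no _   | yes e  = Card≤-∅ λ { ((_ , ≢j) , _) → ≢j e }
      ... | no ℓ≢i | no ℓ≢j = Card≤-⊆ proj₂ (light ℓ ℓ≢i ℓ≢j)
      B′≡x : lookup B′ i ≡ x
      B′≡x = [ id , (λ e → ⊥-elim (B′≢y e)) ]′ (heavy⇒cover i≢j heavy B′∈)
      classify : ∀ {A} → A ∈ G → (∃ λ c → Pair i x (other c) (lookup B (other c)) A) ⊎
        (Pair i x ℓ₀ (lookup B ℓ₀) A ⊎ ∃ λ ℓ → (ℓ ≢ i × ℓ ≢ j) × Pair j y ℓ (lookup B′ ℓ) A)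
      classify {A} A∈ with lookup A i ≟ x
      classify {A} A∈ | no A≢x = let ℓ , eℓ = intersecting A∈ B′∈
                                     A≡y = [ (λ e → ⊥-elim (A≢x e)) , id ]′ (heavy⇒cover i≢j heavy A∈) in
        inj₂ (inj₂ (ℓ , (≢-sym (differ B′ A B′≡x (sym eℓ) A≢x) , ≢-sym (differ A B′ A≡y eℓ B′≢y)) , A∈ , A≡y , eℓ))
      classify {A} A∈ | yes A≡x with intersecting A∈ B∈
      ... | ℓ , eℓ with ℓ₀ ≟ᶠ ℓ
      ... | yes refl = inj₂ (inj₁ (A∈ , A≡x , eℓ))
      ... | no ℓ₀≢ℓ = inj₁ (punchOut l₀≢ , A∈ , A≡x , subst (λ ℓ → lookup A ℓ ≡ lookup B ℓ) (sym other≡) eℓ)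
        where
        i≢ℓ : i ≢ ℓ
        i≢ℓ = differ A B A≡x eℓ B≢x
        l₀≢ : l₀ ≢ punchOut i≢ℓ
        l₀≢ e = ℓ₀≢ℓ (punchOut-injective i≢ℓ₀ i≢ℓ e)
        other≡ : other (punchOut l₀≢) ≡ ℓ
        other≡ = trans (cong (punchIn i) (punchIn-punchOut l₀≢)) (punchIn-punchOut i≢ℓ)
    total : (1 + k) * b ^ (1 + k) + (D₂ + r * D₂) ≤ (1 + k) * b ^ (1 + k) + r * (r * D₂)
    total = +-monoʳ-≤ ((1 + k) * b ^ (1 + k))
      (≤-trans (+-monoˡ-≤ (r * D₂) (m≤m+n D₂ _)) (+-monoʳ-≤ (r * D₂) (m≤m+n (r * D₂) _)))

  -- Every edge meets a fixed edge `A₀` in some part i, and an edge avoiding that vertex of `A₀` in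
  -- another part j. Either all these r² pairs are light, or there is a heavy pair. In a heavy pair,
  -- a vertex without a further heavy partner on the edge avoiding it allows `star`; if both have
  -- one, the partners coincide and close a triangle.
  trichotomy : Small ⊎ HiltonMilner ⊎ Triangle
  -- Only some edge `A₀` is wanted here; the vertex it avoids is arbitrary.
  trichotomy with nontrivial fzero 0
  ... | A₀ , A₀∈ , _ with anyᶠ? (λ i → anyᶠ? λ j → ¬? (i ≟ᶠ j) ×-dec
                        ¬? (Light? i (lookup A₀ i) j (lookup (proj₁ (nontrivial i (lookup A₀ i))) j)))
  ... | no none = inj₁ (≤-trans (cG uG id) (m≤n+m (r * (r * D₂)) ((1 + k) * b ^ (1 + k))))
    where
    avoid : ∀ i → Vec ℕ r
    avoid i = proj₁ (nontrivial i (lookup A₀ i))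
    cG : Card≤ (_∈ G) (r * (r * D₂))
    cG = Card≤-⊆ classify (Card≤-⋃ r λ i → Card≤-⋃ r λ j → lightᵢⱼ i j)
      where
      lightᵢⱼ : ∀ i j → Card≤ (λ A → i ≢ j × Pair i (lookup A₀ i) j (lookup (avoid i) j) A) D₂
      lightᵢⱼ i j with i ≟ᶠ j | Light? i (lookup A₀ i) j (lookup (avoid i) j)
      ... | yes e | _     = Card≤-∅ λ { (≢ , _) → ≢ e }
      ... | no ≢  | yes c = Card≤-⊆ proj₂ c
      ... | no ≢  | no ¬c = ⊥-elim (none (i , j , ≢ , ¬c))
      classify : ∀ {A} → A ∈ G → ∃ λ i → ∃ λ j → i ≢ j × Pair i (lookup A₀ i) j (lookup (avoid i) j) A
      classify {A} A∈ =
        let i , eᵢ = intersecting A∈ A₀∈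
            B , B∈ , B≢ = nontrivial i (lookup A₀ i)
            j , eⱼ = intersecting A∈ B∈ in
        i , j , differ A B eᵢ eⱼ B≢ , A∈ , eᵢ , eⱼ
  ... | yes (i , j , i≢j , heavy) = from-heavy i≢j heavy
    where
    -- The heavy pair of x and z covers every edge through y and z′. If z and z′ differ, such an
    -- edge has a third prescribed vertex, x or z, so the codegree of y and z′ is at most 2 `b ^ k`,
    -- below `D₂`.
    both-heavy : ∀ {i x j y l z l′ z′} → i ≢ j → i ≢ l → j ≢ l → i ≢ l′ → j ≢ l′ →
      ¬ Light i x l z → ¬ Light j y l′ z′ → l ≡ l′ × z ≡ z′
    both-heavy {i} {x} {j} {y} {l} {z} {l′} {z′} i≢j i≢l j≢l i≢l′ j≢l′ heavy heavy′ with l ≟ᶠ l′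
    ... | no l≢l′ = ⊥-elim (heavy′ (Card≤-mono
            (λ { (A∈ , e , e′) → [ (λ e″ → inj₁ (inX A∈ , e , e′ , e″)) , (λ e″ → inj₂ (inX A∈ , e , e′ , e″)) ]′ (heavy⇒cover i≢l heavy A∈) })
            (+-monoʳ-≤ (b ^ k) (m≤m+n (b ^ k) _))
            (Card≤-⊎ (degree₃ y z′ x j≢l′ (≢-sym i≢j) (≢-sym i≢l′)) (degree₃ y z′ z j≢l′ j≢l (≢-sym l≢l′)))))
    ... | yes refl with z ≟ z′
    ...   | yes z≡z′ = refl , z≡z′
    ...   | no z≢z′ = ⊥-elim (heavy′ (Card≤-mono
            (λ { (A∈ , e , e′) → [ (λ e″ → inX A∈ , e , e′ , e″) , (λ e″ → ⊥-elim (z≢z′ (trans (sym e″) e′))) ]′ (heavy⇒cover i≢l heavy A∈) })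
            (m≤m+n (b ^ k) _)
            (degree₃ y z′ x j≢l′ (≢-sym i≢j) (≢-sym i≢l′))))
    from-heavy : ∀ {i x j y} → i ≢ j → ¬ Light i x j y → Small ⊎ HiltonMilner ⊎ Triangle
    from-heavy {i} {x} {j} {y} i≢j heavy with nontrivial i x | nontrivial j y
    ... | B , B∈ , B≢x | B′ , B′∈ , B′≢y
        with anyᶠ? (λ ℓ → ¬? (i ≟ᶠ ℓ) ×-dec ¬? (j ≟ᶠ ℓ) ×-dec ¬? (Light? i x ℓ (lookup B ℓ)))
           | anyᶠ? (λ ℓ → ¬? (i ≟ᶠ ℓ) ×-dec ¬? (j ≟ᶠ ℓ) ×-dec ¬? (Light? j y ℓ (lookup B′ ℓ)))
    ... | _ | no none′ = [ inj₁ , inj₂ ∘ inj₁ ]′ (star i≢j heavy B∈ B≢x B′∈ B′≢y light)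
      where
      light : ∀ ℓ → ℓ ≢ i → ℓ ≢ j → Light j y ℓ (lookup B′ ℓ)
      light ℓ ℓ≢i ℓ≢j with Light? j y ℓ (lookup B′ ℓ)
      ... | yes c = c
      ... | no ¬c = ⊥-elim (none′ (ℓ , ≢-sym ℓ≢i , ≢-sym ℓ≢j , ¬c))
    ... | no none | yes _ = [ inj₁ , inj₂ ∘ inj₁ ]′ (star (≢-sym i≢j) (λ lt → heavy (Light-sym lt)) B′∈ B′≢y B∈ B≢x light)
      where
      light : ∀ ℓ → ℓ ≢ j → ℓ ≢ i → Light i x ℓ (lookup B ℓ)
      light ℓ ℓ≢j ℓ≢i with Light? i x ℓ (lookup B ℓ)
      ... | yes c = c
      ... | no ¬c = ⊥-elim (none (ℓ , ≢-sym ℓ≢i , ≢-sym ℓ≢j , ¬c))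
    ... | yes (l , i≢l , j≢l , h) | yes (l′ , i≢l′ , j≢l′ , h′) with both-heavy i≢j i≢l j≢l i≢l′ j≢l′ h h′
    ...   | refl , eq = inj₂ (inj₂ record
            { i≢j = i≢j ; i≢l = i≢l ; j≢l = j≢l
            ; cover₁₂ = heavy⇒cover i≢j heavy
            ; cover₁₃ = heavy⇒cover i≢l h
            ; cover₂₃ = heavy⇒cover j≢l (subst (λ z → ¬ Light j y l z) (sym eq) h′) })

  -- An edge `B` missing x contains y and z by the covers. With only three parts, every edge missing
  -- x then agrees with `B` outside part `i`, while every edge through x contains y or z and so
  -- meets `B` there.
  triangle⇒HiltonMilner : (∀ {i j l ℓ : Fin r} → i ≢ j → i ≢ l → j ≢ l → ℓ ≢ i → ℓ ≡ j ⊎ ℓ ≡ l) → Triangle → HiltonMilner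
  triangle⇒HiltonMilner three t with nontrivial (Triangle.i t) (Triangle.x t) | nontrivial (Triangle.j t) (Triangle.y t)
  ... | B , B∈ , B≢x | B′ , B′∈ , B′≢y = record
    { B = B
    ; x∈ = subst (_∈ X i) (other B′≢y (swap (cover₁₂ B′∈))) (inX B′∈ i)
    ; B∈ = inX B∈
    ; shape = shape }
    where
    open Triangle t
    other : ∀ {P Q : Set} → ¬ P → P ⊎ Q → Q
    other ¬p = [ (λ p → ⊥-elim (¬p p)) , id ]′
    shape : ∀ {A} → A ∈ G → (lookup A i ≡ x × ∃ λ ℓ → ℓ ≢ i × lookup A ℓ ≡ lookup B ℓ)
                          ⊎ (lookup A i ≢ x × ∀ ℓ → ℓ ≢ i → lookup A ℓ ≡ lookup B ℓ)
    shape {A} A∈ with lookup A i ≟ x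
    ... | yes e = inj₁ (e , [ (λ A≡y → j , ≢-sym i≢j , trans A≡y (sym (other B≢x (cover₁₂ B∈)))) ,
                              (λ A≡z → l , ≢-sym i≢l , trans A≡z (sym (other B≢x (cover₁₃ B∈)))) ]′ (cover₂₃ A∈))
    ... | no A≢x = inj₂ (A≢x , λ ℓ ℓ≢i →
            [ (λ { refl → trans (other A≢x (cover₁₂ A∈)) (sym (other B≢x (cover₁₂ B∈))) }) ,
              (λ { refl → trans (other A≢x (cover₁₃ A∈)) (sym (other B≢x (cover₁₃ B∈))) }) ]′ (three i≢j i≢l j≢l ℓ≢i))

  N : Fin r → ℕ
  N = length ∘ X

  module _ (uX : ∀ ℓ → Unique (X ℓ)) where

    -- Among the edges through the centre exactly those avoiding `B` in every other part are
    -- excluded; they form the box `K`. Off the centre only the coordinate in part `i` is free, with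
    -- `N i ∸ 1` values. The subtraction of `K` is moved to the left.
    HiltonMilner-size : (hm : HiltonMilner) → let open HiltonMilner hm in
      length G + prod r (set (λ ℓ → N ℓ ∸ 1) i 1) ≤ prod r (set N i 1) + (N i ∸ 1)
    HiltonMilner-size hm = begin
      length G + q            ≤⟨ +-monoˡ-≤ q (Card≤-⊆ classify (Card≤-⊎ with-x without-x) uG id) ⟩
      p ∸ length K + (N i ∸ 1) + q    ≡⟨ cong (λ c → p ∸ c + (N i ∸ 1) + q) lengthK ⟩
      p ∸ q + (N i ∸ 1) + q   ≡⟨ +-assoc (p ∸ q) _ q ⟩
      p ∸ q + (N i ∸ 1 + q)   ≡⟨ cong (p ∸ q +_) (+-comm (N i ∸ 1) q) ⟩
      p ∸ q + (q + (N i ∸ 1)) ≡⟨ sym (+-assoc (p ∸ q) q _) ⟩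
      p ∸ q + q + (N i ∸ 1)   ≡⟨ cong (_+ (N i ∸ 1)) (m∸n+n≡m q≤p) ⟩
      p + (N i ∸ 1) ∎
      where
      open HiltonMilner hm
      open ≤-Reasoning
      p q : ℕ
      p = prod r (set N i 1)
      q = prod r (set (λ ℓ → N ℓ ∸ 1) i 1)
      q≤p : q ≤ p
      q≤p = prod-mono r (set-mono (λ ℓ → m∸n≤m (N ℓ) 1) i ≤-refl)
      Y : Fin r → List ℕ
      Y ℓ = X ℓ minus lookup B ℓ
      K : List (Vec ℕ r)
      K = box r (set Y i [ x ])
      lengthK : length K ≡ q
      lengthK = trans (length-box r (set Y i [ x ])) (prod-cong r λ ℓ →
        trans (set-map length Y i [ x ] ℓ) (set-cong (λ ℓ → length-minus (uX ℓ) (B∈ ℓ)) i 1 ℓ))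
      uK : Unique K
      uK = box-unique r (set-elim Y i [ x ] (λ _ → Unique) ([] ∷ []) (λ ℓ _ → minus-unique _ (uX ℓ)))
      K⊆ : ∀ {A} → A ∈ K → ∀ ℓ → (ℓ ≡ i × lookup A ℓ ∈ [ x ]) ⊎ (ℓ ≢ i × lookup A ℓ ∈ Y ℓ)
      K⊆ {A} A∈ ℓ = set-elim Y i [ x ] (λ ℓ Z → lookup A ℓ ∈ Z → (ℓ ≡ i × lookup A ℓ ∈ [ x ]) ⊎ (ℓ ≢ i × lookup A ℓ ∈ Y ℓ))
        (λ ∈x → inj₁ (refl , ∈x)) (λ ℓ ℓ≢i ∈Y → inj₂ (ℓ≢i , ∈Y)) ℓ (∈-box⁻ {X = set Y i [ x ]} A∈ ℓ)
      Star : Vec ℕ r → Set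
      Star A = InBox X A × lookup A i ∈ [ x ]
      with-x : Card≤ (λ A → Star A × ∃ λ ℓ → ℓ ≢ i × lookup A ℓ ≡ lookup B ℓ) (p ∸ length K)
      with-x = Card≤-complement
        (Card≤-mono id (≤-reflexive (*-identityˡ p)) (Card≤-box₁ X i [ x ]))
        proj₁ uK
        (λ {A} A∈ → (λ ℓ → [ (λ { (refl , ∈x) → subst (_∈ X i) (sym (∈[]⇒≡ ∈x)) x∈ }) ,
                             (λ { (_ , ∈Y) → proj₁ (∈-minus⁻ (X ℓ) ∈Y) }) ]′ (K⊆ A∈ ℓ)) ,
                    [ proj₂ , (λ { (i≢i , _) → ⊥-elim (i≢i refl) }) ]′ (K⊆ A∈ i))
        (λ { A∈ (_ , ℓ , ℓ≢i , eq) → [ (λ { (ℓ≡i , _) → ℓ≢i ℓ≡i }) , (λ { (_ , ∈Y) → proj₂ (∈-minus⁻ (X ℓ) ∈Y) eq }) ]′ (K⊆ A∈ ℓ) })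
      without-x : Card≤ (InBox (set (λ ℓ → [ lookup B ℓ ]) i (X i minus x))) (N i ∸ 1)
      without-x = Card≤-mono id (≤-reflexive
        (trans (prod-cong r (set-map length _ i (X i minus x)))
          (trans (prod-set r (λ _ → 1) i _)
            (trans (cong₂ _*_ (length-minus (uX i) x∈) (trans (prod-cong r (set-id (λ _ → 1) i)) (trans (prod-const r 1) (^-zeroˡ r))))
              (*-identityʳ _)))))
        (Card≤-box (set (λ ℓ → [ lookup B ℓ ]) i (X i minus x)))
      classify : ∀ {A} → A ∈ G → (Star A × ∃ λ ℓ → ℓ ≢ i × lookup A ℓ ≡ lookup B ℓ)
                               ⊎ InBox (set (λ ℓ → [ lookup B ℓ ]) i (X i minus x)) A
      classify {A} A∈ with shape A∈
      ... | inj₁ (e , meets) = inj₁ ((inX A∈ , ≡⇒∈[] e) , meets)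
      ... | inj₂ (A≢x , eqs) = inj₂ (set-elim _ i _ (λ ℓ Z → lookup A ℓ ∈ Z) (∈-minus⁺ (inX A∈ i) A≢x) (λ ℓ ℓ≢i → ≡⇒∈[] (eqs ℓ ℓ≢i)))

    -- The edges containing all three vertices are assigned to the first pair only, hence one full
    -- factor `N l` and two factors lowered by 1.
    triangle-size : (t : Triangle) → let open Triangle t in
      length G ≤ prod r (set (set (set N i 1) j 1) l 1) * (N l + ((N j ∸ 1) + (N i ∸ 1)))
    triangle-size t = ≤-trans (Card≤-⊆ classify (Card≤-⊎ c₁₂ (Card≤-⊎ c₁₃ c₂₃)) uG id) (≤-reflexive (arith w (N l) (N j ∸ 1) (N i ∸ 1)))
      where
      open Triangle t
      w : ℕ
      w = prod r (set (set (set N i 1) j 1) l 1)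
      arith : ∀ w a b c → 1 * (1 * (a * w)) + (1 * (b * (1 * w)) + c * (1 * (1 * w))) ≡ w * (a + (b + c))
      arith = solve-∀
      x∈ : x ∈ X i
      x∈ with nontrivial j y
      ... | B , B∈ , B≢y = [ (λ e → subst (_∈ X i) e (inX B∈ i)) , (λ e → ⊥-elim (B≢y e)) ]′ (cover₁₂ B∈)
      y∈ : y ∈ X j
      y∈ with nontrivial i x
      ... | B , B∈ , B≢x = [ (λ e → ⊥-elim (B≢x e)) , (λ e → subst (_∈ X j) e (inX B∈ j)) ]′ (cover₁₂ B∈)
      In : List ℕ → List ℕ → List ℕ → Vec ℕ r → Set
      In P Q R A = InBox X A × lookup A i ∈ P × lookup A j ∈ Q × lookup A l ∈ R
      cIn : ∀ P Q R {p q} → length P ≡ p → length Q ≡ q → Card≤ (In P Q R) (p * (q * (length R * w)))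
      cIn P Q R refl refl = Card≤-box₃ X P Q R i≢j i≢l j≢l
      c₁₂ = cIn [ x ] [ y ] (X l) refl refl
      c₁₃ = cIn [ x ] (X j minus y) [ z ] refl (length-minus (uX j) y∈)
      c₂₃ = cIn (X i minus x) [ y ] [ z ] (length-minus (uX i) x∈) refl
      classify : ∀ {A} → A ∈ G → In [ x ] [ y ] (X l) A ⊎ (In [ x ] (X j minus y) [ z ] A ⊎ In (X i minus x) [ y ] [ z ] A)
      classify {A} A∈ with lookup A i ≟ x | lookup A j ≟ y | cover₁₂ A∈ | cover₁₃ A∈ | cover₂₃ A∈
      ... | yes e | yes e′ | _ | _ | _ = inj₁ (inX A∈ , ≡⇒∈[] e , ≡⇒∈[] e′ , inX A∈ l)
      ... | yes e | no ≢y  | _ | _ | inj₁ e′ = ⊥-elim (≢y e′)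
      ... | yes e | no ≢y  | _ | _ | inj₂ e″ = inj₂ (inj₁ (inX A∈ , ≡⇒∈[] e , ∈-minus⁺ (inX A∈ j) ≢y , ≡⇒∈[] e″))
      ... | no ≢x | _      | inj₁ e | _ | _ = ⊥-elim (≢x e)
      ... | no ≢x | _      | inj₂ _ | inj₁ e | _ = ⊥-elim (≢x e)
      ... | no ≢x | _      | inj₂ e′ | inj₂ e″ | _ = inj₂ (inj₂ (inX A∈ , ∈-minus⁺ (inX A∈ i) ≢x , ≡⇒∈[] e′ , ≡⇒∈[] e″))

    triangle-crude : Triangle → length G ≤ 3 * b ^ (1 + k)
    triangle-crude t = begin
      length G                                     ≤⟨ triangle-size t ⟩
      w * (N l + ((N j ∸ 1) + (N i ∸ 1)))          ≤⟨ *-mono-≤ (prod-set₃-≤ i≢j i≢l j≢l) (+-mono-≤ (X≤b l)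
                                                      (+-mono-≤ (≤-trans (m∸n≤m _ 1) (X≤b j)) (≤-trans (m∸n≤m _ 1) (X≤b i)))) ⟩
      b ^ k * (b + (b + b))                        ≡⟨ arith (b ^ k) b ⟩
      3 * b ^ (1 + k)                              ∎
      where
      open Triangle t
      open ≤-Reasoning
      w : ℕ
      w = prod r (set (set (set N i 1) j 1) l 1)
      arith : ∀ c b → c * (b + (b + b)) ≡ 3 * (b * c)
      arith = solve-∀

    -- One `b ^ (1 + k)` weaker than `Small`, but valid for every shape. It suffices once the stars
    -- of the peeled vertices have lost `m ^ (1 + k)` edges.
    Crude : Set
    Crude = length G ≤ (2 + k) * b ^ (1 + k) + r * (r * D₂) + b

    small⇒crude : Small → Crude
    small⇒crude s = ≤-trans s (≤-trans (+-monoˡ-≤ (r * (r * D₂)) (m≤n+m ((1 + k) * b ^ (1 + k)) (b ^ (1 + k)))) (m≤m+n _ b))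

    HiltonMilner⇒crude : HiltonMilner → Crude
    HiltonMilner⇒crude hm = ≤-trans (Card≤-⊆ classify (Card≤-⊎ with-x without-x) uG id)
      (+-monoˡ-≤ b (m≤m+n ((2 + k) * b ^ (1 + k)) (r * (r * D₂))))
      where
      open HiltonMilner hm
      with-x : Card≤ (λ A → ∃ λ c → InBox X A × lookup A i ≡ x × lookup A (punchIn i c) ≡ lookup B (punchIn i c)) ((2 + k) * b ^ (1 + k))
      with-x = Card≤-⋃ (2 + k) λ c → degree₂ x (lookup B (punchIn i c)) (≢-sym (punchInᵢ≢i i c))
      without-x : Card≤ (InBox (set (λ ℓ → [ lookup B ℓ ]) i (X i))) b
      without-x = Card≤-mono id (≤-trans (≤-reflexive
        (trans (prod-cong r (set-map length _ i (X i)))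
          (trans (prod-set r (λ _ → 1) i _)
            (trans (cong (N i *_) (trans (prod-cong r (set-id (λ _ → 1) i)) (trans (prod-const r 1) (^-zeroˡ r))))
              (*-identityʳ _))))) (X≤b i))
        (Card≤-box (set (λ ℓ → [ lookup B ℓ ]) i (X i)))
      classify : ∀ {A} → A ∈ G → (∃ λ c → InBox X A × lookup A i ≡ x × lookup A (punchIn i c) ≡ lookup B (punchIn i c))
                               ⊎ InBox (set (λ ℓ → [ lookup B ℓ ]) i (X i)) A
      classify {A} A∈ with shape A∈
      ... | inj₁ (e , ℓ , ℓ≢i , eq) = inj₁ (punchOut (≢-sym ℓ≢i) , inX A∈ , e ,
              subst (λ ℓ → lookup A ℓ ≡ lookup B ℓ) (sym (punchIn-punchOut (≢-sym ℓ≢i))) eq)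
      ... | inj₂ (A≢x , eqs) = inj₂ (set-elim _ i _ (λ ℓ Z → lookup A ℓ ∈ Z) (inX A∈ i) (λ ℓ ℓ≢i → ≡⇒∈[] (eqs ℓ ℓ≢i)))

    -- A triangle family has at most 3 `b ^ (1 + k)` edges. This is within `Small` as soon as 3 ≤ r
    -- - 2, and for r = 3 the family is Hilton-Milner, so a triangle survives only for r = 4.
    classification : Small ⊎ HiltonMilner ⊎ (k ≡ 1 × Triangle)
    classification with trichotomy
    ... | inj₁ s = inj₁ s
    ... | inj₂ (inj₁ hm) = inj₂ (inj₁ hm)
    ... | inj₂ (inj₂ t) with k ≟ 0 | k ≟ 1
    ...   | yes k≡0 | _ = inj₂ (inj₁ (triangle⇒HiltonMilner (three-parts k≡0) t))
    ...   | no _ | yes k≡1 = inj₂ (inj₂ (k≡1 , t))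
    ...   | no k≢0 | no k≢1 = inj₁ (≤-trans (triangle-crude t)
              (≤-trans (*-monoˡ-≤ (b ^ (1 + k)) (s≤s (≤∧≢⇒< (n≢0⇒n>0 k≢0) (≢-sym k≢1)))) (m≤m+n _ (r * (r * D₂)))))

    crude : Crude
    crude with classification
    ... | inj₁ s = small⇒crude s
    ... | inj₂ (inj₁ hm) = HiltonMilner⇒crude hm
    ... | inj₂ (inj₂ (k≡1 , t)) = ≤-trans (triangle-crude t)
          (≤-trans (*-monoˡ-≤ (b ^ (1 + k)) (s≤s (s≤s (≤-reflexive (sym k≡1)))))
            (≤-trans (m≤m+n ((2 + k) * b ^ (1 + k)) (r * (r * D₂))) (m≤m+n _ b)))

-- Matchings and covers

Meets : ∀ {r} → Vec ℕ r → Vec ℕ r → Set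
Meets A B = ∃ λ ℓ → lookup A ℓ ≡ lookup B ℓ

meets-or-disjoint : ∀ {r} (A B : Vec ℕ r) → Meets A B ⊎ Disjoint A B
meets-or-disjoint A B with anyᶠ? (λ ℓ → lookup A ℓ ≟ lookup B ℓ)
... | yes m = inj₁ m
... | no ¬m = inj₂ λ ℓ e → ¬m (ℓ , e)

search : {T : Set} {P Q : T → Set} (L : List T) → (∀ {a} → a ∈ L → P a ⊎ Q a) →
  (∀ {a} → a ∈ L → P a) ⊎ (∃ λ a → a ∈ L × Q a)
search []      f = inj₁ λ ()
search (a ∷ L) f with f (here refl) | search L (f ∘ there)
... | inj₂ q | _                  = inj₂ (a , here refl , q)
... | inj₁ p | inj₁ ps            = inj₁ λ { (here refl) → p ; (there b∈) → ps b∈ }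
... | inj₁ p | inj₂ (b , b∈ , q)  = inj₂ (b , there b∈ , q)

meets-some-or-disjoint : ∀ {r} (A : Vec ℕ r) M → (∃ λ B → B ∈ M × Meets A B) ⊎ All (Disjoint A) M
meets-some-or-disjoint A M with search M (λ {B} _ → swap (meets-or-disjoint A B))
... | inj₁ disjoint = inj₂ (All.tabulate disjoint)
... | inj₂ meets    = inj₁ meets

Matching≤ : ∀ {r} → ℕ → List (Vec ℕ r) → Set
Matching≤ s F = ∀ M → (∀ {A} → A ∈ M → A ∈ F) → AllPairs Disjoint M → length M ≤ s

maximal-matching : ∀ {r} (F : List (Vec ℕ (suc r))) → Σ (List (Vec ℕ (suc r))) λ M →
  (∀ {A} → A ∈ M → A ∈ F) × AllPairs Disjoint M × (∀ {A} → A ∈ F → ∃ λ B → B ∈ M × Meets A B)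
maximal-matching [] = [] , (λ ()) , [] , λ ()
maximal-matching (A ∷ F) with maximal-matching F
... | M , M⊆F , dM , meetsM with meets-some-or-disjoint A M
...   | inj₁ mA = M , there ∘ M⊆F , dM , λ { (here refl) → mA ; (there B∈) → meetsM B∈ }
...   | inj₂ dA = A ∷ M , (λ { (here refl) → here refl ; (there B∈) → there (M⊆F B∈) }) , dA ∷ dM ,
        -- `A` has to meet itself, which takes at least one part; hence `suc r`.
        λ { (here refl) → A , here refl , fzero , refl
          ; (there B∈) → let C , C∈ , m = meetsM B∈ in C , there C∈ , m }

Card≤-⋃-saving : {A B : Set} (M : List B) {D e : ℕ} {Q : B → A → Set} → e ≤ D → (∀ {b} → b ∈ M → Card≤ (Q b) D) →
  ∀ {c} → c ∈ M → Card≤ (Q c) (D ∸ e) → Card≤ (λ a → ∃ λ b → b ∈ M × Q b a) (length M * D ∸ e)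
Card≤-⋃-saving (b ∷ M) {D} {e} e≤D cQ (here refl) cQb = Card≤-mono
  (λ { (_ , here refl , q) → inj₁ q ; (c , there c∈ , q) → inj₂ (c , c∈ , q) })
  (≤-reflexive (sym (+-∸-comm (length M * D) e≤D)))
  (Card≤-⊎ cQb (Card≤-⋃-list M (cQ ∘ there)))
Card≤-⋃-saving (b ∷ M) {D} {e} e≤D cQ (there c∈) cQc = Card≤-mono
  (λ { (_ , here refl , q) → inj₁ q ; (c , there c∈ , q) → inj₂ (c , c∈ , q) })
  (≤-reflexive (sym (+-∸-assoc D (e≤ M c∈))))
  (Card≤-⊎ (cQ (here refl)) (Card≤-⋃-saving M e≤D (cQ ∘ there) c∈ cQc))
  where
  e≤ : ∀ M {c} → c ∈ M → e ≤ length M * D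
  e≤ (_ ∷ M) _ = ≤-trans e≤D (m≤m+n D _)

-- Peeling off heavy vertices, and the stars of the peeled vertices

module Peeling (k : ℕ) (X : Fin (3 + k) → List ℕ) (b : ℕ) (1≤b : 1 ≤ b) (X≤b : ∀ ℓ → length (X ℓ) ≤ b) (s₀ : ℕ) where

  open Codegree k X b 1≤b X≤b

  private
    r D₁ : ℕ
    r  = 3 + k
    -- A matching of at most `s₀` edges, each with `r` vertices, each in at most b^(r-2) edges
    -- together with a given vertex of another part. The initial `s₀` is kept throughout the
    -- recursion, so one threshold serves all stages.
    D₁ = s₀ * (r * b ^ (1 + k))

  -- `t` is what is left of the bound on ν after one unit has been spent on each vertex of `H`. The
  -- field `occurs` places `H` inside the parts; since later vertices lie on edges avoiding the
  -- earlier ones, it also yields `uH`.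
  record Peeled (s : ℕ) (F : List (Vec ℕ r)) : Set where
    field
      H      : List (Vertex r)
      t      : ℕ
      G      : List (Vec ℕ r)
      size≡  : length H + t ≡ s
      uG     : Unique G
      G⊆F    : ∀ {A} → A ∈ G → A ∈ F
      avoids : ∀ {A} → A ∈ G → ∀ {i x} → (i , x) ∈ H → lookup A i ≢ x
      covers : ∀ {A} → A ∈ F → A ∈ G ⊎ ∃ λ v → v ∈ H × lookup A (proj₁ v) ≡ proj₂ v
      νG     : Matching≤ t G
      light  : ∀ i x → Card≤ (λ A → A ∈ G × lookup A i ≡ x) D₁
      uH     : Unique H
      occurs : ∀ {i x} → (i , x) ∈ H → ∃ λ A → A ∈ F × lookup A i ≡ x

  Heavy : List (Vec ℕ r) → Fin r → ℕ → Set
  Heavy F i x = ¬ Card≤ (λ A → A ∈ F × lookup A i ≡ x) D₁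

  avoid? : ∀ (i : Fin r) x → Decidable (λ (A : Vec ℕ r) → lookup A i ≢ x)
  avoid? i x A = ¬? (lookup A i ≟ x)

  -- A matching that avoids a heavy vertex can be extended by an edge through that vertex.
  heavy-ν : ∀ {s F} i x → suc s ≤ s₀ → (∀ {A} → A ∈ F → InBox X A) → Matching≤ (suc s) F →
    Heavy F i x → Matching≤ s (filter (avoid? i x) F)
  heavy-ν {s} {F} i x s<s₀ inX νF heavy M M⊆ dM = extend (search F λ {A} _ → through A)
    where
    M⊆F : ∀ {A} → A ∈ M → A ∈ F
    M⊆F = proj₁ ∘ ∈-filter⁻ (avoid? i x) ∘ M⊆
    M≢x : ∀ {A} → A ∈ M → lookup A i ≢ x
    M≢x = proj₂ ∘ ∈-filter⁻ (avoid? i x) {xs = F} ∘ M⊆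
    through : ∀ A → (lookup A i ≡ x → ∃ λ B → B ∈ M × Meets A B) ⊎ (lookup A i ≡ x × All (Disjoint A) M)
    through A with lookup A i ≟ x | meets-some-or-disjoint A M
    ... | no ≢x  | _       = inj₁ λ e → ⊥-elim (≢x e)
    ... | yes e  | inj₁ m  = inj₁ λ _ → m
    ... | yes e  | inj₂ d  = inj₂ (e , d)
    meets-at : ∀ {B} → B ∈ M → ∀ ℓ → Card≤ (λ A → InBox X A × lookup A i ≡ x × lookup A ℓ ≡ lookup B ℓ) (b ^ (1 + k))
    meets-at {B} B∈ ℓ with i ≟ᶠ ℓ
    ... | yes refl = Card≤-∅ λ { (_ , e , e′) → M≢x B∈ (trans (sym e′) e) }
    ... | no i≢ℓ   = degree₂ x (lookup B ℓ) i≢ℓ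
    extend : (∀ {A} → A ∈ F → lookup A i ≡ x → ∃ λ B → B ∈ M × Meets A B)
           ⊎ (∃ λ A → A ∈ F × lookup A i ≡ x × All (Disjoint A) M) → length M ≤ s
    extend (inj₂ (A , A∈ , _ , dA)) = ≤-pred (νF (A ∷ M) (λ { (here refl) → A∈ ; (there B∈) → M⊆F B∈ }) (dA ∷ dM))
    extend (inj₁ meets) = ⊥-elim (heavy (Card≤-mono
      (λ { (A∈ , e) → let B , B∈ , ℓ , e′ = meets A∈ e in B , B∈ , ℓ , inX A∈ , e , e′ })
      (*-monoˡ-≤ (r * b ^ (1 + k)) (≤-trans (νF M M⊆F dM) s<s₀))
      (Card≤-⋃-list M λ B∈ → Card≤-⋃ r (meets-at B∈))))

  peel : ∀ s → s ≤ s₀ → (F : List (Vec ℕ r)) → Unique F → (∀ {A} → A ∈ F → InBox X A) → Matching≤ s F → Peeled s F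
  -- A vertex on no edge is light, so testing the vertices of the edges is enough to find a heavy
  -- one.
  peel s s≤ F uF inX νF with any? (λ A → anyᶠ? λ i → ¬? (Card≤? (λ B → lookup B i ≟ lookup A i) F uF D₁)) F
  peel s s≤ F uF inX νF | no none = record
    { H = [] ; t = s ; G = F ; size≡ = refl ; uG = uF ; G⊆F = id ; avoids = λ _ () ; covers = inj₁ ; νG = νF
    ; light = light ; uH = [] ; occurs = λ () }
    where
    light : ∀ i x → Card≤ (λ A → A ∈ F × lookup A i ≡ x) D₁
    light i x {[]} _ _ = z≤n
    light i x {A ∷ L} uL L⊆ with L⊆ (here refl)
    ... | A∈ , refl with Card≤? (λ B → lookup B i ≟ lookup A i) F uF D₁
    ...   | yes c = c uL L⊆
    ...   | no ¬c = ⊥-elim (none (lose A∈ (i , ¬c)))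
  peel s s≤ F uF inX νF | yes found with find found
  peel zero s≤ F uF inX νF | yes found | A , A∈ , i , heavy =
    ⊥-elim (n≮0 (νF [ A ] (λ { (here refl) → A∈ }) ([] ∷ [])))
  peel (suc s) s≤ F uF inX νF | yes found | A₀ , A₀∈ , i₀ , heavy = record
    { H = v ∷ H ; t = t ; G = G ; size≡ = cong suc size≡ ; uG = uG
    ; G⊆F = F′⊆F ∘ G⊆F
    ; avoids = λ { A∈ (here refl) → proj₂ (∈-filter⁻ (avoid? i₀ x₀) {xs = F} (G⊆F A∈)) ; A∈ (there v∈) → avoids A∈ v∈ }
    ; covers = covers′
    ; νG = νG ; light = light
    ; uH = ∉⇒All≢ v∉H ∷ uH
    ; occurs = λ { (here refl) → A₀ , A₀∈ , refl ; (there v∈) → let A , A∈ , e = occurs v∈ in A , F′⊆F A∈ , e } }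
    where
    x₀ : ℕ
    x₀ = lookup A₀ i₀
    v : Vertex r
    v = i₀ , x₀
    F′ : List (Vec ℕ r)
    F′ = filter (avoid? i₀ x₀) F
    F′⊆F : ∀ {A} → A ∈ F′ → A ∈ F
    F′⊆F = proj₁ ∘ ∈-filter⁻ (avoid? i₀ x₀)
    open Peeled (peel s (≤-trans (n≤1+n s) s≤) F′ (Uniqueₚ.filter⁺ (avoid? i₀ x₀) uF) (inX ∘ F′⊆F)
      (heavy-ν i₀ x₀ s≤ inX νF heavy))
    v∉H : v ∉ H
    v∉H v∈ = let A , A∈ , e = occurs v∈ in proj₂ (∈-filter⁻ (avoid? i₀ x₀) {xs = F} A∈) e
    covers′ : ∀ {A} → A ∈ F → A ∈ G ⊎ ∃ λ w → w ∈ v ∷ H × lookup A (proj₁ w) ≡ proj₂ w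
    covers′ {A} A∈ with lookup A i₀ ≟ x₀
    ... | yes e = inj₂ (v , here refl , e)
    ... | no ≢x = [ inj₁ , (λ { (w , w∈ , e) → inj₂ (w , there w∈ , e) }) ]′ (covers (∈-filter⁺ (avoid? i₀ x₀) A∈ ≢x))

  -- A maximal matching has at most `t` edges; their vertices cover `G`, and each of them is light.
  residual-size : ∀ {s F} (p : Peeled s F) → length (Peeled.G p) ≤ Peeled.t p * (r * D₁)
  residual-size p with maximal-matching (Peeled.G p)
  ... | M , M⊆ , dM , meetsM = ≤-trans
    (Card≤-⊆ (λ A∈ → let B , B∈ , ℓ , e = meetsM A∈ in B , B∈ , ℓ , A∈ , e)
      (Card≤-⋃-list M {Q = λ B A → ∃ λ ℓ → A ∈ G × lookup A ℓ ≡ lookup B ℓ} (λ {B} _ → Card≤-⋃ r λ ℓ → light ℓ (lookup B ℓ))) uG id)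
    (*-monoˡ-≤ (r * D₁) (νG M M⊆ dM))
    where open Peeled p

  module _ (m : ℕ) (1≤m : 1 ≤ m) (f : Fin r) (m≡ : length (X f) ≡ m) (m≤ : ∀ ℓ → m ≤ length (X ℓ)) (uX : ∀ ℓ → Unique (X ℓ)) where

    N : Fin r → ℕ
    N = length ∘ X

    -- The size of a full star in a smallest part; by `prod-set₁-≤P` no other star in the box is
    -- larger.
    P : ℕ
    P = prod r (set N f 1)

    m^≤prod-set₂ : ∀ {i j} → i ≢ j → m ^ (1 + k) ≤ prod r (set (set N i 1) j 1)
    m^≤prod-set₂ {i} {j} i≢j = ≤-trans (≤-reflexive (sym (prod-set₂-const m 1≤m (1 + k) i≢j)))
      (prod-mono r (set-mono (set-mono m≤ i ≤-refl) j ≤-refl))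

    prod-set₁-≤P : ∀ i → prod r (set N i 1) ≤ P
    prod-set₁-≤P i with i ≟ᶠ f
    ... | yes refl = ≤-refl
    ... | no i≢f = begin
      prod r (set N i 1)                      ≡⟨ prod-set₁≡ N (≢-sym i≢f) ⟩
      N f * prod r (set (set N f 1) i 1)      ≡⟨ cong₂ _*_ m≡ (prod-cong r (set-comm N 1 1 (≢-sym i≢f))) ⟩
      m * prod r (set (set N i 1) f 1)        ≤⟨ *-monoˡ-≤ _ (m≤ i) ⟩
      N i * prod r (set (set N i 1) f 1)      ≡⟨ sym (prod-set₁≡ N i≢f) ⟩
      P ∎
      where open ≤-Reasoning

    m^≤P : m ^ (1 + k) ≤ P
    m^≤P = ≤-trans (m≤n*m (m ^ (1 + k)) m {{>-nonZero 1≤m}})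
      (≤-trans (≤-reflexive (sym (prod-set₁-const m 1≤m (2 + k) f))) (prod-mono r (set-mono m≤ f ≤-refl)))

    -- Up to the common product `R` of the remaining parts, the two stars have `m` and `N i` copies,
    -- and `N i` exceeds `m`. The loss is thus at least one `R`, a product of r - 2 factors of size
    -- at least `m`.
    larger-part : ∀ {i} → N i ≢ m → prod r (set N i 1) ≤ P ∸ m ^ (1 + k)
    larger-part {i} Nᵢ≢m = m+n≤o⇒m≤o∸n _ (begin
      prod r (set N i 1) + m ^ (1 + k)                  ≤⟨ +-monoʳ-≤ _ (m^≤prod-set₂ i≢f) ⟩
      prod r (set N i 1) + R                            ≡⟨ cong (_+ R) (trans (prod-set₁≡ N (≢-sym i≢f)) (cong₂ _*_ m≡ (prod-cong r (set-comm N 1 1 (≢-sym i≢f))))) ⟩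
      m * R + R                                         ≡⟨ +-comm (m * R) R ⟩
      suc m * R                                         ≤⟨ *-monoˡ-≤ R (≤∧≢⇒< (m≤ i) (≢-sym Nᵢ≢m)) ⟩
      N i * R                                           ≡⟨ sym (prod-set₁≡ N i≢f) ⟩
      P ∎)
      where
      open ≤-Reasoning
      i≢f : i ≢ f
      i≢f refl = Nᵢ≢m m≡
      R : ℕ
      R = prod r (set (set N i 1) f 1)

    module _ {s F} (inX : ∀ {A} → A ∈ F → InBox X A) (uF : Unique F) (p : Peeled s F) where
      open Peeled p

      private
        Hit : Vertex r → Vec ℕ r → Set
        Hit (i , x) A = InBox X A × lookup A i ≡ x

        hit-≤ : ∀ i x → Card≤ (Hit (i , x)) (prod r (set N i 1))
        hit-≤ i x = Card≤-mono (λ { (inX , e) → inX , ≡⇒∈[] e }) (≤-reflexive (*-identityˡ _)) (Card≤-box₁ X i [ x ])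

        hit-≤P : ∀ v → Card≤ (Hit v) P
        hit-≤P (i , x) = Card≤-mono id (prod-set₁-≤P i) (hit-≤ i x)

      star-bound : length F ≤ length G + length H * P
      star-bound = Card≤-⊆ (λ A∈ → [ inj₁ , (λ { (v , v∈ , e) → inj₂ (v , v∈ , inX A∈ , e) }) ]′ (covers A∈))
        (Card≤-⊎ (Card≤-list G) (Card≤-⋃-list H {Q = Hit} (λ {v} _ → hit-≤P v))) uF id

      private
        m^≤HP : ∀ {v} → v ∈ H → m ^ (1 + k) ≤ length H * P
        m^≤HP v∈ = ≤-trans m^≤P (nonempty H v∈)
          where
          nonempty : ∀ (H : List (Vertex r)) {v} → v ∈ H → P ≤ length H * P
          nonempty (_ ∷ H) _ = m≤m+n P _

        saved : ∀ {v} → v ∈ H → length F ≤ length G + (length H * P ∸ m ^ (1 + k)) →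
          length F + m ^ (1 + k) ≤ length G + length H * P
        saved v∈ le = begin
          length F + m ^ (1 + k)                                           ≤⟨ +-monoˡ-≤ (m ^ (1 + k)) le ⟩
          length G + (length H * P ∸ m ^ (1 + k)) + m ^ (1 + k)            ≡⟨ +-assoc (length G) _ (m ^ (1 + k)) ⟩
          length G + (length H * P ∸ m ^ (1 + k) + m ^ (1 + k))            ≡⟨ cong (length G +_) (m∸n+n≡m (m^≤HP v∈)) ⟩
          length G + length H * P ∎
          where open ≤-Reasoning

        saving₁ : ∀ {i x} → (i , x) ∈ H → N i ≢ m → length F + m ^ (1 + k) ≤ length G + length H * P
        saving₁ {i} {x} v∈ Nᵢ≢m = saved v∈
          (Card≤-⊆ (λ A∈ → [ inj₁ , (λ { (v , v∈ , e) → inj₂ (v , v∈ , inX A∈ , e) }) ]′ (covers A∈))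
          (Card≤-⊎ (Card≤-list G) (Card≤-⋃-saving H {Q = Hit} m^≤P (λ {v} _ → hit-≤P v) v∈
            (Card≤-mono id (larger-part Nᵢ≢m) (hit-≤ i x)))) uF id)

        -- The edges through both vertices are charged only to (i , x).
        saving₂ : ∀ {i x j y} → (i , x) ∈ H → (j , y) ∈ H → i ≢ j → length F + m ^ (1 + k) ≤ length G + length H * P
        saving₂ {i} {x} {j} {y} v∈ w∈ i≢j = saved w∈ (Card≤-⊆ classify
          (Card≤-⊎ (Card≤-list G) (Card≤-⋃-saving H {Q = Q} m^≤P (λ {v} _ → Card≤-⊆ proj₁ (hit-≤P v)) w∈
            (Card≤-mono (λ { ((inX , e) , ≢x) → inX , ∈-minus⁺ (inX i) (≢x refl) , ≡⇒∈[] e }) bound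
              (Card≤-box₂ X (X i minus x) [ y ] i≢j)))) uF id)
          where
          Q : Vertex r → Vec ℕ r → Set
          Q v A = Hit v A × (v ≡ (j , y) → lookup A i ≢ x)
          x∈X : x ∈ X i
          x∈X = let A , A∈ , e = occurs v∈ in subst (_∈ X i) e (inX A∈ i)
          R : ℕ
          R = prod r (set (set N i 1) j 1)
          bound : length (X i minus x) * (1 * R) ≤ P ∸ m ^ (1 + k)
          bound = begin
            length (X i minus x) * (1 * R) ≡⟨ cong₂ _*_ (length-minus (uX i) x∈X) (*-identityˡ R) ⟩
            (N i ∸ 1) * R                  ≡⟨ *-distribʳ-∸ R (N i) 1 ⟩
            N i * R ∸ 1 * R                ≡⟨ cong₂ _∸_ (sym (prod-set₁≡ N i≢j)) (*-identityˡ R) ⟩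
            prod r (set N j 1) ∸ R         ≤⟨ ∸-mono (prod-set₁-≤P j) (m^≤prod-set₂ i≢j) ⟩
            P ∸ m ^ (1 + k)                ∎
            where open ≤-Reasoning
          classify : ∀ {A} → A ∈ F → A ∈ G ⊎ ∃ λ v → v ∈ H × Q v A
          classify {A} A∈ with covers A∈ | lookup A i ≟ x
          ... | inj₁ A∈G            | _     = inj₁ A∈G
          ... | inj₂ _              | yes e = inj₂ ((i , x) , v∈ , (inX A∈ , e) , λ { refl → ⊥-elim (i≢j refl) })
          ... | inj₂ (v , v∈ , e)   | no ≢x = inj₂ (v , v∈ , (inX A∈ , e) , λ _ → ≢x)

      -- It is enough to compare all of `H` with its first vertex: either that vertex lies in a
      -- larger part, or another vertex lies in a different part and the two stars overlap, or all
      -- vertices share one part of size `m`.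
      one-part-or-saving : (∃ λ j → N j ≡ m × ∀ {i x} → (i , x) ∈ H → i ≡ j)
                         ⊎ length F + m ^ (1 + k) ≤ length G + length H * P
      one-part-or-saving = go H id
        where
        go : ∀ H′ → (∀ {v} → v ∈ H′ → v ∈ H) → (∃ λ j → N j ≡ m × ∀ {i x} → (i , x) ∈ H′ → i ≡ j)
                                            ⊎ length F + m ^ (1 + k) ≤ length G + length H * P
        -- If `H` is empty, any part of size `m` will do, and `f` is one.
        go [] H′⊆ = inj₁ (f , m≡ , λ ())
        go ((i , x) ∷ H′) H′⊆ with N i ≟ m
        ... | no Nᵢ≢m = inj₂ (saving₁ (H′⊆ (here refl)) Nᵢ≢m)
        ... | yes Nᵢ≡m with search ((i , x) ∷ H′) (λ {v} _ → same v)
          where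
          same : ∀ (v : Vertex r) → proj₁ v ≡ i ⊎ i ≢ proj₁ v
          same (j , _) with j ≟ᶠ i
          ... | yes e = inj₁ e
          ... | no ≢  = inj₂ (≢-sym ≢)
        ...   | inj₁ all-same          = inj₁ (i , Nᵢ≡m , all-same)
        ...   | inj₂ (w , w∈ , i≢j)    = inj₂ (saving₂ (H′⊆ (here refl)) (H′⊆ w∈) i≢j)

-- Estimates

-- Lowering the factors one at a time loses, in each of the `suc j` steps, a product of `j` factors
-- that are at least m - 1. This is the lower bound for P - P⁻, the main term of a Hilton-Milner
-- family.
prod-∸1-gap : ∀ j (g : Fin (suc j) → ℕ) m → 1 ≤ m → (∀ i → m ≤ g i) →
  prod (suc j) (λ i → g i ∸ 1) + suc j * (m ∸ 1) ^ j ≤ prod (suc j) g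
prod-∸1-gap zero g m 1≤m m≤g with g fzero | m≤g fzero
... | zero  | m≤ = ⊥-elim (n≮0 (≤-trans 1≤m m≤))
... | suc u | _  = ≤-reflexive (arith u)
  where
  arith : ∀ u → u * 1 + 1 * 1 ≡ (1 + u) * 1
  arith = solve-∀
prod-∸1-gap (suc j) g m 1≤m m≤g with g fzero | m≤g fzero
... | zero  | m≤ = ⊥-elim (n≮0 (≤-trans 1≤m m≤))
... | suc u | m≤ = begin
    u * A′ + suc (suc j) * (d * d ^ j)              ≡⟨ arith u A′ j d (d ^ j) ⟩
    u * A′ + d * (suc j * d ^ j) + d * d ^ j        ≤⟨ +-mono-≤ (+-monoʳ-≤ (u * A′) (*-monoˡ-≤ _ (∸-monoˡ-≤ 1 m≤))) d^≤A ⟩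
    u * A′ + u * (suc j * d ^ j) + A                ≡⟨ cong (_+ A) (sym (*-distribˡ-+ u A′ _)) ⟩
    u * (A′ + suc j * d ^ j) + A                    ≤⟨ +-monoˡ-≤ A (*-monoʳ-≤ u (prod-∸1-gap j (g ∘ fsuc) m 1≤m (m≤g ∘ fsuc))) ⟩
    u * A + A                                       ≡⟨ +-comm (u * A) A ⟩
    suc u * A                                       ∎
  where
  open ≤-Reasoning
  A A′ d : ℕ
  A  = prod (suc j) (g ∘ fsuc)
  A′ = prod (suc j) (λ i → g (fsuc i) ∸ 1)
  d  = m ∸ 1
  d^≤A : d * d ^ j ≤ A
  d^≤A = ≤-trans (≤-reflexive (sym (prod-const (suc j) d))) (prod-mono (suc j) λ i → ≤-trans (m∸n≤m m 1) (m≤g (fsuc i)))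
  arith : ∀ u A′ j d e → u * A′ + (2 + j) * (d * e) ≡ u * A′ + d * ((1 + j) * e) + d * e
  arith = solve-∀

-- The reverse estimate for equal factors: it compares m^(r-2) with the (m - 1)^(r-2) that
-- `prod-∸1-gap` produces.
^-∸1-gap : ∀ m j → suc m ^ suc j ≤ m ^ suc j + suc j * suc m ^ j
^-∸1-gap m zero = ≤-reflexive (arith m)
  where
  arith : ∀ m → (1 + m) * 1 ≡ m * 1 + 1 * 1
  arith = solve-∀
^-∸1-gap m (suc j) = begin
  suc m * suc m ^ suc j                                   ≤⟨ *-monoʳ-≤ (suc m) (^-∸1-gap m j) ⟩
  suc m * (m ^ suc j + suc j * M)                         ≡⟨ arith m (m ^ suc j) j M ⟩
  m * m ^ suc j + (m ^ suc j + suc j * (suc m * M))       ≤⟨ +-monoʳ-≤ (m * m ^ suc j) (+-monoˡ-≤ _ (^-monoˡ-≤ (suc j) (n≤1+n m))) ⟩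
  m * m ^ suc j + (suc m ^ suc j + suc j * (suc m * M))   ∎
  where
  open ≤-Reasoning
  M : ℕ
  M = suc m ^ j
  arith : ∀ m x j M → (1 + m) * (x + (1 + j) * M) ≡ m * x + (x + (1 + j) * ((1 + m) * M))
  arith = solve-∀

-- (1 + 1/q)^j ≤ 1 + excess j / q
excess : ℕ → ℕ
excess zero    = 0
excess (suc j) = suc (2 * excess j)

-- With a = `excess j`, the product (1 + a/q)(1 + 1/q) is 1 + (a + 1 + a/q)/q, and a/q ≤ a gives the
-- recursion `suc (2 * a)`. Multiplying by `q` avoids fractions.
ratio-^ : ∀ q b m → 1 ≤ q → q * b ≤ (q + 1) * m → ∀ j → q * b ^ j ≤ (q + excess j) * m ^ j
ratio-^ q b m 1≤q qb≤ zero = ≤-reflexive (cong (_* 1) (sym (+-identityʳ q)))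
ratio-^ q b m 1≤q qb≤ (suc j) = *-cancelˡ-≤ q {{>-nonZero 1≤q}} (begin
  q * (q * (b * b ^ j))                      ≡⟨ arith₁ q b (b ^ j) ⟩
  (q * b ^ j) * (q * b)                      ≤⟨ *-mono-≤ (ratio-^ q b m 1≤q qb≤ j) qb≤ ⟩
  (q + a) * m ^ j * ((q + 1) * m)            ≡⟨ arith₂ q a (m ^ j) m ⟩
  (q * q + q + a * q + a) * (m * m ^ j)      ≤⟨ *-monoˡ-≤ (m * m ^ j) (+-monoʳ-≤ (q * q + q + a * q) (m≤m*n a q {{>-nonZero 1≤q}})) ⟩
  (q * q + q + a * q + a * q) * (m * m ^ j)  ≡⟨ arith₃ q a (m * m ^ j) ⟩
  q * ((q + suc (2 * a)) * (m * m ^ j))      ∎)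
  where
  open ≤-Reasoning
  a : ℕ
  a = excess j
  arith₁ : ∀ q b x → q * (q * (b * x)) ≡ (q * x) * (q * b)
  arith₁ = solve-∀
  arith₂ : ∀ q a x m → (q + a) * x * ((q + 1) * m) ≡ (q * q + q + a * q + a) * (m * x)
  arith₂ = solve-∀
  arith₃ : ∀ q a x → (q * q + q + a * q + a * q) * x ≡ q * ((q + (1 + 2 * a)) * x)
  arith₃ = solve-∀

ratio-2 : ∀ q b m → 1 ≤ q → q * b ≤ (q + 1) * m → b ≤ 2 * m
ratio-2 q b m 1≤q qb≤ = *-cancelˡ-≤ q {{>-nonZero 1≤q}} (begin
  q * b       ≤⟨ qb≤ ⟩
  (q + 1) * m ≤⟨ *-monoˡ-≤ m (+-monoʳ-≤ q 1≤q) ⟩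
  (q + q) * m ≡⟨ arith q m ⟩
  q * (2 * m) ∎)
  where
  open ≤-Reasoning
  arith : ∀ q m → (q + q) * m ≡ q * (2 * m)
  arith = solve-∀

^-*-2 : ∀ {b m} → b ≤ 2 * m → ∀ j → b ^ j ≤ 2 ^ j * m ^ j
^-*-2         b≤ zero    = ≤-refl
^-*-2 {b} {m} b≤ (suc j) = ≤-trans (*-mono-≤ b≤ (^-*-2 b≤ j)) (≤-reflexive (arith 2 m (2 ^ j) (m ^ j)))
  where
  arith : ∀ c m x y → c * m * (x * y) ≡ c * x * (m * y)
  arith = solve-∀

-- 1/q is the δ of the theorem. In `crude-estimate`, scaled by `q`, passing from b to m costs
-- `κ * excess (1 + k)` copies of m^(r-2), and the surplus provides `q` copies. The two extra copies
-- pay for the additional m in (q + 1) m and for the terms of order m^(r-3), collected in `N₁`. `N₂`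
-- is the constant of `matching-estimate`.
module Constants (k s : ℕ) where

  r κ q N₁ N₂ N₀ : ℕ
  r  = 3 + k
  κ  = 2 + k
  q  = κ * excess (1 + k) + 2
  N₁ = q * (r * (r * r) * 2 ^ k + κ * (1 + k) + s)
  N₂ = s * (r * (s * (r * 2 ^ (1 + k))))
  N₀ = N₁ + N₂ + (3 + s)

  1≤q : 1 ≤ q
  1≤q = ≤-trans (s≤s z≤n) (m≤n+m 2 (κ * excess (1 + k)))

  module _ {b m : ℕ} (N₀≤m : N₀ ≤ m) (qb≤ : q * b ≤ (q + 1) * m) where

    b≤2m : b ≤ 2 * m
    b≤2m = ratio-2 q b m 1≤q qb≤

    3+s≤m : 3 + s ≤ m
    3+s≤m = ≤-trans (m≤n+m (3 + s) (N₁ + N₂)) N₀≤m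

    -- A residue with ν at most s and no heavy vertex is no larger than one full star, since its
    -- order b^(r-2) is one below that of a star.
    matching-estimate : s * (r * (s * (r * b ^ (1 + k)))) ≤ m ^ (2 + k)
    matching-estimate = begin
      s * (r * (s * (r * b ^ (1 + k))))                 ≤⟨ *-monoʳ-≤ s (*-monoʳ-≤ r (*-monoʳ-≤ s (*-monoʳ-≤ r (^-*-2 {m = m} b≤2m (1 + k))))) ⟩
      s * (r * (s * (r * (2 ^ (1 + k) * m ^ (1 + k))))) ≡⟨ arith s r (2 ^ (1 + k)) (m ^ (1 + k)) ⟩
      N₂ * m ^ (1 + k)                                  ≤⟨ *-monoˡ-≤ (m ^ (1 + k)) (≤-trans (≤-trans (m≤n+m N₂ N₁) (m≤m+n (N₁ + N₂) (3 + s))) N₀≤m) ⟩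
      m ^ (2 + k)                                       ∎
      where
      open ≤-Reasoning
      arith : ∀ s r x y → s * (r * (s * (r * (x * y)))) ≡ s * (r * (s * (r * x))) * y
      arith = solve-∀

  -- On the left is the bound `Crude` with s added. On the right, the first term is the guaranteed
  -- part of P - P⁻, and `m ^ (1 + k)` is the deficit gained elsewhere, which pays for the
  -- difference between b and m and for the lower order terms.
  crude-estimate : ∀ {b m} → N₀ ≤ m → q * b ≤ (q + 1) * m →
    κ * b ^ (1 + k) + r * (r * (r * b ^ k)) + b + s ≤ κ * (m ∸ 1) ^ (1 + k) + m + m ^ (1 + k)
  crude-estimate {b} {zero}  N₀≤ qb≤ = ⊥-elim (n≮0 (3+s≤m {b} N₀≤ qb≤))
  crude-estimate {b} {suc d} N₀≤ qb≤ = *-cancelˡ-≤ q {{>-nonZero 1≤q}} (begin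
    q * (κ * b ^ (1 + k) + r * (r * (r * b ^ k)) + b + s)
      ≡⟨ arith₁ q κ (b ^ (1 + k)) r (b ^ k) b s ⟩
    κ * (q * b ^ (1 + k)) + q * (r * (r * r) * b ^ k) + q * b + q * s
      ≤⟨ +-mono-≤ (+-mono-≤ (+-mono-≤
           (*-monoʳ-≤ κ (ratio-^ q b m′ 1≤q qb≤ (1 + k)))
           (*-monoʳ-≤ q (*-monoʳ-≤ (r * (r * r)) (^-*-2 b≤ k))))
           qb≤)
           (*-monoʳ-≤ q (m≤m*n s μ {{m^n≢0 m′ k}})) ⟩
    κ * ((q + a) * (m′ * μ)) + q * (r * (r * r) * (2 ^ k * μ)) + (q + 1) * m′ + q * (s * μ)
      ≡⟨ arith₂ κ q a m′ μ (r * (r * r)) (2 ^ k) s ⟩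
    q * (κ * (m′ * μ)) + κ * a * (m′ * μ) + q * (r * (r * r) * 2 ^ k + s) * μ + q * m′ + m′ * 1
      ≤⟨ +-mono-≤ (+-monoˡ-≤ (q * m′) (+-monoˡ-≤ (q * (r * (r * r) * 2 ^ k + s) * μ) (+-monoˡ-≤ (κ * a * (m′ * μ))
           (*-monoʳ-≤ q (*-monoʳ-≤ κ (^-∸1-gap d k))))))
           (*-monoʳ-≤ m′ (m^n>0 m′ k)) ⟩
    q * (κ * (d ^ (1 + k) + (1 + k) * μ)) + κ * a * (m′ * μ) + q * (r * (r * r) * 2 ^ k + s) * μ + q * m′ + m′ * μ
      ≡⟨ arith₃ q κ (d ^ (1 + k)) (1 + k) μ a m′ (r * (r * r) * 2 ^ k) s ⟩
    q * (κ * d ^ (1 + k)) + q * m′ + (κ * a + 1) * (m′ * μ) + N₁ * μ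
      ≤⟨ +-monoʳ-≤ (q * (κ * d ^ (1 + k)) + q * m′ + (κ * a + 1) * (m′ * μ))
           (*-monoˡ-≤ μ (≤-trans (≤-trans (m≤m+n N₁ N₂) (m≤m+n (N₁ + N₂) (3 + s))) N₀≤)) ⟩
    q * (κ * d ^ (1 + k)) + q * m′ + (κ * a + 1) * (m′ * μ) + m′ * μ
      ≡⟨ arith₄ q (κ * d ^ (1 + k)) m′ (κ * a) (m′ * μ) ⟩
    q * (κ * d ^ (1 + k)) + q * m′ + q * (m′ * μ)
      ≡⟨ arith₅ q (κ * d ^ (1 + k)) m′ (m′ * μ) ⟩
    q * (κ * d ^ (1 + k) + m′ + m′ * μ) ∎)
    where
    open ≤-Reasoning
    b≤ : b ≤ 2 * suc d
    b≤ = b≤2m N₀≤ qb≤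
    m′ μ a : ℕ
    m′ = suc d
    μ = m′ ^ k
    a = excess (1 + k)
    arith₁ : ∀ q κ x r y b s → q * (κ * x + r * (r * (r * y)) + b + s) ≡ κ * (q * x) + q * (r * (r * r) * y) + q * b + q * s
    arith₁ = solve-∀
    arith₂ : ∀ κ q a m μ c t s → κ * ((q + a) * (m * μ)) + q * (c * (t * μ)) + (q + 1) * m + q * (s * μ)
      ≡ q * (κ * (m * μ)) + κ * a * (m * μ) + q * (c * t + s) * μ + q * m + m * 1
    arith₂ = solve-∀
    arith₃ : ∀ q κ x j μ a m c s → q * (κ * (x + j * μ)) + κ * a * (m * μ) + q * (c + s) * μ + q * m + m * μ
      ≡ q * (κ * x) + q * m + (κ * a + 1) * (m * μ) + q * (c + κ * j + s) * μ
    arith₃ = solve-∀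
    arith₄ : ∀ q x m c y → q * x + q * m + (c + 1) * y + y ≡ q * x + q * m + (c + 2) * y
    arith₄ = solve-∀
    arith₅ : ∀ q x m y → q * x + q * m + q * y ≡ q * (x + m + y)
    arith₅ = solve-∀

-- Comparison of the extremal configurations

prod-set-equal : ∀ {r} (f : Fin r → ℕ) {i j} → f i ≡ f j → 1 ≤ f i → prod r (set f i 1) ≡ prod r (set f j 1)
prod-set-equal {r} f {i} {j} fᵢ≡fⱼ 1≤fᵢ = *-cancelˡ-≡ _ _ (f i) {{>-nonZero 1≤fᵢ}}
  (trans (sym (prod-extract r f i)) (trans (prod-extract r f j) (cong (_* prod r (set f j 1)) (sym fᵢ≡fⱼ))))

third-part : ∀ {k} (i j : Fin (3 + k)) → ∃ λ ℓ → ℓ ≢ i × ℓ ≢ j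
third-part fzero           fzero           = fsuc fzero , (λ ()) , (λ ())
third-part fzero           (fsuc fzero)    = fsuc (fsuc fzero) , (λ ()) , (λ ())
third-part fzero           (fsuc (fsuc j)) = fsuc fzero , (λ ()) , (λ ())
third-part (fsuc fzero)    fzero           = fsuc (fsuc fzero) , (λ ()) , (λ ())
third-part (fsuc (fsuc i)) fzero           = fsuc fzero , (λ ()) , (λ ())
third-part (fsuc i)        (fsuc j)        = fzero , (λ ()) , (λ ())

prod-positive : ∀ r (f : Fin r → ℕ) → (∀ ℓ → 1 ≤ f ℓ) → 1 ≤ prod r f
prod-positive zero    f 1≤f = ≤-refl
prod-positive (suc r) f 1≤f = *-mono-≤ (1≤f fzero) (prod-positive r (f ∘ fsuc) (1≤f ∘ fsuc))

module _ {k : ℕ} (f : Fin (3 + k) → ℕ) (1≤f : ∀ ℓ → 1 ≤ f ℓ) where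
  private
    r : ℕ
    r = 3 + k
    f⁻ : Fin r → ℕ
    f⁻ ℓ = f ℓ ∸ 1

  -- Since r ≥ 3, some factor outside `i` and `j` remains, and it drops strictly.
  prod-set₂-pred-< : ∀ i j → prod r (set (set f⁻ i 1) j 1) < prod r (set (set f i 1) j 1)
  prod-set₂-pred-< i j with third-part i j
  ... | ℓ , ℓ≢i , ℓ≢j = begin-strict
    prod r g⁻               ≡⟨ prod-extract r g⁻ ℓ ⟩
    g⁻ ℓ * W⁻               ≤⟨ *-mono-≤ (≤-reflexive (trans (set-other _ 1 ℓ≢j) (set-other _ 1 ℓ≢i))) W⁻≤W ⟩
    (f ℓ ∸ 1) * W           <⟨ *-monoˡ-< W {{>-nonZero 1≤W}} (≤-reflexive (m+[n∸m]≡n (1≤f ℓ))) ⟩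
    f ℓ * W                 ≡⟨ cong (_* W) (sym (trans (set-other _ 1 ℓ≢j) (set-other _ 1 ℓ≢i))) ⟩
    g ℓ * W                 ≡⟨ sym (prod-extract r g ℓ) ⟩
    prod r g                ∎
    where
    open ≤-Reasoning
    g⁻ g : Fin r → ℕ
    g⁻ = set (set f⁻ i 1) j 1
    g = set (set f i 1) j 1
    W⁻ W : ℕ
    W⁻ = prod r (set g⁻ ℓ 1)
    W = prod r (set g ℓ 1)
    W⁻≤W : W⁻ ≤ W
    W⁻≤W = prod-mono r (set-mono (set-mono (set-mono (λ ℓ → m∸n≤m (f ℓ) 1) i ≤-refl) j ≤-refl) ℓ ≤-refl)
    positive : ∀ (h : Fin r → ℕ) i → (∀ ℓ → 1 ≤ h ℓ) → ∀ ℓ → 1 ≤ set h i 1 ℓ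
    positive h i 1≤h = set-elim h i 1 (λ _ y → 1 ≤ y) ≤-refl (λ ℓ _ → 1≤h ℓ)
    1≤W : 1 ≤ W
    1≤W = prod-positive r _ (positive _ ℓ (positive _ j (positive f i 1≤f)))

  -- Moving the centre of a Hilton–Milner family from part i to a smaller part j gains (f i - f j)(R - R⁻ - 1).
  move-centre : ∀ {i j g} → i ≢ j → f j ≤ f i →
    g + prod r (set f⁻ i 1) ≤ prod r (set f i 1) + f⁻ i → g + prod r (set f⁻ j 1) ≤ prod r (set f j 1) + f⁻ j
  move-centre {i} {j} {g} i≢j fⱼ≤fᵢ hyp = begin
    g + prod r (set f⁻ j 1)              ≡⟨ cong (g +_) (prod-set₁≡ f⁻ i≢j) ⟩
    g + f⁻ i * R⁻                        ≤⟨ arith g (f i) (f j) R R⁻ (1≤f j) fⱼ≤fᵢ (prod-set₂-pred-< i j) hyp′ ⟩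
    f i * R + f⁻ j                       ≡⟨ cong (_+ f⁻ j) (sym (prod-set₁≡ f i≢j)) ⟩
    prod r (set f j 1) + f⁻ j            ∎
    where
    open ≤-Reasoning
    R R⁻ : ℕ
    R  = prod r (set (set f i 1) j 1)
    R⁻ = prod r (set (set f⁻ i 1) j 1)
    hyp′ : g + f⁻ j * R⁻ ≤ f j * R + f⁻ i
    hyp′ = subst₂ _≤_ (cong (g +_) (trans (prod-set₁≡ f⁻ (≢-sym i≢j)) (cong (f⁻ j *_) (prod-cong r (set-comm f⁻ 1 1 (≢-sym i≢j))))))
      (cong (_+ f⁻ i) (trans (prod-set₁≡ f (≢-sym i≢j)) (cong (f j *_) (prod-cong r (set-comm f 1 1 (≢-sym i≢j)))))) hyp
    arith : ∀ g a b R R⁻ → 1 ≤ b → b ≤ a → R⁻ < R → g + (b ∸ 1) * R⁻ ≤ b * R + (a ∸ 1) → g + (a ∸ 1) * R⁻ ≤ a * R + (b ∸ 1)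
    arith g (suc α) (suc β) R R⁻ _ (s≤s β≤α) R⁻<R hyp with m≤n⇒∃[o]m+o≡n β≤α
    ... | δ , refl = begin
      g + (β + δ) * R⁻                   ≡⟨ arith₁ g β δ R⁻ ⟩
      g + β * R⁻ + δ * R⁻                ≤⟨ +-monoˡ-≤ (δ * R⁻) hyp ⟩
      suc β * R + (β + δ) + δ * R⁻       ≡⟨ arith₂ (suc β * R) β δ R⁻ ⟩
      suc β * R + β + δ * suc R⁻         ≤⟨ +-monoʳ-≤ (suc β * R + β) (*-monoʳ-≤ δ R⁻<R) ⟩
      suc β * R + β + δ * R              ≡⟨ arith₃ β R δ ⟩
      suc (β + δ) * R + β                ∎
      where
      arith₁ : ∀ g β δ x → g + (β + δ) * x ≡ g + β * x + δ * x
      arith₁ = solve-∀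
      arith₂ : ∀ y β δ x → y + (β + δ) + δ * x ≡ y + β + δ * (1 + x)
      arith₂ = solve-∀
      arith₃ : ∀ β R δ → (1 + β) * R + β + δ * R ≡ (1 + (β + δ)) * R + β
      arith₃ = solve-∀

sumF : ∀ r → (Fin r → ℕ) → ℕ
sumF zero    f = 0
sumF (suc r) f = f fzero + sumF r (f ∘ fsuc)

sumF-cong : ∀ r {f g : Fin r → ℕ} → f ≗ g → sumF r f ≡ sumF r g
sumF-cong zero    f≗g = refl
sumF-cong (suc r) f≗g = cong₂ _+_ (f≗g fzero) (sumF-cong r (f≗g ∘ fsuc))

sumF-extract : ∀ r (f : Fin r → ℕ) j → sumF r f ≡ f j + sumF r (set f j 0)
sumF-extract (suc r) f fzero    = refl
sumF-extract (suc r) f (fsuc j) = trans (cong (f fzero +_) (sumF-extract r (f ∘ fsuc) j)) (arith (f fzero) (f (fsuc j)) _)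
  where
  arith : ∀ a b c → a + (b + c) ≡ b + (a + c)
  arith = solve-∀

abstract
  -- An exhaustive check; `abstract` keeps the search from unfolding in later uses.
  third-of-three : ∀ (j l : Fin 3) → j ≢ l → ∃ λ d → (d ≢ j × d ≢ l) × (∀ ℓ → ℓ ≡ j ⊎ ℓ ≡ l ⊎ ℓ ≡ d)
  third-of-three = from-yes (allᶠ? λ (j : Fin 3) → allᶠ? λ l → ¬? (j ≟ᶠ l) →-dec
    anyᶠ? λ d → (¬? (d ≟ᶠ j) ×-dec ¬? (d ≟ᶠ l)) ×-dec allᶠ? λ ℓ → (ℓ ≟ᶠ j) ⊎-dec ((ℓ ≟ᶠ l) ⊎-dec (ℓ ≟ᶠ d)))

four-parts : ∀ (i j l : Fin 4) → i ≢ j → i ≢ l → j ≢ l →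
  ∃ λ d → (d ≢ i × d ≢ j × d ≢ l) × (∀ ℓ → ℓ ≡ i ⊎ ℓ ≡ j ⊎ ℓ ≡ l ⊎ ℓ ≡ d)
four-parts i j l i≢j i≢l j≢l with third-of-three (punchOut i≢j) (punchOut i≢l) (j≢l ∘ punchOut-injective i≢j i≢l)
... | d , (d≢j , d≢l) , cover = punchIn i d ,
    (punchInᵢ≢i i d , avoids i≢j d≢j , avoids i≢l d≢l) , covers
  where
  avoids : ∀ {c} (i≢c : i ≢ c) → d ≢ punchOut i≢c → punchIn i d ≢ c
  avoids i≢c d≢ e = d≢ (punchIn-injective i d _ (trans e (sym (punchIn-punchOut i≢c))))
  covers : ∀ ℓ → ℓ ≡ i ⊎ ℓ ≡ j ⊎ ℓ ≡ l ⊎ ℓ ≡ punchIn i d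
  covers ℓ with i ≟ᶠ ℓ
  ... | yes e  = inj₁ (sym e)
  ... | no i≢ℓ with cover (punchOut i≢ℓ)
  ...   | inj₁ e        = inj₂ (inj₁ (punchOut-injective i≢ℓ i≢j e))
  ...   | inj₂ (inj₁ e) = inj₂ (inj₂ (inj₁ (punchOut-injective i≢ℓ i≢l e)))
  ...   | inj₂ (inj₂ e) = inj₂ (inj₂ (inj₂ (trans (sym (punchIn-punchOut i≢ℓ)) (cong (punchIn i) e))))

module _ (f : Fin 4 → ℕ) {i j l : Fin 4} (i≢j : i ≢ j) (i≢l : i ≢ l) (j≢l : j ≢ l) where

  private
    -- The value c = 1 removes the three parts from a product, c = 0 from a sum, so facts about
    -- general c serve both.
    set₃ : ℕ → Fin 4 → ℕ
    set₃ c = set (set (set f i c) j c) l c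

  fourth-part : ∃ λ d → prod 4 (set₃ 1) ≡ f d × sumF 4 f ≡ f d + (f i + f j + f l)
  fourth-part with four-parts i j l i≢j i≢l j≢l
  ... | d , (d≢i , d≢j , d≢l) , cover = d , prod≡ , sum≡
    where
    set₃-d : ∀ c → set₃ c d ≡ f d
    set₃-d c = trans (set-other _ c d≢l) (trans (set-other _ c d≢j) (set-other _ c d≢i))
    set₄-const : ∀ c → set (set₃ c) d c ≗ (λ _ → c)
    set₄-const c = set-elim _ d c (λ _ y → y ≡ c) refl at-ijl
      where
      at-i : ∀ ℓ → ℓ ≢ j → ℓ ≢ l → ℓ ≢ d → set f i c ℓ ≡ c
      at-i = set-elim f i c (λ ℓ y → ℓ ≢ j → ℓ ≢ l → ℓ ≢ d → y ≡ c) (λ _ _ _ → refl)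
        λ ℓ ℓ≢i ℓ≢j ℓ≢l ℓ≢d → ⊥-elim ([ ℓ≢i , [ ℓ≢j , [ ℓ≢l , ℓ≢d ]′ ]′ ]′ (cover ℓ))
      at-ij : ∀ ℓ → ℓ ≢ l → ℓ ≢ d → set (set f i c) j c ℓ ≡ c
      at-ij = set-elim _ j c (λ ℓ y → ℓ ≢ l → ℓ ≢ d → y ≡ c) (λ _ _ → refl) at-i
      at-ijl : ∀ ℓ → ℓ ≢ d → set₃ c ℓ ≡ c
      at-ijl = set-elim _ l c (λ ℓ y → ℓ ≢ d → y ≡ c) (λ _ → refl) at-ij
    prod≡ : prod 4 (set₃ 1) ≡ f d
    prod≡ = trans (prod-extract 4 (set₃ 1) d) (trans (cong₂ _*_ (set₃-d 1) (prod-cong 4 (set₄-const 1))) (*-identityʳ (f d)))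
    sum≡ : sumF 4 f ≡ f d + (f i + f j + f l)
    sum≡ = trans (sumF-extract 4 f i) (trans (cong (f i +_)
      (trans (sumF-extract 4 (set f i 0) j) (cong₂ _+_ (set-other f 0 (≢-sym i≢j))
        (trans (sumF-extract 4 (set (set f i 0) j 0) l) (cong₂ _+_ (trans (set-other _ 0 (≢-sym j≢l)) (set-other f 0 (≢-sym i≢l)))
          (trans (sumF-extract 4 (set₃ 0) d) (cong₂ _+_ (set₃-d 0) (sumF-cong 4 (set₄-const 0)))))))))
      (arith (f i) (f j) (f l) (f d)))
      where
      arith : ∀ a b c d → a + (b + (c + (d + 0))) ≡ d + (a + b + c)
      arith = solve-∀

  -- Let w be the fourth part and S the sum of the three others. The difference of the two sides is
  -- (U - w)(S - U - 2), and both factors are nonnegative: it is best to leave a largest part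
  -- outside the triple.
  triangle-arith : ∀ U → (∀ ℓ → f ℓ ≤ U) → (∀ ℓ → 1 ≤ f ℓ) → U + 2 ≤ f i + f j + f l →
    prod 4 (set₃ 1) * (f l + ((f j ∸ 1) + (f i ∸ 1))) ≤ U * (sumF 4 f ∸ (U + 2))
  triangle-arith U f≤U 1≤f U+2≤ with fourth-part
  ... | d , prod≡ , sum≡ = begin
    prod 4 (set₃ 1) * (f l + ((f j ∸ 1) + (f i ∸ 1)))   ≡⟨ cong₂ _*_ prod≡ (arith₁ (f i) (f j) (f l) (1≤f i) (1≤f j)) ⟩
    f d * ((f i + f j + f l) ∸ 2)                       ≤⟨ arith₂ (f d) U (f i + f j + f l) (f≤U d) U+2≤ ⟩
    U * ((f d + (f i + f j + f l)) ∸ (U + 2))           ≡⟨ cong (λ S → U * (S ∸ (U + 2))) (sym sum≡) ⟩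
    U * (sumF 4 f ∸ (U + 2)) ∎
    where
    open ≤-Reasoning
    arith₁ : ∀ x y z → 1 ≤ x → 1 ≤ y → z + ((y ∸ 1) + (x ∸ 1)) ≡ (x + y + z) ∸ 2
    arith₁ (suc x) (suc y) z _ _ = sym (trans (cong (_∸ 2) (rearrange x y z)) (m+n∸m≡n 2 _))
      where
      rearrange : ∀ x y z → 1 + x + (1 + y) + z ≡ 2 + (z + (y + x))
      rearrange = solve-∀
    arith₂ : ∀ w U S → w ≤ U → U + 2 ≤ S → w * (S ∸ 2) ≤ U * ((w + S) ∸ (U + 2))
    arith₂ w U S w≤U U+2≤S with m≤n⇒∃[o]m+o≡n U+2≤S
    ... | g , refl = begin
      w * ((U + 2 + g) ∸ 2)                ≡⟨ cong (w *_) (trans (cong (_∸ 2) (shift₁ U g)) (m+n∸m≡n 2 _)) ⟩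
      w * (U + g)                          ≡⟨ *-distribˡ-+ w U g ⟩
      w * U + w * g                        ≤⟨ +-monoʳ-≤ (w * U) (*-monoˡ-≤ g w≤U) ⟩
      w * U + U * g                        ≡⟨ shift₂ w U g ⟩
      U * (w + g)                          ≡⟨ cong (U *_) (sym (trans (cong (_∸ (U + 2)) (shift₃ w U g)) (m+n∸m≡n (U + 2) _))) ⟩
      U * ((w + (U + 2 + g)) ∸ (U + 2))    ∎
      where
      shift₁ : ∀ U g → U + 2 + g ≡ 2 + (U + g)
      shift₁ = solve-∀
      shift₂ : ∀ w U g → w * U + U * g ≡ U * (w + g)
      shift₂ = solve-∀
      shift₃ : ∀ w U g → w + (U + 2 + g) ≡ U + 2 + (w + g)
      shift₃ = solve-∀

triangle-arith′ : ∀ {k} → k ≡ 1 → (f : Fin (3 + k) → ℕ) {i j l : Fin (3 + k)} → i ≢ j → i ≢ l → j ≢ l →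
  ∀ U → (∀ ℓ → f ℓ ≤ U) → (∀ ℓ → 1 ≤ f ℓ) → U + 2 ≤ f i + f j + f l →
  prod (3 + k) (set (set (set f i 1) j 1) l 1) * (f l + ((f j ∸ 1) + (f i ∸ 1))) ≤ U * (sumF (3 + k) f ∸ (U + 2))
triangle-arith′ refl = triangle-arith

-- The upper bound

_≟ᵛ_ : ∀ {r} → DecidableEquality (Vertex r)
_≟ᵛ_ = ≡-dec _≟ᶠ_ _≟_

Covers : ∀ {r} → List (Vec ℕ r) → List (Vertex r) → Set
Covers F T = ∀ {A} → A ∈ F → ∃ λ v → v ∈ T × lookup A (proj₁ v) ≡ proj₂ v

-- Transversals are duplicate-free and within range. Discarding repeated and out-of-range vertices
-- keeps a cover and does not lengthen it, so arbitrary concatenated lists may be used as covers.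
cover-size : ∀ {r} {n : Fin r → ℕ} {s} (F : Family n) → τExceeds s F → ∀ T → Covers (members F) T → s < length T
cover-size {r} {n} {s} F τF T covers = ≤-trans (τF T′ (uT′ , valid-T′ , hits)) (Card≤-list T uT′ (proj₁ ∘ T′⇒T))
  where
  inside? : Decidable (λ (v : Vertex r) → proj₂ v < n (proj₁ v))
  inside? v = proj₂ v <? n (proj₁ v)
  T′ : List (Vertex r)
  T′ = deduplicate _≟ᵛ_ (filter inside? T)
  uT′ : Unique T′
  uT′ = DecUniqueₚ.deduplicate-! _≟ᵛ_ (filter inside? T)
  T′⇒T : ∀ {v} → v ∈ T′ → v ∈ T × proj₂ v < n (proj₁ v)
  T′⇒T v∈ = ∈-filter⁻ inside? (∈-deduplicate⁻ _≟ᵛ_ (filter inside? T) v∈)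
  valid-T′ : ∀ {ℓ v} → (ℓ , v) ∈ T′ → v < n ℓ
  valid-T′ = proj₂ ∘ T′⇒T
  hits : ∀ {A} → A ∈ members F → Σ (Fin r) λ ℓ → (ℓ , lookup A ℓ) ∈ T′
  hits A∈ with covers A∈
  ... | (ℓ , _) , v∈ , refl = ℓ , ∈-deduplicate⁺ _≟ᵛ_ (∈-filter⁺ inside? v∈ (valid F A∈ ℓ))

prod-set-last : ∀ k (f : Fin (suc k) → ℕ) → prod (suc k) (set f (fromℕ k) 1) ≡ prodInit k f
prod-set-last zero    f = refl
prod-set-last (suc k) f = cong (f fzero *_) (prod-set-last k (f ∘ fsuc))

module UpperBound (k s : ℕ) (X : Fin (3 + k) → List ℕ) (uX : ∀ ℓ → Unique (X ℓ)) (b m : ℕ)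
  (X≤b : ∀ ℓ → length (X ℓ) ≤ b) (m≤X : ∀ ℓ → m ≤ length (X ℓ)) (m≡ : length (X (fromℕ (2 + k))) ≡ m)
  (N₀≤m : Constants.N₀ k s ≤ m) (qb≤ : Constants.q k s * b ≤ (Constants.q k s + 1) * m)
  (F : List (Vec ℕ (3 + k))) (uF : Unique F) (inX : ∀ {A} → A ∈ F → InBox X A)
  (νF : Matching≤ s F) (τF : ∀ T → Covers F T → s < length T) where

  open Constants k s using (r; κ)

  private
    s<m : 3 + s ≤ m
    s<m = Constants.3+s≤m k s {b} N₀≤m qb≤

    1≤m : 1 ≤ m
    1≤m = ≤-trans (s≤s z≤n) s<m

    m≤b : m ≤ b
    m≤b = ≤-trans (≤-reflexive (sym m≡)) (X≤b _)

    1≤b : 1 ≤ b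
    1≤b = ≤-trans 1≤m m≤b

    N : Fin r → ℕ
    N = length ∘ X

  open Peeling k X b 1≤b X≤b s using (Peeled; module Peeled; peel; residual-size; star-bound; one-part-or-saving)

  P P⁻ : ℕ
  P  = prod r (set N (fromℕ (2 + k)) 1)
  P⁻ = prod r (set (λ ℓ → N ℓ ∸ 1) (fromℕ (2 + k)) 1)

  -- `Main` is `mainBound` with the subtraction moved to the left. `Alternative` describes h = s - 1
  -- stars together with a triangle family: deleting h vertices lowers the sum of the part sizes by
  -- h, and the part outside the triple contributes at most the factor b.
  Main Alternative : Set
  Main = length F + (P⁻ + s) ≤ s * P + m
  Alternative = k ≡ 1 × ∃ λ h → h + 1 ≡ s × length F ≤ b * (sumF r N ∸ (b + 2 + h)) + h * P

  private
    gap : P⁻ + κ * (m ∸ 1) ^ (1 + k) ≤ P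
    gap = subst₂ (λ x y → x + κ * (m ∸ 1) ^ (1 + k) ≤ y) (sym (prod-set-last (2 + k) (λ ℓ → N ℓ ∸ 1))) (sym (prod-set-last (2 + k) N))
      (prod-∸1-gap (1 + k) (N ∘ inject₁) m 1≤m (m≤X ∘ inject₁))

    P⁻≤P : P⁻ ≤ P
    P⁻≤P = ≤-trans (m≤m+n P⁻ _) gap

    m^≤P : m ^ (2 + k) ≤ P
    m^≤P = ≤-trans (≤-reflexive (sym (prod-set₁-const m 1≤m (2 + k) (fromℕ (2 + k)))))
      (prod-mono r (set-mono m≤X (fromℕ (2 + k)) ≤-refl))

    -- `Main` grants the residue P - P⁻ + m - s edges, of which `gap` guarantees κ (m - 1)^(r-2) + m
    -- - s. The additional `m ^ (1 + k)` on the left of the hypothesis is the deficit required by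
    -- `crude-estimate`.
    crude⇒main : ∀ {h} → h + 1 ≡ s → length F + m ^ (1 + k) ≤ κ * b ^ (1 + k) + r * (r * (r * b ^ k)) + b + h * P → Main
    crude⇒main {h} refl le = +-cancelʳ-≤ (m ^ (1 + k)) _ _ (begin
      length F + (P⁻ + s) + μ              ≡⟨ arith₁ (length F) P⁻ s μ ⟩
      (length F + μ) + (P⁻ + s)            ≤⟨ +-monoˡ-≤ (P⁻ + s) le ⟩
      c + h * P + (P⁻ + s)                 ≡⟨ arith₂ c (h * P) P⁻ s ⟩
      (c + s) + (h * P + P⁻)               ≤⟨ +-monoˡ-≤ (h * P + P⁻) (Constants.crude-estimate k s N₀≤m qb≤) ⟩
      (κ * (m ∸ 1) ^ (1 + k) + m + μ) + (h * P + P⁻) ≡⟨ arith₃ (κ * (m ∸ 1) ^ (1 + k)) m μ (h * P) P⁻ ⟩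
      h * P + (P⁻ + κ * (m ∸ 1) ^ (1 + k)) + m + μ ≤⟨ +-monoˡ-≤ μ (+-monoˡ-≤ m (+-monoʳ-≤ (h * P) gap)) ⟩
      h * P + P + m + μ                    ≡⟨ arith₄ h P m μ ⟩
      (h + 1) * P + m + μ ∎)
      where
      open ≤-Reasoning
      c μ : ℕ
      c = κ * b ^ (1 + k) + r * (r * (r * b ^ k)) + b
      μ = m ^ (1 + k)
      arith₁ : ∀ x y z w → x + (y + z) + w ≡ (x + w) + (y + z)
      arith₁ = solve-∀
      arith₂ : ∀ c h p s → c + h + (p + s) ≡ (c + s) + (h + p)
      arith₂ = solve-∀
      arith₃ : ∀ x m μ h p → (x + m + μ) + (h + p) ≡ h + (p + x) + m + μ
      arith₃ = solve-∀
      arith₄ : ∀ h P m μ → h * P + P + m + μ ≡ (h + 1) * P + m + μ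
      arith₄ = solve-∀

  module _ (p : Peeled s F) where

    open Peeled p

    starF : length F ≤ length G + length H * P
    starF = star-bound m 1≤m (fromℕ (2 + k)) m≡ m≤X uX inX uF p

    cover-by : ∀ L → (∀ {A} → A ∈ G → ∃ λ v → v ∈ L × lookup A (proj₁ v) ≡ proj₂ v) → s < length (L ++ H)
    cover-by L f = τF (L ++ H) λ A∈ →
      [ (λ A∈G → let v , v∈ , e = f A∈G in v , ∈-++⁺ˡ v∈ , e) , (λ { (v , v∈ , e) → v , ∈-++⁺ʳ L v∈ , e }) ]′ (covers A∈)

    no-residue : t ≢ 0
    no-residue t≡0 = <-irrefl refl (subst (s <_) (trans (sym (+-identityʳ _)) (trans (cong (length H +_) (sym t≡0)) size≡))
      (cover-by [] λ {A} A∈ → ⊥-elim (n≮0 (subst (1 ≤_) t≡0 (νG [ A ] (λ { (here refl) → A∈ }) ([] ∷ []))))))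

    -- At most s - 2 stars are present and the residue weighs no more than one. The remaining copy
    -- of P absorbs the subtracted P⁻.
    large-residue : 2 ≤ t → Main
    large-residue 2≤t = begin
      length F + (P⁻ + s)                        ≤⟨ +-mono-≤ starF (+-mono-≤ P⁻≤P s≤m) ⟩
      length G + length H * P + (P + m)          ≤⟨ +-monoˡ-≤ (P + m) (+-monoˡ-≤ (length H * P) G≤P) ⟩
      P + length H * P + (P + m)                 ≡⟨ arith P (length H) m ⟩
      (length H + 2) * P + m                     ≤⟨ +-monoˡ-≤ m (*-monoˡ-≤ P (≤-trans (+-monoʳ-≤ (length H) 2≤t) (≤-reflexive size≡))) ⟩
      s * P + m                                  ∎
      where
      open ≤-Reasoning
      s≤m : s ≤ m
      s≤m = ≤-trans (m≤n+m s 3) s<m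
      t≤s : t ≤ s
      t≤s = ≤-trans (m≤n+m t (length H)) (≤-reflexive size≡)
      G≤P : length G ≤ P
      G≤P = ≤-trans (residual-size p) (≤-trans (*-monoˡ-≤ (r * (s * (r * b ^ (1 + k)))) t≤s)
        (≤-trans (Constants.matching-estimate k s N₀≤m qb≤) m^≤P))
      arith : ∀ P h m → P + h * P + (P + m) ≡ (h + 2) * P + m
      arith = solve-∀

    module Residue (t≡1 : t ≡ 1) where

      h+1≡s : length H + 1 ≡ s
      h+1≡s = trans (cong (length H +_) (sym t≡1)) size≡

      intersecting : ∀ {A B} → A ∈ G → B ∈ G → ∃ λ ℓ → lookup A ℓ ≡ lookup B ℓ
      intersecting {A} {B} A∈ B∈ = [ id , (λ disjoint → ⊥-elim (1+n≰n (subst (2 ≤_) t≡1 (νG (A ∷ B ∷ [])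
        (λ { (here refl) → A∈ ; (there (here refl)) → B∈ }) ((disjoint ∷ []) ∷ [] ∷ []))))) ]′ (meets-or-disjoint A B)

      -- A vertex common to all edges of `G` would complete `H` to a cover of `F` with only s
      -- vertices.
      nontrivial : ∀ i x → ∃ λ B → B ∈ G × lookup B i ≢ x
      nontrivial i x with search G (λ {B} _ → same B)
        where
        same : ∀ (B : Vec ℕ r) → lookup B i ≡ x ⊎ lookup B i ≢ x
        same B with lookup B i ≟ x
        ... | yes e = inj₁ e
        ... | no ≢x = inj₂ ≢x
      ... | inj₂ found = found
      ... | inj₁ all-x = ⊥-elim (<-irrefl refl (subst (s <_) (trans (+-comm 1 (length H)) h+1≡s)
              (cover-by [ (i , x) ] λ A∈ → (i , x) , here refl , all-x A∈)))

      module OnePart (j : Fin r) (Nⱼ≡m : N j ≡ m) (in-j : ∀ {i x} → (i , x) ∈ H → i ≡ j) where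

        open DecMembership (_≟ᵛ_ {r}) using (_∈?_)

        free? : Decidable (λ y → ¬ ((j , y) ∈ H))
        free? y = ¬? ((j , y) ∈? H)

        Y : List ℕ
        Y = filter free? (X j)

        X′ : Fin r → List ℕ
        X′ = set X j Y

        N′ : Fin r → ℕ
        N′ = length ∘ X′

        uX′ : ∀ ℓ → Unique (X′ ℓ)
        uX′ = set-elim X j Y (λ _ → Unique) (Uniqueₚ.filter⁺ free? (uX j)) (λ ℓ _ → uX ℓ)

        Y+h≤m : length Y + length H ≤ m
        Y+h≤m = begin
          length Y + length H                    ≡⟨ cong (_+ length H) (sym (length-map (j ,_) Y)) ⟩
          length (map (j ,_) Y) + length H       ≡⟨ sym (length-++ (map (j ,_) Y)) ⟩
          length (map (j ,_) Y ++ H)             ≤⟨ Card≤-list (map (j ,_) (X j))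
                                                      (Uniqueₚ.++⁺ (Uniqueₚ.map⁺ (cong proj₂) (Uniqueₚ.filter⁺ free? (uX j))) uH Y∩H)
                                                      (λ v∈ → [ Y⊆ , H⊆ ]′ (∈-++⁻ (map (j ,_) Y) v∈)) ⟩
          length (map (j ,_) (X j))              ≡⟨ length-map (j ,_) (X j) ⟩
          N j                                    ≡⟨ Nⱼ≡m ⟩
          m                                      ∎
          where
          open ≤-Reasoning
          Y∩H : ∀ {v} → v ∈ map (j ,_) Y × v ∈ H → ⊥
          Y∩H (v∈Y , v∈H) with ∈-map⁻ (j ,_) v∈Y
          ... | y , y∈ , refl = proj₂ (∈-filter⁻ free? {xs = X j} y∈) v∈H
          Y⊆ : ∀ {v} → v ∈ map (j ,_) Y → v ∈ map (j ,_) (X j)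
          Y⊆ v∈Y with ∈-map⁻ (j ,_) v∈Y
          ... | y , y∈ , refl = ∈-map⁺ (j ,_) (proj₁ (∈-filter⁻ free? y∈))
          H⊆ : ∀ {v} → v ∈ H → v ∈ map (j ,_) (X j)
          H⊆ {i , x} v∈H with in-j v∈H
          ... | refl = let A , A∈ , e = occurs v∈H in ∈-map⁺ (j ,_) (subst (_∈ X j) e (inX A∈ j))

        N′≤N : ∀ ℓ → N′ ℓ ≤ N ℓ
        N′≤N = set-elim X j Y (λ ℓ Z → length Z ≤ N ℓ) (≤-trans (m≤m+n _ _) (≤-trans Y+h≤m (m≤X j))) (λ _ _ → ≤-refl)

        N′ⱼ≡ : N′ j ≡ length Y
        N′ⱼ≡ = cong length (set-same X j Y)

        N′-other : ∀ {ℓ} → ℓ ≢ j → N′ ℓ ≡ N ℓ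
        N′-other ℓ≢j = cong length (set-other X Y ℓ≢j)

        inX′ : ∀ {A} → A ∈ G → InBox X′ A
        inX′ {A} A∈ = InBox-set A (inX (G⊆F A∈)) j (∈-filter⁺ free? (inX (G⊆F A∈) j) λ v∈H → avoids A∈ v∈H refl)

        open Intersecting k X′ b 1≤b (λ ℓ → ≤-trans (N′≤N ℓ) (X≤b ℓ)) G uG inX′ intersecting nontrivial
          using (Small; HiltonMilner; Triangle; classification; HiltonMilner-size; triangle-size)

        1≤N′ : ∀ ℓ → 1 ≤ N′ ℓ
        1≤N′ ℓ with nontrivial fzero 0
        ... | A , A∈ , _ = nonempty (inX′ A∈ ℓ)
          where
          nonempty : ∀ {x} {L : List ℕ} → x ∈ L → 1 ≤ length L
          nonempty (here _)  = s≤s z≤n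
          nonempty (there _) = s≤s z≤n

        -- Adding the required deficit `m ^ (1 + k)`, at most `b ^ (1 + k)`, raises the coefficient
        -- r - 2 just to r - 1, so `crude⇒main` applies without any loss from the stars.
        small-case : Small → Main
        small-case small = crude⇒main h+1≡s (begin
          length F + μ                                       ≤⟨ +-mono-≤ starF (^-monoˡ-≤ (1 + k) m≤b) ⟩
          length G + length H * P + b ^ (1 + k)              ≤⟨ +-monoˡ-≤ (b ^ (1 + k)) (+-monoˡ-≤ (length H * P) small) ⟩
          (1 + k) * B + c + length H * P + B                 ≡⟨ arith k B c (length H * P) ⟩
          κ * B + c + length H * P                           ≤⟨ +-monoˡ-≤ (length H * P) (m≤m+n (κ * B + c) b) ⟩
          κ * B + c + b + length H * P                       ∎)
          where
          open ≤-Reasoning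
          μ B c : ℕ
          μ = m ^ (1 + k)
          B = b ^ (1 + k)
          c = r * (r * (r * b ^ k))
          arith : ∀ k B c h → (1 + k) * B + c + h + B ≡ (2 + k) * B + c + h
          arith = solve-∀

        -- After the deletion of `H`, part `j` is no larger than any other, so the centre may be
        -- moved there. Then P and P⁻ do not see the deletion; it only affects the number of edges
        -- off the centre, at most (m - h) - 1 = m - s.
        HiltonMilner-case : HiltonMilner → Main
        HiltonMilner-case hm = begin
          length F + (P⁻ + s)                               ≤⟨ +-monoˡ-≤ (P⁻ + s) starF ⟩
          length G + length H * P + (P⁻ + s)                ≡⟨ arith₁ (length G) (length H * P) P⁻ s ⟩
          length G + P⁻ + (length H * P + s)                ≤⟨ +-monoˡ-≤ (length H * P + s) centred ⟩
          P + (length Y ∸ 1) + (length H * P + s)           ≡⟨ cong (λ s → P + (length Y ∸ 1) + (length H * P + s)) (sym h+1≡s) ⟩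
          P + (length Y ∸ 1) + (length H * P + (length H + 1)) ≡⟨ arith₂ P (length Y ∸ 1) (length H) ⟩
          (length H + 1) * P + (length Y ∸ 1 + 1 + length H)  ≡⟨ cong (λ y → (length H + 1) * P + (y + length H)) (m∸n+n≡m (subst (1 ≤_) N′ⱼ≡ (1≤N′ j))) ⟩
          (length H + 1) * P + (length Y + length H)        ≤⟨ +-mono-≤ (≤-reflexive (cong (_* P) h+1≡s)) Y+h≤m ⟩
          s * P + m                                         ∎
          where
          open ≤-Reasoning
          open HiltonMilner hm using (i)
          arith₁ : ∀ g h p s → g + h + (p + s) ≡ g + p + (h + s)
          arith₁ = solve-∀
          arith₂ : ∀ P y h → P + y + (h * P + (h + 1)) ≡ (h + 1) * P + (y + 1 + h)
          arith₂ = solve-∀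
          at-j : length G + prod r (set (λ ℓ → N′ ℓ ∸ 1) j 1) ≤ prod r (set N′ j 1) + (N′ j ∸ 1)
          at-j = from (i ≟ᶠ j) (HiltonMilner-size uX′ hm)
            where
            from : ∀ {i} → Dec (i ≡ j) → length G + prod r (set (λ ℓ → N′ ℓ ∸ 1) i 1) ≤ prod r (set N′ i 1) + (N′ i ∸ 1) →
              length G + prod r (set (λ ℓ → N′ ℓ ∸ 1) j 1) ≤ prod r (set N′ j 1) + (N′ j ∸ 1)
            from     (yes refl) le = le
            from {i} (no i≢j)   le = move-centre N′ 1≤N′ i≢j
              (≤-trans (N′≤N j) (≤-trans (≤-reflexive Nⱼ≡m) (≤-trans (m≤X i) (≤-reflexive (sym (N′-other i≢j)))))) le
          same-outside : ∀ (g : ℕ → ℕ) → prod r (set (g ∘ N′) j 1) ≡ prod r (set (g ∘ N) j 1)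
          same-outside g = prod-cong r λ ℓ → trans (set-cong (set-map (g ∘ length) X j Y) j 1 ℓ) (set-set (g ∘ N) j _ 1 ℓ)
          Nⱼ≡N : N j ≡ N (fromℕ (2 + k))
          Nⱼ≡N = trans Nⱼ≡m (sym m≡)
          centred : length G + P⁻ ≤ P + (length Y ∸ 1)
          centred = subst₂ (λ p⁻ q → length G + p⁻ ≤ q)
            (trans (same-outside (_∸ 1)) (prod-set-equal (λ ℓ → N ℓ ∸ 1) (cong (_∸ 1) Nⱼ≡N)
              (subst (λ n → 1 ≤ n ∸ 1) (sym Nⱼ≡m) (∸-monoˡ-≤ 1 (≤-trans (s≤s (s≤s z≤n)) s<m)))))
            (cong₂ (λ p y → p + (y ∸ 1)) (trans (same-outside id) (prod-set-equal N Nⱼ≡N (subst (1 ≤_) (sym Nⱼ≡m) 1≤m))) N′ⱼ≡)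
            at-j

        triangle-case : k ≡ 1 → Triangle → Alternative
        triangle-case k≡1 tr = k≡1 , h , h+1≡s , ≤-trans starF (+-monoˡ-≤ (h * P) (begin
          length G
            ≤⟨ triangle-size uX′ tr ⟩
          prod r (set (set (set N′ i₁ 1) i₂ 1) i₃ 1) * (N′ i₃ + ((N′ i₂ ∸ 1) + (N′ i₁ ∸ 1)))
            ≤⟨ *-mono-≤ (prod-mono r (set-mono (set-mono (set-mono N′≤M i₁ ≤-refl) i₂ ≤-refl) i₃ ≤-refl))
                 (+-mono-≤ (N′≤M i₃) (+-mono-≤ (∸-monoˡ-≤ 1 (N′≤M i₂)) (∸-monoˡ-≤ 1 (N′≤M i₁)))) ⟩
          prod r (set (set (set M i₁ 1) i₂ 1) i₃ 1) * (M i₃ + ((M i₂ ∸ 1) + (M i₁ ∸ 1)))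
            ≤⟨ triangle-arith′ k≡1 M i≢j i≢l j≢l b M≤b (λ ℓ → ≤-trans (s≤s z≤n) (2≤M ℓ)) b+2≤ ⟩
          b * (sumF r M ∸ (b + 2))
            ≡⟨ cong (b *_) (sym (trans (cong₂ _∸_ sumN (+-comm (b + 2) h)) ([m+n]∸[m+o]≡n∸o h _ _))) ⟩
          b * (sumF r N ∸ (b + 2 + h)) ∎))
          where
          open ≤-Reasoning
          open Triangle tr using (i≢j; i≢l; j≢l) renaming (i to i₁; j to i₂; l to i₃)
          h : ℕ
          h = length H
          M : Fin r → ℕ
          -- Part `j` may have fewer than m - h vertices left; padding it to exactly this size makes
          -- the sum of the sizes computable.
          M = set N j (m ∸ h)
          h+2≤m : h + 2 ≤ m
          h+2≤m = ≤-trans (≤-reflexive (trans (+-comm h 2) (cong suc (trans (+-comm 1 h) h+1≡s)))) (≤-trans (m≤n+m (suc s) 2) s<m)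
          h≤m : h ≤ m
          h≤m = ≤-trans (m≤m+n h 2) h+2≤m
          2≤m∸h : 2 ≤ m ∸ h
          2≤m∸h = m+n≤o⇒m≤o∸n 2 (subst (_≤ m) (+-comm h 2) h+2≤m)
          N′≤M : ∀ ℓ → N′ ℓ ≤ M ℓ
          N′≤M = set-elim N j (m ∸ h) (λ ℓ y → N′ ℓ ≤ y) (≤-trans (≤-reflexive N′ⱼ≡) (m+n≤o⇒m≤o∸n (length Y) Y+h≤m)) (λ ℓ _ → N′≤N ℓ)
          M≤b : ∀ ℓ → M ℓ ≤ b
          M≤b = set-elim N j (m ∸ h) (λ _ y → y ≤ b) (≤-trans (m∸n≤m m h) m≤b) (λ ℓ _ → X≤b ℓ)
          2≤m : 2 ≤ m
          2≤m = ≤-trans (m≤n+m 2 h) h+2≤m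
          2≤M : ∀ ℓ → 2 ≤ M ℓ
          2≤M = set-elim N j (m ∸ h) (λ _ y → 2 ≤ y) 2≤m∸h (λ ℓ _ → ≤-trans 2≤m (m≤X ℓ))
          m≤M : ∀ {ℓ} → ℓ ≢ j → m ≤ M ℓ
          m≤M {ℓ} ℓ≢j = ≤-trans (m≤X ℓ) (≤-reflexive (sym (set-other N (m ∸ h) ℓ≢j)))
          b≤2m : b ≤ 2 * m
          b≤2m = Constants.b≤2m k s N₀≤m qb≤
          -- At most one of the three parts is `j`. Two of them have size at least `m`, the third at
          -- least 2, and b ≤ 2m.
          b+2≤ : b + 2 ≤ M i₁ + M i₂ + M i₃
          b+2≤ with i₁ ≟ᶠ j | i₂ ≟ᶠ j
          ... | yes refl | _ = ≤-trans (+-monoˡ-≤ 2 b≤2m) (≤-trans (≤-reflexive (arith m))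
                (+-mono-≤ (+-mono-≤ (2≤M i₁) (m≤M (≢-sym i≢j))) (m≤M (≢-sym i≢l))))
            where
            arith : ∀ m → 2 * m + 2 ≡ 2 + m + m
            arith = solve-∀
          ... | no i₁≢j | yes refl = ≤-trans (+-monoˡ-≤ 2 b≤2m) (≤-trans (≤-reflexive (arith m))
                (+-mono-≤ (+-mono-≤ (m≤M i₁≢j) (2≤M i₂)) (m≤M (≢-sym j≢l))))
            where
            arith : ∀ m → 2 * m + 2 ≡ m + 2 + m
            arith = solve-∀
          ... | no i₁≢j | no i₂≢j = ≤-trans (+-monoˡ-≤ 2 b≤2m) (≤-trans (≤-reflexive (arith m))
                (+-mono-≤ (+-mono-≤ (m≤M i₁≢j) (m≤M i₂≢j)) (2≤M i₃)))
            where
            arith : ∀ m → 2 * m + 2 ≡ m + m + 2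
            arith = solve-∀
          sumN : sumF r N ≡ h + sumF r M
          sumN = trans (sumF-extract r N j) (trans (cong (_+ sumF r (set N j 0)) (trans Nⱼ≡m (sym (m+[n∸m]≡n h≤m))))
            (trans (+-assoc h (m ∸ h) _) (cong (h +_) (sym (trans (sumF-extract r M j)
              (cong₂ _+_ (set-same N j (m ∸ h)) (sumF-cong r (set-set N j (m ∸ h) 0))))))))

        one-part : Main ⊎ Alternative
        one-part = [ inj₁ ∘ small-case , [ inj₁ ∘ HiltonMilner-case , (λ { (k≡1 , tr) → inj₂ (triangle-case k≡1 tr) }) ]′ ]′
          (classification uX′)

      one-residue : Main ⊎ Alternative
      one-residue with one-part-or-saving m 1≤m (fromℕ (2 + k)) m≡ m≤X uX inX uF p
      ... | inj₁ (j , Nⱼ≡m , in-j) = OnePart.one-part j Nⱼ≡m in-j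
      ... | inj₂ saving = inj₁ (crude⇒main h+1≡s (≤-trans saving (+-monoˡ-≤ (length H * P)
              (Intersecting.crude k X b 1≤b X≤b G uG (inX ∘ G⊆F) intersecting nontrivial uX))))

    from-peeled : Main ⊎ Alternative
    from-peeled with t ≟ 0 | t ≟ 1
    ... | yes t≡0 | _       = ⊥-elim (no-residue t≡0)
    ... | no _    | yes t≡1 = Residue.one-residue t≡1
    ... | no t≢0  | no t≢1  = inj₁ (large-residue (≤∧≢⇒< (n≢0⇒n>0 t≢0) (≢-sym t≢1)))

  upper-bound : Main ⊎ Alternative
  upper-bound = from-peeled (peel s ≤-refl F uF inX νF)

-- Extremal families

module _ {r : ℕ} {n : Fin (suc r) → ℕ} (F : Family n) where

  -- The edges of a matching carry distinct labels, and only s labels exist.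
  labelled-ν : ∀ {s} (g : Vec ℕ (suc r) → ℕ) → (∀ {A} → A ∈ members F → g A < s) →
    (∀ {A B} → A ∈ members F → B ∈ members F → g A ≡ g B → ¬ Disjoint A B) → νAtMost s F
  labelled-ν {s} g g<s clash M (M⊆F , dM) = begin
    length M              ≡⟨ sym (length-map g M) ⟩
    length (map g M)      ≤⟨ Card≤-list (upTo s) (unique M M⊆F dM) in-range ⟩
    length (upTo s)       ≡⟨ length-upTo s ⟩
    s                     ∎
    where
    open ≤-Reasoning
    in-range : ∀ {x} → x ∈ map g M → x ∈ upTo s
    in-range x∈ with ∈-map⁻ g x∈
    ... | A , A∈ , refl = ∈-upTo⁺ (g<s (M⊆F A∈))
    unique : ∀ M → (∀ {A} → A ∈ M → A ∈ members F) → AllPairs Disjoint M → Unique (map g M)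
    unique []      _   _          = []
    unique (A ∷ M) M⊆F (dA ∷ dM) = ∉⇒All≢ fresh ∷ unique M (M⊆F ∘ there) dM
      where
      fresh : g A ∉ map g M
      fresh gA∈ with ∈-map⁻ g gA∈
      ... | B , B∈ , e = clash (M⊆F (here refl)) (M⊆F (there B∈)) e (All.lookup dA B∈)

  -- Each edge of the matching M and the triple B₁, B₂, B₃ need their own vertices of a transversal, the triple two of them.
  τ-lower : ∀ M → IsMatching F M → ∀ {B₁ B₂ B₃} → B₁ ∈ members F → B₂ ∈ members F → B₃ ∈ members F →
    (∀ ℓ → lookup B₂ ℓ ≡ lookup B₁ ℓ → lookup B₃ ℓ ≢ lookup B₁ ℓ) →
    (∀ {E} → E ∈ M → Disjoint E B₁ × Disjoint E B₂ × Disjoint E B₃) →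
    τExceeds (suc (length M)) F
  τ-lower M (M⊆F , dM) {B₁} {B₂} {B₃} B₁∈ B₂∈ B₃∈ no-common apart T (uT , _ , hits)
    with hit-all M M⊆F dM
    where
    Hit : Vec ℕ (suc r) → Vertex (suc r) → Set
    Hit A (ℓ , x) = lookup A ℓ ≡ x
    hit-all : ∀ M → (∀ {A} → A ∈ M → A ∈ members F) → AllPairs Disjoint M →
      ∃ λ U → Unique U × (∀ {v} → v ∈ U → v ∈ T × ∃ λ E → E ∈ M × Hit E v) × length U ≡ length M
    hit-all []      _   _         = [] , [] , (λ ()) , refl
    hit-all (E ∷ M) M⊆F (dE ∷ dM) with hits (M⊆F (here refl)) | hit-all M (M⊆F ∘ there) dM
    ... | ℓ , v∈ | U , uU , U⊆ , len = (ℓ , lookup E ℓ) ∷ U , ∉⇒All≢ fresh ∷ uU ,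
        (λ { (here refl) → v∈ , E , here refl , refl
           ; (there w∈) → let w∈T , E′ , E′∈ , hit = U⊆ w∈ in w∈T , E′ , there E′∈ , hit }) ,
        cong suc len
      where
      fresh : (ℓ , lookup E ℓ) ∉ U
      fresh v∈U = let _ , E′ , E′∈ , hit = U⊆ v∈U in All.lookup dE E′∈ ℓ (sym hit)
  ... | U , uU , U⊆ , len = finish (hits B₁∈) (hits B₂∈) (hits B₃∈)
    where
    conclude : ∀ {ℓ x ℓ′ x′} → (ℓ , x) ∈ T → (ℓ′ , x′) ∈ T → (ℓ , x) ≢ (ℓ′ , x′) →
      (∀ {E} → E ∈ M → lookup E ℓ ≢ x) → (∀ {E} → E ∈ M → lookup E ℓ′ ≢ x′) → 2 + length M ≤ length T
    conclude v∈ w∈ v≢w v# w# = ≤-trans (≤-reflexive (cong (2 +_) (sym len)))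
      (Card≤-list T
        (∉⇒All≢ (λ { (here e) → v≢w e ; (there v∈U) → let _ , E , E∈ , hit = U⊆ v∈U in v# E∈ hit }) ∷
         ∉⇒All≢ (λ w∈U → let _ , E , E∈ , hit = U⊆ w∈U in w# E∈ hit) ∷ uU)
        (λ { (here refl) → v∈ ; (there (here refl)) → w∈ ; (there (there u∈)) → proj₁ (U⊆ u∈) }))
    Hitting : Vec ℕ (suc r) → Set
    Hitting B = Σ (Fin (suc r)) λ ℓ → (ℓ , lookup B ℓ) ∈ T
    finish : Hitting B₁ → Hitting B₂ → Hitting B₃ → 2 + length M ≤ length T
    -- If the vertex chosen on `B₁` also lies on `B₂`, it is not on `B₃`, and the vertex chosen on
    -- `B₃` is a second one. Otherwise the vertex chosen on `B₂` is.
    finish (ℓ₁ , v₁) (ℓ₂ , v₂) (ℓ₃ , v₃) with lookup B₂ ℓ₁ ≟ lookup B₁ ℓ₁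
    ... | yes e = conclude v₁ v₃ (differs (no-common ℓ₁ e)) (λ E∈ → proj₁ (apart E∈) ℓ₁) (λ E∈ → proj₂ (proj₂ (apart E∈)) ℓ₃)
      where
      differs : lookup B₃ ℓ₁ ≢ lookup B₁ ℓ₁ → (ℓ₁ , lookup B₁ ℓ₁) ≢ (ℓ₃ , lookup B₃ ℓ₃)
      differs B₃≢B₁ e with cong proj₁ e | cong proj₂ e
      ... | refl | e₂ = B₃≢B₁ (sym e₂)
    ... | no B₂≢B₁ = conclude v₁ v₂ differs (λ E∈ → proj₁ (apart E∈) ℓ₁) (λ E∈ → proj₁ (proj₂ (apart E∈)) ℓ₂)
      where
      differs : (ℓ₁ , lookup B₁ ℓ₁) ≢ (ℓ₂ , lookup B₂ ℓ₂)
      differs e with cong proj₁ e | cong proj₂ e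
      ... | refl | e₂ = B₂≢B₁ (sym e₂)

module _ {r : ℕ} (X : Fin r → List ℕ) (j : Fin r) (Y : List ℕ) where

  ∈-box-set⁻ : ∀ {A} → A ∈ box r (set X j Y) → lookup A j ∈ Y × (∀ ℓ → ℓ ≢ j → lookup A ℓ ∈ X ℓ)
  ∈-box-set⁻ {A} A∈ = subst (lookup A j ∈_) (set-same X j Y) (∈-box⁻ {X = set X j Y} A∈ j) ,
    λ ℓ ℓ≢j → subst (lookup A ℓ ∈_) (set-other X Y ℓ≢j) (∈-box⁻ {X = set X j Y} A∈ ℓ)

  ∈-box-set⁺ : ∀ {A} → lookup A j ∈ Y → (∀ ℓ → ℓ ≢ j → lookup A ℓ ∈ X ℓ) → A ∈ box r (set X j Y)
  ∈-box-set⁺ {A} A∈Y A∈X = ∈-box⁺ (set-elim X j Y (λ ℓ Z → lookup A ℓ ∈ Z) A∈Y A∈X)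

  box-set-unique : Unique Y → (∀ ℓ → Unique (X ℓ)) → Unique (box r (set X j Y))
  box-set-unique uY uX = box-unique r (set-elim X j Y (λ _ → Unique) uY (λ ℓ _ → uX ℓ))

-- With h = s - 1, the vertices 0, ..., h - 1 of the last part carry full stars, and vertex h is the
-- centre of a Hilton-Milner family whose edge `B` is 0 outside the last part. The bound 4 + h
-- leaves room for the edges that witness τ > s.
module MainFamily (k h : ℕ) (n : Fin (3 + k) → ℕ) (h+4≤n : ∀ ℓ → 4 + h ≤ n ℓ) where

  private
    r s m : ℕ
    r = 3 + k
    s = suc h
    last : Fin r
    last = fromℕ (2 + k)
    m = n last

    X X⁺ : Fin r → List ℕ
    X  ℓ = upTo (n ℓ)
    X⁺ ℓ = X ℓ minus 0

    beyond : List ℕ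
    beyond = map (s +_) (upTo (m ∸ s))

    Zero : Vec ℕ r → Set
    Zero A = ∃ λ ℓ → ℓ ≢ last × lookup A ℓ ≡ 0

    Zero? : Decidable Zero
    Zero? A = anyᶠ? λ ℓ → ¬? (ℓ ≟ᶠ last) ×-dec (lookup A ℓ ≟ 0)

    -- The family consists of `full`, `centre` and `fan`. `K⁺` is the complement of `centre` in
    -- `star`; being a box, it gives the size of `centre`.
    star K⁺ full centre fan : List (Vec ℕ r)
    full   = box r (set X last (upTo h))
    star   = box r (set X last [ h ])
    K⁺     = box r (set X⁺ last [ h ])
    centre = filter Zero? star
    fan    = box r (set (λ _ → [ 0 ]) last beyond)

    uX : ∀ ℓ → Unique (X ℓ)
    uX ℓ = Uniqueₚ.upTo⁺ (n ℓ)

    s<m : s < m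
    s<m = ≤-trans (s≤s (s≤s (m≤n+m h 2))) (h+4≤n last)

    small∈X : ∀ {x} ℓ → x < 4 + h → x ∈ X ℓ
    small∈X ℓ x< = ∈-upTo⁺ (≤-trans x< (h+4≤n ℓ))

    ∈-beyond⁻ : ∀ {x} → x ∈ beyond → s ≤ x × x < m
    ∈-beyond⁻ x∈ with ∈-map⁻ (s +_) x∈
    ... | y , y∈ , refl = m≤m+n s y , ≤-trans (+-monoʳ-< s (∈-upTo⁻ y∈)) (≤-reflexive (m+[n∸m]≡n (<⇒≤ s<m)))

    full⁻ : ∀ {A} → A ∈ full → lookup A last < h × (∀ ℓ → ℓ ≢ last → lookup A ℓ ∈ X ℓ)
    full⁻ A∈ = let ∈h , ∈X = ∈-box-set⁻ X last (upTo h) A∈ in ∈-upTo⁻ ∈h , ∈X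

    star⁻ : ∀ {A} → A ∈ star → lookup A last ≡ h × (∀ ℓ → ℓ ≢ last → lookup A ℓ ∈ X ℓ)
    star⁻ A∈ = let ∈h , ∈X = ∈-box-set⁻ X last [ h ] A∈ in ∈[]⇒≡ ∈h , ∈X

    centre⁻ : ∀ {A} → A ∈ centre → lookup A last ≡ h × Zero A
    centre⁻ A∈ = let A∈star , zero-A = ∈-filter⁻ Zero? {xs = star} A∈ in proj₁ (star⁻ A∈star) , zero-A

    fan⁻ : ∀ {A} → A ∈ fan → (s ≤ lookup A last × lookup A last < m) × (∀ ℓ → ℓ ≢ last → lookup A ℓ ≡ 0)
    fan⁻ A∈ = let ∈b , ∈0 = ∈-box-set⁻ (λ _ → [ 0 ]) last beyond A∈ in ∈-beyond⁻ ∈b , λ ℓ ℓ≢ → ∈[]⇒≡ (∈0 ℓ ℓ≢)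

    full-unique : Unique full
    full-unique = box-set-unique X last (upTo h) (Uniqueₚ.upTo⁺ h) uX

    star-unique : Unique star
    star-unique = box-set-unique X last [ h ] ([] ∷ []) uX

    centre-unique : Unique centre
    centre-unique = Uniqueₚ.filter⁺ Zero? star-unique

    K⁺-unique : Unique K⁺
    K⁺-unique = box-set-unique X⁺ last [ h ] ([] ∷ []) (λ ℓ → minus-unique 0 (uX ℓ))

    fan-unique : Unique fan
    fan-unique = box-set-unique (λ _ → [ 0 ]) last beyond
      (Uniqueₚ.map⁺ (+-cancelˡ-≡ s _ _) (Uniqueₚ.upTo⁺ (m ∸ s))) (λ _ → [] ∷ [])

    edges : List (Vec ℕ r)
    edges = full ++ centre ++ fan

    edges-unique : Unique edges
    edges-unique = Unique-++ {P = λ A → lookup A last < h}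
      full-unique
      (Unique-++ {P = λ A → lookup A last < s} centre-unique fan-unique
        (λ A∈ → s≤s (≤-reflexive (proj₁ (centre⁻ A∈))))
        (λ A∈ <s → <⇒≱ <s (proj₁ (proj₁ (fan⁻ A∈)))))
      (proj₁ ∘ full⁻)
      (λ A∈ <h → [ (λ A∈ → <-irrefl (proj₁ (centre⁻ A∈)) <h) , (λ A∈ → <⇒≱ <h (<⇒≤ (proj₁ (proj₁ (fan⁻ A∈))))) ]′ (∈-++⁻ centre A∈))

    edges-valid : ∀ {A} → A ∈ edges → IsSeq n A
    edges-valid {A} A∈ with ∈-++⁻ full A∈
    ... | inj₁ A∈full = at-last (λ { refl → ≤-trans (proj₁ (full⁻ A∈full)) (≤-trans (n≤1+n h) (<⇒≤ s<m)) })
                                 (λ ℓ ℓ≢ → ∈-upTo⁻ (proj₂ (full⁻ A∈full) ℓ ℓ≢))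
      where
      at-last : (∀ {ℓ} → ℓ ≡ last → lookup A ℓ < n ℓ) → (∀ ℓ → ℓ ≢ last → lookup A ℓ < n ℓ) → IsSeq n A
      at-last same other ℓ with ℓ ≟ᶠ last
      ... | yes e = same e
      ... | no ≢  = other ℓ ≢
    ... | inj₂ A∈rest with ∈-++⁻ centre A∈rest
    ...   | inj₁ A∈centre = λ ℓ → at-last ℓ
      where
      A∈star : A ∈ star
      A∈star = proj₁ (∈-filter⁻ Zero? A∈centre)
      at-last : IsSeq n A
      at-last ℓ with ℓ ≟ᶠ last
      ... | yes refl = ≤-trans (s≤s (≤-reflexive (proj₁ (star⁻ A∈star)))) (<⇒≤ s<m)
      ... | no ℓ≢    = ∈-upTo⁻ (proj₂ (star⁻ A∈star) ℓ ℓ≢)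
    ...   | inj₂ A∈fan = at-last
      where
      at-last : IsSeq n A
      at-last ℓ with ℓ ≟ᶠ last
      ... | yes refl = proj₂ (proj₁ (fan⁻ A∈fan))
      ... | no ℓ≢    = subst (_< n ℓ) (sym (proj₂ (fan⁻ A∈fan) ℓ ℓ≢)) (≤-trans (s≤s z≤n) (h+4≤n ℓ))

  family : Family n
  family = record { members = edges ; valid = edges-valid ; distinct = edges-unique }

  private
    P P⁻ : ℕ
    P  = prodInit (2 + k) n
    P⁻ = prodInitPred (2 + k) n

    length-box-set : ∀ (Z : Fin r → List ℕ) Y → length (box r (set Z last Y)) ≡ length Y * prodInit (2 + k) (length ∘ Z)
    length-box-set Z Y = trans (length-box r (set Z last Y)) (trans (prod-cong r (set-map length Z last Y))
      (trans (prod-set r (length ∘ Z) last (length Y)) (cong (length Y *_) (prod-set-last (2 + k) (length ∘ Z)))))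

    P≡ : prodInit (2 + k) (length ∘ X) ≡ P
    P≡ = prod-cong (2 + k) λ i → length-upTo (n (inject₁ i))

    P⁻≡ : prodInit (2 + k) (length ∘ X⁺) ≡ P⁻
    P⁻≡ = prod-cong (2 + k) λ i → trans (length-minus (uX (inject₁ i)) (small∈X (inject₁ i) (s≤s z≤n)))
      (cong (_∸ 1) (length-upTo (n (inject₁ i))))

    |full| : length full ≡ h * P
    |full| = trans (length-box-set X (upTo h)) (cong₂ _*_ (length-upTo h) P≡)

    |star| : length star ≡ P
    |star| = trans (length-box-set X [ h ]) (trans (*-identityˡ _) P≡)

    |K⁺| : length K⁺ ≡ P⁻
    |K⁺| = trans (length-box-set X⁺ [ h ]) (trans (*-identityˡ _) P⁻≡)

    |fan| : length fan ≡ m ∸ s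
    |fan| = trans (length-box-set (λ _ → [ 0 ]) beyond) (trans
      (cong₂ _*_ (trans (length-map (s +_) (upTo (m ∸ s))) (length-upTo (m ∸ s))) (trans (prod-const (2 + k) 1) (^-zeroˡ (2 + k))))
      (*-identityʳ _))

    K⁺⁻ : ∀ {A} → A ∈ K⁺ → A ∈ star × ¬ Zero A
    K⁺⁻ A∈ = let ∈h , ∈X⁺ = ∈-box-set⁻ X⁺ last [ h ] A∈ in
      ∈-box-set⁺ X last [ h ] ∈h (λ ℓ ℓ≢ → proj₁ (∈-minus⁻ (X ℓ) (∈X⁺ ℓ ℓ≢))) ,
      λ { (ℓ , ℓ≢ , e) → proj₂ (∈-minus⁻ (X ℓ) (∈X⁺ ℓ ℓ≢)) e }

    |centre| : length centre + P⁻ ≡ P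
    |centre| = trans (cong (length centre +_) (sym |K⁺|)) (trans (≤-antisym
      (subst (_≤ length star) (length-++ centre {K⁺})
        (Card≤-list star (Unique-++ {P = Zero} centre-unique K⁺-unique
            (λ A∈ → proj₂ (∈-filter⁻ Zero? {xs = star} A∈)) (proj₂ ∘ K⁺⁻))
          (λ A∈ → [ (λ A∈ → proj₁ (∈-filter⁻ Zero? A∈)) , proj₁ ∘ K⁺⁻ ]′ (∈-++⁻ centre A∈))))
      (Card≤-⊎ (Card≤-list centre) (Card≤-list K⁺) star-unique split)) |star|)
      where
      split : ∀ {A} → A ∈ star → A ∈ centre ⊎ A ∈ K⁺
      split {A} A∈ with Zero? A
      ... | yes z = inj₁ (∈-filter⁺ Zero? A∈ z)
      ... | no ¬z = let e , ∈X = star⁻ A∈ in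
            inj₂ (∈-box-set⁺ X⁺ last [ h ] (≡⇒∈[] e) λ ℓ ℓ≢ → ∈-minus⁺ (∈X ℓ ℓ≢) λ e₀ → ¬z (ℓ , ℓ≢ , e₀))

  family-size : size family ≡ mainBound (2 + k) s n
  family-size = sym (trans (cong (_∸ (P⁻ + s)) (sym total)) (m+n∸n≡m (length edges) (P⁻ + s)))
    where
    open ≤-Reasoning
    total : length edges + (P⁻ + s) ≡ s * P + m
    total = begin-equality
      length edges + (P⁻ + s)                              ≡⟨ cong (_+ (P⁻ + s)) (trans (length-++ full {centre ++ fan}) (cong (length full +_) (length-++ centre {fan}))) ⟩
      length full + (length centre + length fan) + (P⁻ + s) ≡⟨ cong₂ (λ x y → x + (length centre + y) + (P⁻ + s)) |full| |fan| ⟩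
      h * P + (length centre + (m ∸ s)) + (P⁻ + s)         ≡⟨ arith (h * P) (length centre) (m ∸ s) P⁻ s ⟩
      h * P + (length centre + P⁻) + (m ∸ s + s)           ≡⟨ cong₂ (λ x y → h * P + x + y) |centre| (m∸n+n≡m (<⇒≤ s<m)) ⟩
      h * P + P + m                                        ≡⟨ cong (_+ m) (+-comm (h * P) P) ⟩
      s * P + m ∎
      where
      arith : ∀ a c d p s → a + (c + d) + (p + s) ≡ a + (c + p) + (d + s)
      arith = solve-∀

  private
    -- All edges at the Hilton-Milner end, with last coordinate h or more, share the label h; the
    -- full stars have one label each.
    label : Vec ℕ r → ℕ
    label A = lookup A last ⊓ h

    Big : Vec ℕ r → Set
    Big A = h ≤ lookup A last × ((lookup A last ≡ h × Zero A) ⊎ (∀ ℓ → ℓ ≢ last → lookup A ℓ ≡ 0))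

    low-or-big : ∀ {A} → A ∈ edges → lookup A last < h ⊎ Big A
    low-or-big A∈ with ∈-++⁻ full A∈
    ... | inj₁ A∈full = inj₁ (proj₁ (full⁻ A∈full))
    ... | inj₂ A∈rest with ∈-++⁻ centre A∈rest
    ...   | inj₁ A∈centre = let e , z = centre⁻ A∈centre in inj₂ (≤-reflexive (sym e) , inj₁ (e , z))
    ...   | inj₂ A∈fan    = let (s≤ , _) , zeros = fan⁻ A∈fan in inj₂ (<⇒≤ s≤ , inj₂ zeros)

    0≢last : fzero ≢ last
    0≢last ()

    big-meet : ∀ A B → Big A → Big B → Meets A B
    big-meet A B (_ , inj₁ (e , _))           (_ , inj₁ (e′ , _))           = last , trans e (sym e′)
    big-meet A B (_ , inj₁ (_ , ℓ , ℓ≢ , e))  (_ , inj₂ zeros)              = ℓ , trans e (sym (zeros ℓ ℓ≢))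
    big-meet A B (_ , inj₂ zeros)             (_ , inj₁ (_ , ℓ , ℓ≢ , e))   = ℓ , trans (zeros ℓ ℓ≢) (sym e)
    big-meet A B (_ , inj₂ zeros)             (_ , inj₂ zeros′)             = fzero , trans (zeros fzero 0≢last) (sym (zeros′ fzero 0≢last))

    clash : ∀ {A B} → A ∈ edges → B ∈ edges → label A ≡ label B → Meets A B
    clash {A} {B} A∈ B∈ e with low-or-big A∈ | low-or-big B∈
    ... | inj₂ bigA | inj₂ bigB = big-meet A B bigA bigB
    ... | inj₁ lowA | inj₁ lowB = last , trans (sym (m≤n⇒m⊓n≡m (<⇒≤ lowA))) (trans e (m≤n⇒m⊓n≡m (<⇒≤ lowB)))
    ... | inj₁ lowA | inj₂ (h≤B , _) = ⊥-elim (<-irrefl (trans (sym (m≤n⇒m⊓n≡m (<⇒≤ lowA))) (trans e (m≥n⇒m⊓n≡n h≤B))) lowA)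
    ... | inj₂ (h≤A , _) | inj₁ lowB = ⊥-elim (<-irrefl (trans (sym (m≤n⇒m⊓n≡m (<⇒≤ lowB))) (trans (sym e) (m≥n⇒m⊓n≡n h≤A))) lowB)

    spread : (Fin r → ℕ) → ℕ → Vec ℕ r
    spread g x = tabulate (set g last x)

    spread-last : ∀ g x → lookup (spread g x) last ≡ x
    spread-last g x = trans (lookup∘tabulate (set g last x) last) (set-same g last x)

    spread-other : ∀ g x {ℓ} → ℓ ≢ last → lookup (spread g x) ℓ ≡ g ℓ
    spread-other g x {ℓ} ℓ≢ = trans (lookup∘tabulate (set g last x) ℓ) (set-other g x ℓ≢)

    spread-disjoint : ∀ g g′ {x x′} → x ≢ x′ → (∀ ℓ → g ℓ ≢ g′ ℓ) → Disjoint (spread g x) (spread g′ x′)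
    spread-disjoint g g′ {x} {x′} x≢ g≢ ℓ e with ℓ ≟ᶠ last
    ... | yes refl = x≢ (trans (sym (spread-last g x)) (trans e (spread-last g′ x′)))
    ... | no ℓ≢    = g≢ ℓ (trans (sym (spread-other g x ℓ≢)) (trans e (spread-other g′ x′ ℓ≢)))

    -- Outside the last part these edges use only values from 2 on, so they avoid the values 0 and 1
    -- of `B₁`, `B₂` and `B₃`.
    E : ℕ → Vec ℕ r
    E i = spread (λ _ → 2 + i) i

    g₁ g₂ : Fin r → ℕ
    g₁ = set (λ _ → 1) fzero 0
    g₂ = set (λ _ → 1) (fsuc fzero) 0

    -- Two edges through the centre whose single zeros lie in different parts, and an edge off the
    -- centre with zeros everywhere else. A vertex on all three would have to be a zero common to
    -- the first two.
    B₁ B₂ B₃ : Vec ℕ r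
    B₁ = spread g₁ h
    B₂ = spread g₂ h
    B₃ = spread (λ _ → 0) s

    ≤1 : ∀ j ℓ → set {r = r} (λ _ → 1) j 0 ℓ ≤ 1
    ≤1 j = set-elim (λ _ → 1) j 0 (λ _ y → y ≤ 1) z≤n (λ _ _ → ≤-refl)

    E∈ : ∀ {i} → i < h → E i ∈ edges
    E∈ {i} i<h = ∈-++⁺ˡ (∈-box-set⁺ X last (upTo h) (subst (_∈ upTo h) (sym (spread-last (λ _ → 2 + i) i)) (∈-upTo⁺ i<h))
      λ ℓ ℓ≢ → subst (_∈ X ℓ) (sym (spread-other (λ _ → 2 + i) i ℓ≢)) (small∈X ℓ (s≤s (s≤s (≤-trans i<h (m≤n+m h 2))))))

    centre∈ : ∀ j → j ≢ last → spread (set (λ _ → 1) j 0) h ∈ edges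
    centre∈ j j≢ = ∈-++⁺ʳ full (∈-++⁺ˡ (∈-filter⁺ Zero? (∈-box-set⁺ X last [ h ] (≡⇒∈[] (spread-last (set (λ _ → 1) j 0) h))
        λ ℓ ℓ≢ → subst (_∈ X ℓ) (sym (spread-other (set (λ _ → 1) j 0) h ℓ≢)) (small∈X ℓ (s≤s (≤-trans (≤1 j ℓ) (s≤s z≤n)))))
      (j , j≢ , trans (spread-other (set (λ _ → 1) j 0) h j≢) (set-same (λ _ → 1) j 0))))

    B₃∈ : B₃ ∈ edges
    B₃∈ = ∈-++⁺ʳ full (∈-++⁺ʳ centre (∈-box-set⁺ (λ _ → [ 0 ]) last beyond
      (subst (_∈ beyond) (trans (+-identityʳ s) (sym (spread-last (λ _ → 0) s))) (∈-map⁺ (s +_) (∈-upTo⁺ (m<n⇒0<n∸m s<m))))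
      λ ℓ ℓ≢ → ≡⇒∈[] (spread-other (λ _ → 0) s ℓ≢)))

    no-common : ∀ ℓ → lookup B₂ ℓ ≡ lookup B₁ ℓ → lookup B₃ ℓ ≢ lookup B₁ ℓ
    no-common ℓ e₂ e₃ with ℓ ≟ᶠ last
    ... | yes refl = 1+n≢n (trans (sym (spread-last (λ _ → 0) s)) (trans e₃ (spread-last g₁ h)))
    ... | no ℓ≢ = distinct-zeros ℓ
          (trans (sym (spread-other g₁ h ℓ≢)) (trans (sym e₃) (spread-other (λ _ → 0) s ℓ≢)))
          (trans (sym (spread-other g₂ h ℓ≢)) (trans e₂ (trans (sym e₃) (spread-other (λ _ → 0) s ℓ≢))))
      where
      distinct-zeros : ∀ ℓ → g₁ ℓ ≡ 0 → g₂ ℓ ≢ 0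
      distinct-zeros fzero    _  ()
      distinct-zeros (fsuc ℓ) () _

    M : List (Vec ℕ r)
    M = map E (upTo h)

    M⁻ : ∀ {A} → A ∈ M → ∃ λ i → i < h × A ≡ E i
    M⁻ A∈ with ∈-map⁻ E A∈
    ... | i , i∈ , e = i , ∈-upTo⁻ i∈ , e

    M-matching : IsMatching family M
    M-matching = (λ A∈ → let i , i<h , e = M⁻ A∈ in subst (_∈ edges) (sym e) (E∈ i<h)) ,
      AllPairsₚ.map⁺ (AllPairs.map (λ {i} {j} i≢j → spread-disjoint (λ _ → 2 + i) (λ _ → 2 + j) i≢j λ _ e → i≢j (+-cancelˡ-≡ 2 _ _ e)) (Uniqueₚ.upTo⁺ h))

    apart : ∀ {A} → A ∈ M → Disjoint A B₁ × Disjoint A B₂ × Disjoint A B₃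
    apart A∈ with M⁻ A∈
    ... | i , i<h , refl =
      spread-disjoint (λ _ → 2 + i) g₁ (<⇒≢ i<h) (λ ℓ e → <⇒≢ (s≤s (≤-trans (≤1 fzero ℓ) (s≤s z≤n))) (sym e)) ,
      spread-disjoint (λ _ → 2 + i) g₂ (<⇒≢ i<h) (λ ℓ e → <⇒≢ (s≤s (≤-trans (≤1 (fsuc fzero) ℓ) (s≤s z≤n))) (sym e)) ,
      spread-disjoint (λ _ → 2 + i) (λ _ → 0) (<⇒≢ (m<n⇒m<1+n i<h)) (λ _ ())

  family-admissible : Admissible s family
  family-admissible =
    labelled-ν family label (λ {A} _ → s≤s (m⊓n≤n (lookup A last) h))
      (λ A∈ B∈ e disjoint → let ℓ , e′ = clash A∈ B∈ e in disjoint ℓ e′) ,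
    subst (λ c → τExceeds c family) (cong suc (trans (length-map E (upTo h)) (length-upTo h)))
      (τ-lower family M M-matching (centre∈ fzero 0≢last) (centre∈ (fsuc fzero) (λ ())) B₃∈ no-common apart)

module _ {r : ℕ} {n : Fin (suc r) → ℕ} (F : Family (n ∘ fsuc)) where

  -- For r = 3 and s = 1 the main family consists of all edges containing two of three fixed
  -- vertices. Its product with one more part is the triangle family for r = 4, with a largest part
  -- left outside the triple.
  cylinder : Family n
  cylinder = record
    { members  = cartesianProductWith _∷_ (upTo (n fzero)) (members F)
    ; valid    = valid′
    ; distinct = Uniqueₚ.cartesianProductWith⁺ _∷_ ∷-injective (Uniqueₚ.upTo⁺ (n fzero)) (distinct F) }
    where
    valid′ : ∀ {A} → A ∈ cartesianProductWith _∷_ (upTo (n fzero)) (members F) → IsSeq n A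
    valid′ A∈ ℓ with ∈-cartesianProductWith⁻ _∷_ (upTo (n fzero)) (members F) A∈
    valid′ A∈ fzero    | a , A , a∈ , A∈F , refl = ∈-upTo⁻ a∈
    valid′ A∈ (fsuc ℓ) | a , A , a∈ , A∈F , refl = valid F A∈F ℓ

  cylinder-size : size cylinder ≡ n fzero * size F
  cylinder-size = trans (length-cartesianProductWith _∷_ (upTo (n fzero)) (members F)) (cong (_* size F) (length-upTo (n fzero)))

  -- Matchings project to matchings. A transversal either contains the whole first part, which has
  -- more than s vertices, or misses some vertex a there; the fibre over a is then covered by the
  -- remaining vertices alone, and there are more than s of them.
  cylinder-admissible : ∀ {s} → s < n fzero → Admissible s F → Admissible s cylinder
  cylinder-admissible {s} s<n (νF , τF) = ν , τ
    where
    tail∈ : ∀ {A} → A ∈ members cylinder → tail A ∈ members F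
    tail∈ A∈ with ∈-cartesianProductWith⁻ _∷_ (upTo (n fzero)) (members F) A∈
    ... | a , A , a∈ , A∈F , refl = A∈F
    tail-lookup : ∀ (A : Vec ℕ (suc r)) ℓ → lookup (tail A) ℓ ≡ lookup A (fsuc ℓ)
    tail-lookup (a ∷ A) ℓ = refl
    ν : νAtMost s cylinder
    ν M (M⊆ , dM) = subst (_≤ s) (length-map tail M) (νF (map tail M)
      ((λ A∈ → let A , A∈M , e = ∈-map⁻ tail A∈ in subst (_∈ members F) (sym e) (tail∈ (M⊆ A∈M))) ,
       AllPairsₚ.map⁺ (AllPairs.map (λ {A} {B} d ℓ e → d (fsuc ℓ)
         (trans (sym (tail-lookup A ℓ)) (trans e (tail-lookup B ℓ)))) dM)))
    drop-first : List (Vertex (suc r)) → List (Vertex r)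
    drop-first []                  = []
    drop-first ((fzero , x) ∷ T)   = drop-first T
    drop-first ((fsuc ℓ , x) ∷ T)  = (ℓ , x) ∷ drop-first T
    length-drop-first : ∀ T → length (drop-first T) ≤ length T
    length-drop-first []                  = z≤n
    length-drop-first ((fzero , x) ∷ T)   = ≤-trans (length-drop-first T) (n≤1+n _)
    length-drop-first ((fsuc ℓ , x) ∷ T)  = s≤s (length-drop-first T)
    ∈-drop-first : ∀ {ℓ x} T → (fsuc ℓ , x) ∈ T → (ℓ , x) ∈ drop-first T
    ∈-drop-first ((fzero , x) ∷ T)   (there v∈)  = ∈-drop-first T v∈
    ∈-drop-first ((fsuc ℓ , x) ∷ T)  (here refl) = here refl
    ∈-drop-first ((fsuc ℓ , x) ∷ T)  (there v∈)  = there (∈-drop-first T v∈)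
    first : ℕ → Vertex (suc r)
    first a = fzero , a
    τ : τExceeds s cylinder
    τ T (uT , _ , hits) with search (upTo (n fzero)) (λ {a} _ → covered a)
      where
      open DecMembership (_≟ᵛ_ {suc r}) using (_∈?_)
      covered : ∀ a → (fzero , a) ∈ T ⊎ (fzero , a) ∉ T
      covered a with (fzero , a) ∈? T
      ... | yes v∈ = inj₁ v∈
      ... | no v∉  = inj₂ v∉
    ... | inj₁ all∈ = begin-strict
        s                                       <⟨ s<n ⟩
        n fzero                                 ≡⟨ sym (trans (length-map first (upTo (n fzero))) (length-upTo (n fzero))) ⟩
        length (map first (upTo (n fzero))) ≤⟨ Card≤-list T (Uniqueₚ.map⁺ (cong proj₂) (Uniqueₚ.upTo⁺ (n fzero))) ⊆T ⟩
        length T ∎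
      where
      open ≤-Reasoning
      ⊆T : ∀ {v} → v ∈ map first (upTo (n fzero)) → v ∈ T
      ⊆T v∈ with ∈-map⁻ first v∈
      ... | a , a∈ , refl = all∈ a∈
    ... | inj₂ (a , a∈ , v∉) = ≤-trans (cover-size F τF (drop-first T) below) (length-drop-first T)
      where
      below : ∀ {A} → A ∈ members F → ∃ λ v → v ∈ drop-first T × lookup A (proj₁ v) ≡ proj₂ v
      below {A} A∈ with hits (∈-cartesianProductWith⁺ _∷_ a∈ A∈)
      ... | fzero  , v∈ = ⊥-elim (v∉ v∈)
      ... | fsuc ℓ , v∈ = (ℓ , lookup A ℓ) , ∈-drop-first T v∈ , refl

-- Upper and lower bounds combined

alternative-arith : ∀ a x y w h → 1 ≤ x → 1 ≤ y → h + 1 ≤ w →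
  a * ((a + (x + (y + (w + 0)))) ∸ (a + 2 + h)) + h * (a * (x * (y * 1))) ≡
  a * (((h + 1) * x * y + w) ∸ ((x ∸ 1) * (y ∸ 1) + (h + 1)))
alternative-arith a (suc u) (suc v) w h _ _ h+1≤w with m≤n⇒∃[o]m+o≡n h+1≤w
... | w′ , refl = begin
  a * ((a + (suc u + (suc v + (h + 1 + w′ + 0)))) ∸ (a + 2 + h)) + h * (a * (suc u * (suc v * 1)))
    ≡⟨ cong (λ t → a * t + h * (a * (suc u * (suc v * 1)))) (trans (cong (_∸ (a + 2 + h)) (arith₁ a u v h w′)) (m+n∸m≡n (a + 2 + h) _)) ⟩
  a * (u + v + 1 + w′) + h * (a * (suc u * (suc v * 1)))
    ≡⟨ arith₂ a u v w′ h ⟩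
  a * (h * (suc u * suc v) + (u + v + 1) + w′)
    ≡⟨ cong (a *_) (sym (trans (cong (_∸ (u * v + (h + 1))) (arith₃ h u v w′)) (m+n∸m≡n (u * v + (h + 1)) _))) ⟩
  a * (((h + 1) * suc u * suc v + (h + 1 + w′)) ∸ (u * v + (h + 1))) ∎
  where
  open ≡-Reasoning
  arith₁ : ∀ a u v h w → a + (1 + u + (1 + v + (h + 1 + w + 0))) ≡ a + 2 + h + (u + v + 1 + w)
  arith₁ = solve-∀
  arith₂ : ∀ a u v w h → a * (u + v + 1 + w) + h * (a * ((1 + u) * ((1 + v) * 1))) ≡ a * (h * ((1 + u) * (1 + v)) + (u + v + 1) + w)
  arith₂ = solve-∀
  arith₃ : ∀ h u v w → (h + 1) * (1 + u) * (1 + v) + (h + 1 + w) ≡ u * v + (h + 1) + (h * ((1 + u) * (1 + v)) + (u + v + 1) + w)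
  arith₃ = solve-∀

module _ (k h : ℕ) (n : Fin (3 + k) → ℕ) (antitone : ∀ i j → i ≤ᶠ j → n j ≤ n i)
  (N₀≤m : Constants.N₀ k (suc h) ≤ n (fromℕ (2 + k)))
  (qb≤ : Constants.q k (suc h) * n fzero ≤ (Constants.q k (suc h) + 1) * n (fromℕ (2 + k))) where

  private
    s m : ℕ
    s = suc h
    m = n (fromℕ (2 + k))

    m≤n : ∀ ℓ → m ≤ n ℓ
    m≤n ℓ = antitone ℓ (fromℕ (2 + k)) (≤fromℕ ℓ)

    h+4≤n : ∀ ℓ → 4 + h ≤ n ℓ
    h+4≤n ℓ = ≤-trans (Constants.3+s≤m k s {n fzero} N₀≤m qb≤) (m≤n ℓ)

    N : Fin (3 + k) → ℕ
    N = length ∘ upTo ∘ n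

    N≡n : N ≗ n
    N≡n ℓ = length-upTo (n ℓ)

    P≡ : prod (3 + k) (set N (fromℕ (2 + k)) 1) ≡ prodInit (2 + k) n
    P≡ = trans (prod-cong (3 + k) (set-cong N≡n (fromℕ (2 + k)) 1)) (prod-set-last (2 + k) n)

    P⁻≡ : prod (3 + k) (set (λ ℓ → N ℓ ∸ 1) (fromℕ (2 + k)) 1) ≡ prodInitPred (2 + k) n
    P⁻≡ = trans (prod-cong (3 + k) (set-cong (λ ℓ → cong (_∸ 1) (N≡n ℓ)) (fromℕ (2 + k)) 1)) (prod-set-last (2 + k) (λ ℓ → n ℓ ∸ 1))

  Alternative : ℕ → Set
  Alternative c = k ≡ 1 × c ≤ n fzero * (sumF (3 + k) n ∸ (n fzero + 2 + h)) + h * prodInit (2 + k) n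

  size-bound : (F : Family n) → Admissible s F → size F ≤ mainBound (2 + k) s n ⊎ Alternative (size F)
  size-bound F (νF , τF) = [ inj₁ ∘ main , inj₂ ∘ alternative ]′ U.upper-bound
    where
    module U = UpperBound k s (upTo ∘ n) (λ ℓ → Uniqueₚ.upTo⁺ (n ℓ)) (n fzero) m
      (λ ℓ → ≤-trans (≤-reflexive (N≡n ℓ)) (antitone fzero ℓ z≤n))
      (λ ℓ → ≤-trans (m≤n ℓ) (≤-reflexive (sym (N≡n ℓ))))
      (N≡n (fromℕ (2 + k))) N₀≤m qb≤
      (members F) (distinct F) (λ A∈ ℓ → ∈-upTo⁺ (valid F A∈ ℓ))
      (λ M M⊆ dM → νF M (M⊆ , dM)) (cover-size F τF)
    main : U.Main → size F ≤ mainBound (2 + k) s n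
    main le = m+n≤o⇒m≤o∸n (size F) (subst₂ (λ p⁻ p → size F + (p⁻ + s) ≤ s * p + m) P⁻≡ P≡ le)
    alternative : U.Alternative → Alternative (size F)
    alternative (k≡1 , h′ , h′+1≡s , le) with suc-injective (trans (+-comm 1 h′) h′+1≡s)
    ... | refl = k≡1 , subst₂ (λ S p → size F ≤ n fzero * (S ∸ (n fzero + 2 + h)) + h * p) (sumF-cong (3 + k) N≡n) P≡ le

  main-family : Σ (Family n) λ F → Admissible s F × size F ≡ mainBound (2 + k) s n
  main-family = family , family-admissible , family-size
    where open MainFamily k h n h+4≤n

  m₀-main : 3 + k ≢ 4 → M0Is s n (mainBound (2 + k) s n)
  m₀-main r≢4 = main-family , λ F adm → [ id , (λ { (k≡1 , _) → ⊥-elim (r≢4 (cong (3 +_) k≡1)) }) ]′ (size-bound F adm)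

  m₀-four : (e : 3 + k ≡ 4) → M0Is s n (mainBound (2 + k) s n ⊔ altBound4 s (λ i → n (cast (sym e) i)))
  m₀-four refl = attained , λ F adm → [ (λ le → ≤-trans le (m≤m⊔n main alt)) ,
      (λ { (_ , le) → ≤-trans le (≤-trans (≤-reflexive alt≡) (m≤n⊔m main alt)) }) ]′ (size-bound F adm)
    where
    main alt : ℕ
    main = mainBound 3 s n
    alt = altBound4 s n
    n₁ n₂ n₃ n₄ : ℕ
    n₁ = n fzero
    n₂ = n (fsuc fzero)
    n₃ = n (fsuc (fsuc fzero))
    n₄ = n (fsuc (fsuc (fsuc fzero)))
    1≤n : ∀ ℓ → 1 ≤ n ℓ
    1≤n ℓ = ≤-trans (s≤s z≤n) (h+4≤n ℓ)
    s≤n : ∀ ℓ → s ≤ n ℓ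
    s≤n ℓ = ≤-trans (s≤s (m≤n+m h 3)) (h+4≤n ℓ)
    alt≡ : n₁ * (sumF 4 n ∸ (n₁ + 2 + h)) + h * prodInit 3 n ≡ alt
    alt≡ = trans (alternative-arith n₁ n₂ n₃ n₄ h (1≤n _) (1≤n _) (subst (_≤ n₄) (+-comm 1 h) (s≤n _)))
      (cong (λ s → n₁ * ((s * n₂ * n₃ + n₄) ∸ ((n₂ ∸ 1) * (n₃ ∸ 1) + s))) (+-comm h 1))
    module Three = MainFamily 0 h (n ∘ fsuc) (h+4≤n ∘ fsuc)
    alt-family : Σ (Family n) λ F → Admissible s F × size F ≡ alt
    alt-family = cylinder Three.family ,
      cylinder-admissible Three.family (≤-trans (s≤s (s≤s (m≤n+m h 2))) (h+4≤n fzero)) Three.family-admissible ,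
      trans (cylinder-size {n = n} Three.family) (cong (n₁ *_) (trans Three.family-size
        (cong₂ (λ x y → (x + n₄) ∸ (y + s))
          (trans (cong (λ y → s * (n₂ * y)) (*-identityʳ n₃)) (sym (*-assoc s n₂ n₃)))
          (cong ((n₂ ∸ 1) *_) (*-identityʳ (n₃ ∸ 1))))))
    attained : Σ (Family n) λ F → Admissible s F × size F ≡ main ⊔ alt
    attained with ⊔-sel main alt
    ... | inj₁ e = let F , adm , eq = main-family in F , adm , trans eq (sym e)
    ... | inj₂ e = let F , adm , eq = alt-family in F , adm , trans eq (sym e)

theorem3p4 : ∀ (k : ℕ) → 3 ≤ suc k → ∀ (s : ℕ) → 1 ≤ s →
    Σ ℕ λ p → Σ ℕ λ q → Σ ℕ λ N → 1 ≤ p × 1 ≤ q × 1 ≤ N ×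
    (∀ (n : Fin (suc k) → ℕ) →
    (∀ (i j : Fin (suc k)) → i ≤ᶠ j → n j ≤ n i) →
    N ≤ n (fromℕ k) →
    s < n (fromℕ k) →
    q * n Fin.zero ≤ (q + p) * n (fromℕ k) →
    (suc k ≢ 4 → M0Is s n (mainBound k s n))
    × ((e : suc k ≡ 4) → M0Is s n (mainBound k s n ⊔ altBound4 s (λ i → n (cast (sym e) i)))))
theorem3p4 (suc zero)    (s≤s (s≤s ()))
theorem3p4 (suc (suc k)) _ zero    ()
theorem3p4 (suc (suc k)) _ (suc h) _ =
  -- δ is the fraction 1/q; one pair of constants serves both r = 4 and r different from 4.
  1 , Constants.q k (suc h) , Constants.N₀ k (suc h) , ≤-refl , Constants.1≤q k (suc h) ,
  ≤-trans (s≤s z≤n) (m≤n+m (3 + suc h) _) ,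
  λ n antitone N₀≤m _ qb≤ → m₀-main k h n antitone N₀≤m qb≤ , m₀-four k h n antitone N₀≤m qb≤
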